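{- If the signature $\Sigma$ and the context $\Gamma$ are in canonical form and $\Gamma\vdash M:A$, then there exist unique canonical $A'$ and $M'$ such that $\Gamma\vdash A=A':\mathrm{type}$ and $\Gamma\vdash M=M':A'$.
   Context: **Syntax of $\lambda^{\Pi N}$.** Fix countable, pairwise disjoint sets of variables $x,y$, names $\mathsf a,\mathsf b$, object constants $c$, type constants $a$, and name-type constants $\alpha,\beta$. Kinds: $K::=\mathrm{type}\mid\Pi x{:}A.K$. Types (type families): $A,B::=a\mid A\,M\mid\Pi x{:}A.B\mid\alpha\mid\mathrm{New}\,\mathsf a{:}\alpha.B$. Objects: $M,N::=c\mid x\mid\lambda x{:}A.M\mid M\,N\mid\mathsf a\mid\langle\mathsf a{:}\alpha\rangle M\mid M@\mathsf a$. Signatures: $\Sigma::=\cdot\mid\Sigma,c{:}A\mid\Sigma,a{:}K\mid\Sigma,\alpha{:}\mathrm{name}$. Contexts: $\Gamma::=\cdot\mid\Gamma,x{:}A\mid\Gamma\#\mathsf a{:}\alpha$. $\Pi,\lambda$ bind $x$; $\mathrm{New}$ and $\langle\mathsf a{:}\alpha\rangle$ bind $\mathsf a$; expressions are identified up to renaming of bound variables and names, and $[M/x]$, $[\mathsf b/\mathsf a]$ are capture-avoiding. Items declared in a signature or context are distinct. All judgments except signature formation are implicitly parametrized by a signature $\Sigma$; signatures and contexts are implicitly well-formed and bound variables/names implicitly fresh. **Restriction** $\Gamma\vdash\mathsf a{:}\alpha\backslash\Gamma'$ (inductively): $\Gamma\#\mathsf a{:}\alpha\vdash\mathsf a{:}\alpha\backslash\Gamma$;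 if $\Gamma\vdash\mathsf a{:}\alpha\backslash\Gamma'$ then $\Gamma\#\mathsf b{:}\beta\vdash\mathsf a{:}\alpha\backslash\Gamma'\#\mathsf b{:}\beta$ and $\Gamma,x{:}A\vdash\mathsf a{:}\alpha\backslash\Gamma'$. **Formation.** Signatures: $\cdot$ is well-formed; a well-formed $\Sigma$ may be extended by $a{:}K$ if $\cdot\vdash K:\mathrm{kind}$, by $c{:}A$ if $\cdot\vdash A:\mathrm{type}$, by $\alpha{:}\mathrm{name}$ always. Contexts: $\cdot$ is well-formed; a well-formed $\Gamma$ may be extended by $x{:}A$ if $\Gamma\vdash A:\mathrm{type}$, by $\#\mathsf a{:}\alpha$ if $\alpha{:}\mathrm{name}\in\Sigma$. Kinds: $\Gamma\vdash\mathrm{type}:\mathrm{kind}$; if $\Gamma\vdash A:\mathrm{type}$ and $\Gamma,x{:}A\vdash K:\mathrm{kind}$ then $\Gamma\vdash\Pi x{:}A.K:\mathrm{kind}$. Types: $\Gamma\vdash a:K$ if $a{:}K\in\Sigma$; $\Gamma\vdash A\,M:K[M/x]$ if $\Gamma\vdash A:\Pi x{:}B.K$ and $\Gamma\vdash M:B$; $\Gamma\vdash\Pi x{:}A.B:\mathrm{type}$ if $\Gamma\vdash A:\mathrm{type}$ and $\Gamma,x{:}A\vdash B:\mathrm{type}$; $\Gamma\vdash\alpha:\mathrm{type}$ if $\alpha{:}\mathrm{name}\in\Sigma$; $\Gamma\vdash\mathrm{New}\,\mathsf a{:}\alpha.B:\mathrm{type}$ if $\alpha{:}\mathrm{name}\in\Sigma$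 and $\Gamma\#\mathsf a{:}\alpha\vdash B:\mathrm{type}$; conversion: $\Gamma\vdash A:K'$ and $\Gamma\vdash K=K':\mathrm{kind}$ give $\Gamma\vdash A:K$. Objects: $\Gamma\vdash c:A$ if $c{:}A\in\Sigma$; $\Gamma\vdash x:A$ if $x{:}A\in\Gamma$; $\Gamma\vdash\mathsf a:\alpha$ if $\mathsf a{:}\alpha\in\Gamma$; $\Gamma\vdash\lambda x{:}A.M:\Pi x{:}A.B$ if $\Gamma\vdash A:\mathrm{type}$ and $\Gamma,x{:}A\vdash M:B$; $\Gamma\vdash M\,N:B[N/x]$ if $\Gamma\vdash M:\Pi x{:}A.B$ and $\Gamma\vdash N:A$; $\Gamma\vdash\langle\mathsf a{:}\alpha\rangle M:\mathrm{New}\,\mathsf a{:}\alpha.B$ if $\alpha{:}\mathrm{name}\in\Sigma$ and $\Gamma\#\mathsf a{:}\alpha\vdash M:B$; $\Gamma\vdash M@\mathsf a:B$ if $\Gamma\vdash\mathsf a{:}\alpha\backslash\Gamma'$ and $\Gamma'\vdash M:\mathrm{New}\,\mathsf a{:}\alpha.B$; conversion: $\Gamma\vdash M:A$ and $\Gamma\vdash A=B:\mathrm{type}$ give $\Gamma\vdash M:B$. **Definitional equality.** Standard LF rules. At each of the three levels: symmetry and transitivity; at the object (type) level conversion along an equal type (kind). Kinds: $\mathrm{type}=\mathrm{type}$; $\Pi x{:}A.K=\Pi x{:}B.L$ if $\Gamma\vdash A:\mathrm{type}$, $\Gamma\vdash A=B:\mathrm{type}$ and $\Gamma,x{:}A\vdash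 K=L:\mathrm{kind}$. Types: $a=a:K$ if $a{:}K\in\Sigma$; $A\,M=B\,N:K[M/x]$ if $A=B:\Pi x{:}C.K$ and $M=N:C$; $\Pi x{:}A_1.A_2=\Pi x{:}B_1.B_2:\mathrm{type}$ if $\Gamma\vdash A_1:\mathrm{type}$, $A_1=B_1:\mathrm{type}$ and $\Gamma,x{:}A_1\vdash A_2=B_2:\mathrm{type}$. Objects: $x=x:A$ and $c=c:A$ for declared $x{:}A$, $c{:}A$; $M_1M_2=N_1N_2:B[M_2/x]$ if $M_1=N_1:\Pi x{:}A.B$ and $M_2=N_2:A$; $\lambda x{:}A'.M=\lambda x{:}A''.N:\Pi x{:}A.B$ if $A'=A:\mathrm{type}$, $A''=A:\mathrm{type}$ and $\Gamma,x{:}A\vdash M=N:B$; $(\lambda x{:}A.M_2)M_1=N_2[N_1/x]:B[M_1/x]$ if $\Gamma\vdash A:\mathrm{type}$, $\Gamma,x{:}A\vdash M_2=N_2:B$ and $M_1=N_1:A$; $M=N:\Pi x{:}A.B$ if $\Gamma\vdash A:\mathrm{type}$, $\Gamma\vdash M:\Pi x{:}A.B$, $\Gamma\vdash N:\Pi x{:}A.B$ and $\Gamma,x{:}A\vdash M\,x=N\,x:B$. Additional rules: $A_1=A_2:\Pi x{:}B.K$ if $\Gamma,x{:}B\vdash A_1\,x=A_2\,x:K$; $\alpha=\alpha:\mathrm{type}$ if $\alpha{:}\mathrm{name}\in\Sigma$; $\mathrm{New}\,\mathsf a{:}\alpha.A=\mathrm{New}\,\mathsf a{:}\alpha.B:\mathrm{type}$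 if $\Gamma\#\mathsf a{:}\alpha\vdash A=B:\mathrm{type}$; $\mathsf a=\mathsf a:\alpha$ if $\mathsf a{:}\alpha\in\Gamma$; $\langle\mathsf a{:}\alpha\rangle M=\langle\mathsf a{:}\alpha\rangle N:\mathrm{New}\,\mathsf a{:}\alpha.A$ if $\Gamma\#\mathsf a{:}\alpha\vdash M=N:A$; $M@\mathsf b=N@\mathsf b:A[\mathsf b/\mathsf a]$ if $\Gamma\vdash\mathsf b{:}\alpha\backslash\Gamma'$ and $\Gamma'\vdash M=N:\mathrm{New}\,\mathsf a{:}\alpha.A$; $(\langle\mathsf a{:}\alpha\rangle M)@\mathsf b=N[\mathsf b/\mathsf a]:A[\mathsf b/\mathsf a]$ if $\Gamma\vdash\mathsf b{:}\alpha\backslash\Gamma'$ and $\Gamma'\#\mathsf a{:}\alpha\vdash M=N:A$; $M=N:\mathrm{New}\,\mathsf a{:}\alpha.A$ if $\Gamma\#\mathsf a{:}\alpha\vdash M@\mathsf a=N@\mathsf a:A$. **Canonical form.** An expression is in canonical form if it (including its type annotations) is $\beta$-normal and cannot be $\eta$-expanded without introducing a $\beta$-redex. Here $\beta$-redexes are $(\lambda x{:}A.M)N$ and $(\langle\mathsf a{:}\alpha\rangle M)@\mathsf b$, and $\eta$-expansion replaces an object $M$ of type $\Pi x{:}A.B$ by $\lambda x{:}A.M\,x$, and of type $\mathrm{New}\,\mathsf a{:}\alpha.B$ by $\langle\mathsf a{:}\alpha\rangle(M@\mathsf a)$. A signature or context is in canonical form if all types and kinds in it are. Uniqueness is syntactic,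 up to renaming of bound variables and names. -}

module Defs where

open import Data.List.Base using (List; []; _∷_)
open import Data.List.Membership.Propositional using (_∈_; _∉_)
open import Data.List.Relation.Binary.Sublist.Propositional
  using (_⊆_; []; _∷_; _∷ʳ_; ⊆-refl; minimum; lookup)
open import Data.List.Relation.Unary.Any using (here; there)
open import Data.Nat.Base using (ℕ)
open import Data.Product.Base using (_×_)
open import Relation.Binary.PropositionalEquality using (_≡_; refl)
open import Relation.Nullary using (¬_)

-- Well-scoped de Bruijn: variables and names share one index
-- space, and a scope records which of its entries are variables and which
-- are names.  Syntactic equality up to renaming of bound variables and
-- names is therefore _≡_.

data Sort : Set where
  var nm : Sort

Scope : Set
Scope = List Sort

ObjConst TyConst NameTy : Set
ObjConst = ℕ
TyConst  = ℕ
NameTy   = ℕ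

infix  9 `_
infixl 8 _·_ _＠_
infixr 6 ⟨_⟩_

mutual

  data Ty (s : Scope) : Set where
    con  : TyConst → Ty s
    _·_  : Ty s → Obj s → Ty s
    Π    : Ty s → Ty (var ∷ s) → Ty s
    name : NameTy → Ty s
    New  : NameTy → Ty (nm ∷ s) → Ty s

  data Obj (s : Scope) : Set where
    con  : ObjConst → Obj s
    `_   : var ∈ s → Obj s
    ƛ    : Ty s → Obj (var ∷ s) → Obj s
    _·_  : Obj s → Obj s → Obj s
    nm   : nm ∈ s → Obj s
    ⟨_⟩_ : NameTy → Obj (nm ∷ s) → Obj s
    _＠_ : Obj s → nm ∈ s → Obj s

data Kind (s : Scope) : Set where
  type : Kind s
  Π    : Ty s → Kind (var ∷ s) → Kind s

data Decl : Set where
  obj  : ObjConst → Ty [] → Decl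
  fam  : TyConst → Kind [] → Decl
  name : NameTy → Decl

-- The most recent declaration is the head of the list.
Sig : Set
Sig = List Decl

infixl 5 _,_ _#_

data Ctx : Scope → Set where
  ∙   : Ctx []
  _,_ : ∀ {s} → Ctx s → Ty s → Ctx (var ∷ s)
  _#_ : ∀ {s} → Ctx s → NameTy → Ctx (nm ∷ s)

mutual

  renᵗ : ∀ {s t} → s ⊆ t → Ty s → Ty t
  renᵗ θ (con a)   = con a
  renᵗ θ (A · M)   = renᵗ θ A · renᵒ θ M
  renᵗ θ (Π A B)   = Π (renᵗ θ A) (renᵗ (refl ∷ θ) B)
  renᵗ θ (name α)  = name α
  renᵗ θ (New α B) = New α (renᵗ (refl ∷ θ) B)

  renᵒ : ∀ {s t} → s ⊆ t → Obj s → Obj t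
  renᵒ θ (con c)   = con c
  renᵒ θ (` x)     = ` lookup θ x
  renᵒ θ (ƛ A M)   = ƛ (renᵗ θ A) (renᵒ (refl ∷ θ) M)
  renᵒ θ (M · N)   = renᵒ θ M · renᵒ θ N
  renᵒ θ (nm a)    = nm (lookup θ a)
  renᵒ θ (⟨ α ⟩ M) = ⟨ α ⟩ renᵒ (refl ∷ θ) M
  renᵒ θ (M ＠ a)  = renᵒ θ M ＠ lookup θ a

renᵏ : ∀ {s t} → s ⊆ t → Kind s → Kind t
renᵏ θ type    = type
renᵏ θ (Π A K) = Π (renᵗ θ A) (renᵏ (refl ∷ θ) K)

weaken : ∀ {k : Sort} {s} → s ⊆ k ∷ s
weaken {k} = k ∷ʳ ⊆-refl

-- Objects are substituted for variables, but only names for names.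
Image : Sort → Scope → Set
Image var s = Obj s
Image nm  s = nm ∈ s

Sub : Scope → Scope → Set
Sub s t = ∀ {k} → k ∈ s → Image k t

index : ∀ {k s} → k ∈ s → Image k s
index {var} x = ` x
index {nm}  a = a

renⁱ : ∀ {k s t} → s ⊆ t → Image k s → Image k t
renⁱ {var} θ M = renᵒ θ M
renⁱ {nm}  θ a = lookup θ a

lift : ∀ {k s t} → Sub s t → Sub (k ∷ s) (k ∷ t)
lift σ (here refl) = index (here refl)
lift {k = k} σ {l} (there i) = renⁱ {l} (weaken {k}) (σ i)

mutual

  subᵗ : ∀ {s t} → Sub s t → Ty s → Ty t
  subᵗ σ (con a)   = con a
  subᵗ σ (A · M)   = subᵗ σ A · subᵒ σ M
  subᵗ σ (Π A B)   = Π (subᵗ σ A) (subᵗ (lift σ) B)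
  subᵗ σ (name α)  = name α
  subᵗ σ (New α B) = New α (subᵗ (lift σ) B)

  subᵒ : ∀ {s t} → Sub s t → Obj s → Obj t
  subᵒ σ (con c)   = con c
  subᵒ σ (` x)     = σ x
  subᵒ σ (ƛ A M)   = ƛ (subᵗ σ A) (subᵒ (lift σ) M)
  subᵒ σ (M · N)   = subᵒ σ M · subᵒ σ N
  subᵒ σ (nm a)    = nm (σ a)
  subᵒ σ (⟨ α ⟩ M) = ⟨ α ⟩ subᵒ (lift σ) M
  subᵒ σ (M ＠ a)  = subᵒ σ M ＠ σ a

subᵏ : ∀ {s t} → Sub s t → Kind s → Kind t
subᵏ σ type    = type
subᵏ σ (Π A K) = Π (subᵗ σ A) (subᵏ (lift σ) K)

single : ∀ {k s} → Image k s → Sub (k ∷ s) s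
single i (here refl) = i
single i (there j)   = index j

infix 7 _[_]ᵏ _[_]ᵗ _[_]ᵒ _[#_]ᵗ _[#_]ᵒ

_[_]ᵏ : ∀ {s} → Kind (var ∷ s) → Obj s → Kind s
K [ M ]ᵏ = subᵏ (single M) K

_[_]ᵗ : ∀ {s} → Ty (var ∷ s) → Obj s → Ty s
A [ M ]ᵗ = subᵗ (single M) A

_[_]ᵒ : ∀ {s} → Obj (var ∷ s) → Obj s → Obj s
N [ M ]ᵒ = subᵒ (single M) N

_[#_]ᵗ : ∀ {s} → Ty (nm ∷ s) → nm ∈ s → Ty s
A [# b ]ᵗ = subᵗ (single b) A

_[#_]ᵒ : ∀ {s} → Obj (nm ∷ s) → nm ∈ s → Obj s
M [# b ]ᵒ = subᵒ (single b) M

infix 4 _∋_∶_ _∋#_∶_ _⊢_∶_╲_via_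

data _∋_∶_ : ∀ {s} → Ctx s → var ∈ s → Ty s → Set where
  here    : ∀ {s} {Γ : Ctx s} {A} → Γ , A ∋ here refl ∶ renᵗ weaken A
  there   : ∀ {s} {Γ : Ctx s} {x A B} →
            Γ ∋ x ∶ A → Γ , B ∋ there x ∶ renᵗ weaken A
  there#  : ∀ {s} {Γ : Ctx s} {x A β} →
            Γ ∋ x ∶ A → Γ # β ∋ there x ∶ renᵗ weaken A

data _∋#_∶_ : ∀ {s} → Ctx s → nm ∈ s → NameTy → Set where
  here    : ∀ {s} {Γ : Ctx s} {α} → Γ # α ∋# here refl ∶ α
  there   : ∀ {s} {Γ : Ctx s} {a α B} →
            Γ ∋# a ∶ α → Γ , B ∋# there a ∶ α
  there#  : ∀ {s} {Γ : Ctx s} {a α β} →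
            Γ ∋# a ∶ α → Γ # β ∋# there a ∶ α

-- The embedding of the scope of the restricted context Γ′ into that of Γ is
-- what makes an expression over Γ′ also one over Γ.
data _⊢_∶_╲_via_ : ∀ {s s′} →
       Ctx s → nm ∈ s → NameTy → Ctx s′ → s′ ⊆ s → Set where
  here   : ∀ {s} {Γ : Ctx s} {α} → Γ # α ⊢ here refl ∶ α ╲ Γ via weaken
  there# : ∀ {s s′} {Γ : Ctx s} {Γ′ : Ctx s′} {θ a α β} →
           Γ ⊢ a ∶ α ╲ Γ′ via θ →
           Γ # β ⊢ there a ∶ α ╲ Γ′ # β via (refl ∷ θ)
  there  : ∀ {s s′} {Γ : Ctx s} {Γ′ : Ctx s′} {θ a α A} →
           Γ ⊢ a ∶ α ╲ Γ′ via θ →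
           Γ , A ⊢ there a ∶ α ╲ Γ′ via (var ∷ʳ θ)

-- Contexts are implicitly well-formed in every judgment: a rule with a
-- premise over an extended context carries the premise making that extension
-- well-formed whenever it does not already follow from well-formedness of
-- the context of the conclusion.  Well-formedness of the signature and of
-- the ambient context is assumed where the judgments are used.

infix 3 _⨾_⊢ᵏ_ _⨾_⊢ᵗ_∶_ _⨾_⊢ᵒ_∶_ _⨾_⊢ᵏ_≈_ _⨾_⊢ᵗ_≈_∶_ _⨾_⊢ᵒ_≈_∶_

mutual

  data _⨾_⊢ᵏ_ (Σ : Sig) {s} (Γ : Ctx s) : Kind s → Set where
    type : Σ ⨾ Γ ⊢ᵏ type
    Π    : ∀ {A K} → Σ ⨾ Γ ⊢ᵗ A ∶ type → Σ ⨾ Γ , A ⊢ᵏ K → Σ ⨾ Γ ⊢ᵏ Π A K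

  data _⨾_⊢ᵗ_∶_ (Σ : Sig) {s} (Γ : Ctx s) : Ty s → Kind s → Set where
    con  : ∀ {a K} → fam a K ∈ Σ → Σ ⨾ Γ ⊢ᵗ con a ∶ renᵏ (minimum s) K
    app  : ∀ {A B K M} →
           Σ ⨾ Γ ⊢ᵗ A ∶ Π B K → Σ ⨾ Γ ⊢ᵒ M ∶ B →
           Σ ⨾ Γ ⊢ᵗ A · M ∶ K [ M ]ᵏ
    Π    : ∀ {A B} →
           Σ ⨾ Γ ⊢ᵗ A ∶ type → Σ ⨾ Γ , A ⊢ᵗ B ∶ type →
           Σ ⨾ Γ ⊢ᵗ Π A B ∶ type
    name : ∀ {α} → name α ∈ Σ → Σ ⨾ Γ ⊢ᵗ name α ∶ type
    New  : ∀ {α B} →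
           name α ∈ Σ → Σ ⨾ Γ # α ⊢ᵗ B ∶ type → Σ ⨾ Γ ⊢ᵗ New α B ∶ type
    conv : ∀ {A K K′} →
           Σ ⨾ Γ ⊢ᵗ A ∶ K′ → Σ ⨾ Γ ⊢ᵏ K ≈ K′ → Σ ⨾ Γ ⊢ᵗ A ∶ K

  data _⨾_⊢ᵒ_∶_ (Σ : Sig) {s} (Γ : Ctx s) : Obj s → Ty s → Set where
    con  : ∀ {c A} → obj c A ∈ Σ → Σ ⨾ Γ ⊢ᵒ con c ∶ renᵗ (minimum s) A
    var  : ∀ {x A} → Γ ∋ x ∶ A → Σ ⨾ Γ ⊢ᵒ ` x ∶ A
    nm   : ∀ {a α} → Γ ∋# a ∶ α → Σ ⨾ Γ ⊢ᵒ nm a ∶ name α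
    lam  : ∀ {A B M} →
           Σ ⨾ Γ ⊢ᵗ A ∶ type → Σ ⨾ Γ , A ⊢ᵒ M ∶ B →
           Σ ⨾ Γ ⊢ᵒ ƛ A M ∶ Π A B
    app  : ∀ {A B M N} →
           Σ ⨾ Γ ⊢ᵒ M ∶ Π A B → Σ ⨾ Γ ⊢ᵒ N ∶ A →
           Σ ⨾ Γ ⊢ᵒ M · N ∶ B [ N ]ᵗ
    abs  : ∀ {α B M} →
           name α ∈ Σ → Σ ⨾ Γ # α ⊢ᵒ M ∶ B →
           Σ ⨾ Γ ⊢ᵒ ⟨ α ⟩ M ∶ New α B
    conc : ∀ {s′} {Γ′ : Ctx s′} {θ a α B M} →
           Γ ⊢ a ∶ α ╲ Γ′ via θ → Σ ⨾ Γ′ ⊢ᵒ M ∶ New α B →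
           Σ ⨾ Γ ⊢ᵒ renᵒ θ M ＠ a ∶ renᵗ (refl ∷ θ) B [# a ]ᵗ
    conv : ∀ {A B M} →
           Σ ⨾ Γ ⊢ᵒ M ∶ A → Σ ⨾ Γ ⊢ᵗ A ≈ B ∶ type → Σ ⨾ Γ ⊢ᵒ M ∶ B

  data _⨾_⊢ᵏ_≈_ (Σ : Sig) {s} (Γ : Ctx s) : Kind s → Kind s → Set where
    ≈-sym   : ∀ {K L} → Σ ⨾ Γ ⊢ᵏ K ≈ L → Σ ⨾ Γ ⊢ᵏ L ≈ K
    ≈-trans : ∀ {J K L} →
              Σ ⨾ Γ ⊢ᵏ J ≈ K → Σ ⨾ Γ ⊢ᵏ K ≈ L → Σ ⨾ Γ ⊢ᵏ J ≈ L
    type    : Σ ⨾ Γ ⊢ᵏ type ≈ type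
    Π       : ∀ {A B K L} →
              Σ ⨾ Γ ⊢ᵗ A ∶ type → Σ ⨾ Γ ⊢ᵗ A ≈ B ∶ type →
              Σ ⨾ Γ , A ⊢ᵏ K ≈ L →
              Σ ⨾ Γ ⊢ᵏ Π A K ≈ Π B L

  data _⨾_⊢ᵗ_≈_∶_ (Σ : Sig) {s} (Γ : Ctx s) : Ty s → Ty s → Kind s → Set where
    ≈-sym   : ∀ {A B K} → Σ ⨾ Γ ⊢ᵗ A ≈ B ∶ K → Σ ⨾ Γ ⊢ᵗ B ≈ A ∶ K
    ≈-trans : ∀ {A B C K} →
              Σ ⨾ Γ ⊢ᵗ A ≈ B ∶ K → Σ ⨾ Γ ⊢ᵗ B ≈ C ∶ K → Σ ⨾ Γ ⊢ᵗ A ≈ C ∶ K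
    conv    : ∀ {A B K L} →
              Σ ⨾ Γ ⊢ᵗ A ≈ B ∶ K → Σ ⨾ Γ ⊢ᵏ K ≈ L → Σ ⨾ Γ ⊢ᵗ A ≈ B ∶ L
    con     : ∀ {a K} →
              fam a K ∈ Σ → Σ ⨾ Γ ⊢ᵗ con a ≈ con a ∶ renᵏ (minimum s) K
    app     : ∀ {A B C K M N} →
              Σ ⨾ Γ ⊢ᵗ A ≈ B ∶ Π C K → Σ ⨾ Γ ⊢ᵒ M ≈ N ∶ C →
              Σ ⨾ Γ ⊢ᵗ A · M ≈ B · N ∶ K [ M ]ᵏ
    Π       : ∀ {A₁ A₂ B₁ B₂} →
              Σ ⨾ Γ ⊢ᵗ A₁ ∶ type → Σ ⨾ Γ ⊢ᵗ A₁ ≈ B₁ ∶ type →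
              Σ ⨾ Γ , A₁ ⊢ᵗ A₂ ≈ B₂ ∶ type →
              Σ ⨾ Γ ⊢ᵗ Π A₁ A₂ ≈ Π B₁ B₂ ∶ type
    ext     : ∀ {A₁ A₂ B K} →
              Σ ⨾ Γ ⊢ᵗ B ∶ type →
              Σ ⨾ Γ , B ⊢ᵗ renᵗ weaken A₁ · (` here refl) ≈
                           renᵗ weaken A₂ · (` here refl) ∶ K →
              Σ ⨾ Γ ⊢ᵗ A₁ ≈ A₂ ∶ Π B K
    name    : ∀ {α} → name α ∈ Σ → Σ ⨾ Γ ⊢ᵗ name α ≈ name α ∶ type
    New     : ∀ {α A B} →
              name α ∈ Σ → Σ ⨾ Γ # α ⊢ᵗ A ≈ B ∶ type →
              Σ ⨾ Γ ⊢ᵗ New α A ≈ New α B ∶ type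

  data _⨾_⊢ᵒ_≈_∶_ (Σ : Sig) {s} (Γ : Ctx s) : Obj s → Obj s → Ty s → Set where
    ≈-sym   : ∀ {M N A} → Σ ⨾ Γ ⊢ᵒ M ≈ N ∶ A → Σ ⨾ Γ ⊢ᵒ N ≈ M ∶ A
    ≈-trans : ∀ {M N P A} →
              Σ ⨾ Γ ⊢ᵒ M ≈ N ∶ A → Σ ⨾ Γ ⊢ᵒ N ≈ P ∶ A → Σ ⨾ Γ ⊢ᵒ M ≈ P ∶ A
    conv    : ∀ {M N A B} →
              Σ ⨾ Γ ⊢ᵒ M ≈ N ∶ A → Σ ⨾ Γ ⊢ᵗ A ≈ B ∶ type → Σ ⨾ Γ ⊢ᵒ M ≈ N ∶ B
    var     : ∀ {x A} → Γ ∋ x ∶ A → Σ ⨾ Γ ⊢ᵒ ` x ≈ ` x ∶ A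
    con     : ∀ {c A} →
              obj c A ∈ Σ → Σ ⨾ Γ ⊢ᵒ con c ≈ con c ∶ renᵗ (minimum s) A
    app     : ∀ {A B M₁ M₂ N₁ N₂} →
              Σ ⨾ Γ ⊢ᵒ M₁ ≈ N₁ ∶ Π A B → Σ ⨾ Γ ⊢ᵒ M₂ ≈ N₂ ∶ A →
              Σ ⨾ Γ ⊢ᵒ M₁ · M₂ ≈ N₁ · N₂ ∶ B [ M₂ ]ᵗ
    lam     : ∀ {A A′ A″ B M N} →
              Σ ⨾ Γ ⊢ᵗ A ∶ type →
              Σ ⨾ Γ ⊢ᵗ A′ ≈ A ∶ type → Σ ⨾ Γ ⊢ᵗ A″ ≈ A ∶ type →
              Σ ⨾ Γ , A ⊢ᵒ M ≈ N ∶ B →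
              Σ ⨾ Γ ⊢ᵒ ƛ A′ M ≈ ƛ A″ N ∶ Π A B
    β       : ∀ {A B M₁ M₂ N₁ N₂} →
              Σ ⨾ Γ ⊢ᵗ A ∶ type →
              Σ ⨾ Γ , A ⊢ᵒ M₂ ≈ N₂ ∶ B → Σ ⨾ Γ ⊢ᵒ M₁ ≈ N₁ ∶ A →
              Σ ⨾ Γ ⊢ᵒ ƛ A M₂ · M₁ ≈ N₂ [ N₁ ]ᵒ ∶ B [ M₁ ]ᵗ
    ext     : ∀ {A B M N} →
              Σ ⨾ Γ ⊢ᵗ A ∶ type → Σ ⨾ Γ ⊢ᵒ M ∶ Π A B → Σ ⨾ Γ ⊢ᵒ N ∶ Π A B →
              Σ ⨾ Γ , A ⊢ᵒ renᵒ weaken M · (` here refl) ≈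
                           renᵒ weaken N · (` here refl) ∶ B →
              Σ ⨾ Γ ⊢ᵒ M ≈ N ∶ Π A B
    nm      : ∀ {a α} → Γ ∋# a ∶ α → Σ ⨾ Γ ⊢ᵒ nm a ≈ nm a ∶ name α
    abs     : ∀ {α A M N} →
              name α ∈ Σ → Σ ⨾ Γ # α ⊢ᵒ M ≈ N ∶ A →
              Σ ⨾ Γ ⊢ᵒ ⟨ α ⟩ M ≈ ⟨ α ⟩ N ∶ New α A
    conc    : ∀ {s′} {Γ′ : Ctx s′} {θ b α A M N} →
              Γ ⊢ b ∶ α ╲ Γ′ via θ → Σ ⨾ Γ′ ⊢ᵒ M ≈ N ∶ New α A →
              Σ ⨾ Γ ⊢ᵒ renᵒ θ M ＠ b ≈ renᵒ θ N ＠ b ∶ renᵗ (refl ∷ θ) A [# b ]ᵗ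
    β#      : ∀ {s′} {Γ′ : Ctx s′} {θ b α A M N} →
              Γ ⊢ b ∶ α ╲ Γ′ via θ → Σ ⨾ Γ′ # α ⊢ᵒ M ≈ N ∶ A →
              Σ ⨾ Γ ⊢ᵒ renᵒ θ (⟨ α ⟩ M) ＠ b ≈ renᵒ (refl ∷ θ) N [# b ]ᵒ
                     ∶ renᵗ (refl ∷ θ) A [# b ]ᵗ
    ext#    : ∀ {α A M N} →
              name α ∈ Σ →
              Σ ⨾ Γ # α ⊢ᵒ renᵒ weaken M ＠ here refl ≈
                           renᵒ weaken N ＠ here refl ∶ A →
              Σ ⨾ Γ ⊢ᵒ M ≈ N ∶ New α A

infix 3 ⊢_sig _⊢_ctx

data ⊢_sig : Sig → Set where
  []   : ⊢ [] sig
  fam  : ∀ {Σ a K} →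
         ⊢ Σ sig → (∀ {L} → fam a L ∉ Σ) → Σ ⨾ ∙ ⊢ᵏ K → ⊢ fam a K ∷ Σ sig
  obj  : ∀ {Σ c A} →
         ⊢ Σ sig → (∀ {B} → obj c B ∉ Σ) → Σ ⨾ ∙ ⊢ᵗ A ∶ type →
         ⊢ obj c A ∷ Σ sig
  name : ∀ {Σ α} → ⊢ Σ sig → name α ∉ Σ → ⊢ name α ∷ Σ sig

data _⊢_ctx (Σ : Sig) : ∀ {s} → Ctx s → Set where
  ∙   : Σ ⊢ ∙ ctx
  _,_ : ∀ {s} {Γ : Ctx s} {A} →
        Σ ⊢ Γ ctx → Σ ⨾ Γ ⊢ᵗ A ∶ type → Σ ⊢ Γ , A ctx
  _#_ : ∀ {s} {Γ : Ctx s} {α} →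
        Σ ⊢ Γ ctx → name α ∈ Σ → Σ ⊢ Γ # α ctx

mutual

  data HasRedexᵗ {s} : Ty s → Set where
    app₁ : ∀ {A M} → HasRedexᵗ A → HasRedexᵗ (A · M)
    app₂ : ∀ {A M} → HasRedexᵒ M → HasRedexᵗ (A · M)
    Π₁   : ∀ {A B} → HasRedexᵗ A → HasRedexᵗ (Π A B)
    Π₂   : ∀ {A B} → HasRedexᵗ B → HasRedexᵗ (Π A B)
    New  : ∀ {α B} → HasRedexᵗ B → HasRedexᵗ (New α B)

  data HasRedexᵒ {s} : Obj s → Set where
    β    : ∀ {A M N} → HasRedexᵒ (ƛ A M · N)
    β#   : ∀ {α M b} → HasRedexᵒ ((⟨ α ⟩ M) ＠ b)
    lam₁ : ∀ {A M} → HasRedexᵗ A → HasRedexᵒ (ƛ A M)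
    lam₂ : ∀ {A M} → HasRedexᵒ M → HasRedexᵒ (ƛ A M)
    app₁ : ∀ {M N} → HasRedexᵒ M → HasRedexᵒ (M · N)
    app₂ : ∀ {M N} → HasRedexᵒ N → HasRedexᵒ (M · N)
    abs  : ∀ {α M} → HasRedexᵒ M → HasRedexᵒ (⟨ α ⟩ M)
    conc : ∀ {M a} → HasRedexᵒ M → HasRedexᵒ (M ＠ a)

data HasRedexᵏ {s} : Kind s → Set where
  Π₁ : ∀ {A K} → HasRedexᵗ A → HasRedexᵏ (Π A K)
  Π₂ : ∀ {A K} → HasRedexᵏ K → HasRedexᵏ (Π A K)

-- η-expansion of one subobject, at a type it has in the context of its
-- occurrence (for M in M ＠ a, the context restricted by a).

infix 3 _⨾_⊢ᵏ_⟶η_ _⨾_⊢ᵗ_⟶η_ _⨾_⊢ᵒ_⟶η_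

mutual

  data _⨾_⊢ᵗ_⟶η_ (Σ : Sig) {s} (Γ : Ctx s) : Ty s → Ty s → Set where
    app₁ : ∀ {A A′ M} → Σ ⨾ Γ ⊢ᵗ A ⟶η A′ → Σ ⨾ Γ ⊢ᵗ A · M ⟶η A′ · M
    app₂ : ∀ {A M M′} → Σ ⨾ Γ ⊢ᵒ M ⟶η M′ → Σ ⨾ Γ ⊢ᵗ A · M ⟶η A · M′
    Π₁   : ∀ {A A′ B} → Σ ⨾ Γ ⊢ᵗ A ⟶η A′ → Σ ⨾ Γ ⊢ᵗ Π A B ⟶η Π A′ B
    Π₂   : ∀ {A B B′} → Σ ⨾ Γ , A ⊢ᵗ B ⟶η B′ → Σ ⨾ Γ ⊢ᵗ Π A B ⟶η Π A B′
    New  : ∀ {α B B′} → Σ ⨾ Γ # α ⊢ᵗ B ⟶η B′ → Σ ⨾ Γ ⊢ᵗ New α B ⟶η New α B′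

  data _⨾_⊢ᵒ_⟶η_ (Σ : Sig) {s} (Γ : Ctx s) : Obj s → Obj s → Set where
    η    : ∀ {A B M} → Σ ⨾ Γ ⊢ᵒ M ∶ Π A B →
           Σ ⨾ Γ ⊢ᵒ M ⟶η ƛ A (renᵒ weaken M · (` here refl))
    η#   : ∀ {α B M} → Σ ⨾ Γ ⊢ᵒ M ∶ New α B →
           Σ ⨾ Γ ⊢ᵒ M ⟶η ⟨ α ⟩ (renᵒ weaken M ＠ here refl)
    lam₁ : ∀ {A A′ M} → Σ ⨾ Γ ⊢ᵗ A ⟶η A′ → Σ ⨾ Γ ⊢ᵒ ƛ A M ⟶η ƛ A′ M
    lam₂ : ∀ {A M M′} → Σ ⨾ Γ , A ⊢ᵒ M ⟶η M′ → Σ ⨾ Γ ⊢ᵒ ƛ A M ⟶η ƛ A M′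
    app₁ : ∀ {M M′ N} → Σ ⨾ Γ ⊢ᵒ M ⟶η M′ → Σ ⨾ Γ ⊢ᵒ M · N ⟶η M′ · N
    app₂ : ∀ {M N N′} → Σ ⨾ Γ ⊢ᵒ N ⟶η N′ → Σ ⨾ Γ ⊢ᵒ M · N ⟶η M · N′
    abs  : ∀ {α M M′} →
           Σ ⨾ Γ # α ⊢ᵒ M ⟶η M′ → Σ ⨾ Γ ⊢ᵒ ⟨ α ⟩ M ⟶η ⟨ α ⟩ M′
    conc : ∀ {s′} {Γ′ : Ctx s′} {θ a α M M′} →
           Γ ⊢ a ∶ α ╲ Γ′ via θ → Σ ⨾ Γ′ ⊢ᵒ M ⟶η M′ →
           Σ ⨾ Γ ⊢ᵒ renᵒ θ M ＠ a ⟶η renᵒ θ M′ ＠ a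

data _⨾_⊢ᵏ_⟶η_ (Σ : Sig) {s} (Γ : Ctx s) : Kind s → Kind s → Set where
  Π₁ : ∀ {A A′ K} → Σ ⨾ Γ ⊢ᵗ A ⟶η A′ → Σ ⨾ Γ ⊢ᵏ Π A K ⟶η Π A′ K
  Π₂ : ∀ {A K K′} → Σ ⨾ Γ , A ⊢ᵏ K ⟶η K′ → Σ ⨾ Γ ⊢ᵏ Π A K ⟶η Π A K′

-- Since the expression itself is β-normal, an η-expansion introduces a
-- β-redex exactly when its result contains one.

Canonicalᵏ : Sig → ∀ {s} → Ctx s → Kind s → Set
Canonicalᵏ Σ Γ K =
  ¬ HasRedexᵏ K × (∀ {K′} → Σ ⨾ Γ ⊢ᵏ K ⟶η K′ → HasRedexᵏ K′)

Canonicalᵗ : Sig → ∀ {s} → Ctx s → Ty s → Set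
Canonicalᵗ Σ Γ A =
  ¬ HasRedexᵗ A × (∀ {A′} → Σ ⨾ Γ ⊢ᵗ A ⟶η A′ → HasRedexᵗ A′)

Canonicalᵒ : Sig → ∀ {s} → Ctx s → Obj s → Set
Canonicalᵒ Σ Γ M =
  ¬ HasRedexᵒ M × (∀ {M′} → Σ ⨾ Γ ⊢ᵒ M ⟶η M′ → HasRedexᵒ M′)

data CanonicalSig : Sig → Set where
  []   : CanonicalSig []
  fam  : ∀ {Σ a K} →
         CanonicalSig Σ → Canonicalᵏ Σ ∙ K → CanonicalSig (fam a K ∷ Σ)
  obj  : ∀ {Σ c A} →
         CanonicalSig Σ → Canonicalᵗ Σ ∙ A → CanonicalSig (obj c A ∷ Σ)
  name : ∀ {Σ α} → CanonicalSig Σ → CanonicalSig (name α ∷ Σ)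

data CanonicalCtx (Σ : Sig) : ∀ {s} → Ctx s → Set where
  ∙   : CanonicalCtx Σ ∙
  _,_ : ∀ {s} {Γ : Ctx s} {A} →
        CanonicalCtx Σ Γ → Canonicalᵗ Σ Γ A → CanonicalCtx Σ (Γ , A)
  _#  : ∀ {s} {Γ : Ctx s} {α} → CanonicalCtx Σ Γ → CanonicalCtx Σ (Γ # α)

{-# OPTIONS --safe #-}

-- Existence: every type in a well-formed signature or context has a normal form, by induction on
-- the declarations, so constants and variables can be η-expanded, and the redexes created by
-- application and concretion are removed by hereditary substitution, which terminates because the
-- simple type of the substituted variable decreases.  Uniqueness: a Kripke logical relation over
-- weak head reduction, indexed by simple types, shows that equal objects have the same η-long normal
-- form up to type annotations.  The annotations are then determined by induction on typing, since
-- objects synthesise unique types and Π is injective.  An object is canonical exactly when it is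
-- β-normal and η-long, because an η-expansion creates a redex just when its subject is an
-- introduction form or the head of an elimination.

module Submission where

open import Data.Empty using (⊥; ⊥-elim)
open import Data.List.Base using (List; []; _∷_)
open import Data.List.Membership.Propositional using (_∈_)
open import Data.List.Properties using (∷-injective)
open import Data.List.Relation.Binary.Sublist.Propositional
  using (_⊆_; []; _∷_; _∷ʳ_; ⊆-refl; ⊆-trans; minimum; lookup)
open import Data.List.Relation.Binary.Sublist.Propositional.Properties
  using (lookup-⊆-refl; lookup-⊆-trans; lookup-injective)
open import Data.List.Relation.Unary.Any using (here; there)
open import Data.Nat.Base as ℕ using (ℕ; suc; _≤_; s≤s)
open import Data.Nat.Properties as ℕ using ()
open import Data.Product using (∃!; _×_; _,_; Σ-syntax; ∃-syntax; proj₁; proj₂)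
open import Data.Sum using (_⊎_; inj₁; inj₂)
open import Relation.Binary.PropositionalEquality
  using (_≡_; refl; sym; trans; cong; cong₂; subst; subst₂)
open import Relation.Nullary using (¬_)
open import Defs hiding (_,_)
open import Defs using () renaming (_,_ to infixl 5 _▸_)

-- Renaming and substitution

-- Two rules shape the development. In `M ＠ a` the object `M` is typed in the context restricted by
-- `a`, so a substitution is usable only if it can be restricted together with its domain. This
-- dictates the form of `SubRel` and requires successive restrictions to be exchanged. Second,
-- extensionality for families and for `New` has no typing premises for the two sides, so regularity
-- must recover their typing by inversion, or settle for families applied to enough variables.
--
-- Simple types can serve as the index throughout because erasure is invariant under both
-- substitution and definitional equality, so that neither hereditary substitution nor the logical
-- relation has to follow dependencies. The two have complementary outputs. Hereditary substitution
-- yields typed normal forms provably equal to the given object. The logical relation lives on raw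
-- objects and never reads the annotation of an abstraction; hence it decides normal forms only up
-- to annotations, and a second, typed induction is needed.

variable
  s t u v : Scope
  k l : Sort

infix 4 _≗_

-- Substitutions are functions and their equality is intensional, so laws about them are pointwise
-- and each traversal of the syntax needs its own congruence lemma.
_≗_ : Sub s t → Sub s t → Set
_≗_ {s} {t} σ τ = ∀ {k} (i : k ∈ s) → σ {k} i ≡ τ {k} i

≗-sym : {σ τ : Sub s t} → σ ≗ τ → τ ≗ σ
≗-sym e i = sym (e i)

≗-trans : {σ τ ρ : Sub s t} → σ ≗ τ → τ ≗ ρ → σ ≗ ρ
≗-trans e f i = trans (e i) (f i)

lift-cong : {σ τ : Sub s t} → σ ≗ τ → lift {k} σ ≗ lift τ
lift-cong e (here refl) = refl
lift-cong {k = k} e {l} (there i) = cong (renⁱ {l} (weaken {k})) (e i)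

mutual
  subᵗ-cong : {σ τ : Sub s t} → σ ≗ τ → (A : Ty s) → subᵗ σ A ≡ subᵗ τ A
  subᵗ-cong e (con a)   = refl
  subᵗ-cong e (A · M)   = cong₂ _·_ (subᵗ-cong e A) (subᵒ-cong e M)
  subᵗ-cong e (Π A B)   = cong₂ Π (subᵗ-cong e A) (subᵗ-cong (lift-cong e) B)
  subᵗ-cong e (name α)  = refl
  subᵗ-cong e (New α B) = cong (New α) (subᵗ-cong (lift-cong e) B)

  subᵒ-cong : {σ τ : Sub s t} → σ ≗ τ → (M : Obj s) → subᵒ σ M ≡ subᵒ τ M
  subᵒ-cong e (con c)   = refl
  subᵒ-cong e (` x)     = e x
  subᵒ-cong e (ƛ A M)   = cong₂ ƛ (subᵗ-cong e A) (subᵒ-cong (lift-cong e) M)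
  subᵒ-cong e (M · N)   = cong₂ _·_ (subᵒ-cong e M) (subᵒ-cong e N)
  subᵒ-cong e (nm a)    = cong nm (e a)
  subᵒ-cong e (⟨ α ⟩ M) = cong (⟨ α ⟩_) (subᵒ-cong (lift-cong e) M)
  subᵒ-cong e (M ＠ a)  = cong₂ _＠_ (subᵒ-cong e M) (e a)

subᵏ-cong : {σ τ : Sub s t} → σ ≗ τ → (K : Kind s) → subᵏ σ K ≡ subᵏ τ K
subᵏ-cong e type    = refl
subᵏ-cong e (Π A K) = cong₂ Π (subᵗ-cong e A) (subᵏ-cong (lift-cong e) K)

-- An embedding seen as a substitution. Once renaming is known to be this special case, composites
-- of renamings with substitutions reduce to the single fusion law `sub-sub`.
ι : s ⊆ t → Sub s t
ι θ {k} i = index {k} (lookup θ i)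

renⁱ-index : (θ : s ⊆ t) (i : k ∈ s) → renⁱ {k} θ (index i) ≡ index (lookup θ i)
renⁱ-index {k = var} θ i = refl
renⁱ-index {k = nm}  θ i = refl

lift-ι : (θ : s ⊆ t) → lift {k} (ι θ) ≗ ι (refl ∷ θ)
lift-ι θ (here refl) = refl
lift-ι θ {k} (there i) =
  trans (renⁱ-index weaken (lookup θ i)) (cong (λ j → index (there j)) (lookup-⊆-refl (lookup θ i)))

mutual
  renᵗ-sub : (θ : s ⊆ t) (A : Ty s) → renᵗ θ A ≡ subᵗ (ι θ) A
  renᵗ-sub θ (con a)   = refl
  renᵗ-sub θ (A · M)   = cong₂ _·_ (renᵗ-sub θ A) (renᵒ-sub θ M)
  renᵗ-sub θ (Π A B)   = cong₂ Π (renᵗ-sub θ A) (trans (renᵗ-sub (refl ∷ θ) B) (sym (subᵗ-cong (lift-ι θ) B)))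
  renᵗ-sub θ (name α)  = refl
  renᵗ-sub θ (New α B) = cong (New α) (trans (renᵗ-sub (refl ∷ θ) B) (sym (subᵗ-cong (lift-ι θ) B)))

  renᵒ-sub : (θ : s ⊆ t) (M : Obj s) → renᵒ θ M ≡ subᵒ (ι θ) M
  renᵒ-sub θ (con c)   = refl
  renᵒ-sub θ (` x)     = refl
  renᵒ-sub θ (ƛ A M)   = cong₂ ƛ (renᵗ-sub θ A) (trans (renᵒ-sub (refl ∷ θ) M) (sym (subᵒ-cong (lift-ι θ) M)))
  renᵒ-sub θ (M · N)   = cong₂ _·_ (renᵒ-sub θ M) (renᵒ-sub θ N)
  renᵒ-sub θ (nm a)    = refl
  renᵒ-sub θ (⟨ α ⟩ M) = cong (⟨ α ⟩_) (trans (renᵒ-sub (refl ∷ θ) M) (sym (subᵒ-cong (lift-ι θ) M)))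
  renᵒ-sub θ (M ＠ a)  = cong (_＠ lookup θ a) (renᵒ-sub θ M)

renᵏ-sub : (θ : s ⊆ t) (K : Kind s) → renᵏ θ K ≡ subᵏ (ι θ) K
renᵏ-sub θ type    = refl
renᵏ-sub θ (Π A K) = cong₂ Π (renᵗ-sub θ A) (trans (renᵏ-sub (refl ∷ θ) K) (sym (subᵏ-cong (lift-ι θ) K)))

subⁱ : Sub s t → Image k s → Image k t
subⁱ {k = var} σ M = subᵒ σ M
subⁱ {k = nm}  σ a = σ a

subⁱ-index : (σ : Sub s t) (i : k ∈ s) → subⁱ {k = k} σ (index i) ≡ σ i
subⁱ-index {k = var} σ i = refl
subⁱ-index {k = nm}  σ i = refl

renⁱ-sub : (θ : s ⊆ t) (i : Image k s) → renⁱ {k} θ i ≡ subⁱ {k = k} (ι θ) i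
renⁱ-sub {k = var} θ M = renᵒ-sub θ M
renⁱ-sub {k = nm}  θ a = refl

subⁱ-cong : {σ τ : Sub s t} → σ ≗ τ → (i : Image k s) → subⁱ {k = k} σ i ≡ subⁱ {k = k} τ i
subⁱ-cong {k = var} e M = subᵒ-cong e M
subⁱ-cong {k = nm}  e a = e a

infixr 9 _⊙_

_⊙_ : Sub t u → Sub s t → Sub s u
(τ ⊙ σ) {k} i = subⁱ {k = k} τ (σ i)

-- Fusion is reached in stages: substitution after renaming, renaming after substitution,
-- substitution after substitution. Since `lift` weakens images, each later stage uses earlier ones
-- to commute with it.
lift-⊙ι : (σ : Sub t u) (θ : s ⊆ t) → (lift {k} σ) ⊙ ι (refl ∷ θ) ≗ lift (σ ⊙ ι θ)
lift-⊙ι σ θ {var} (here refl) = refl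
lift-⊙ι σ θ {nm}  (here refl) = refl
lift-⊙ι σ θ {var} (there i) = refl
lift-⊙ι σ θ {nm} (there i) = refl

mutual
  subᵗ-renᵗ : (σ : Sub t u) (θ : s ⊆ t) (A : Ty s) → subᵗ σ (renᵗ θ A) ≡ subᵗ (σ ⊙ ι θ) A
  subᵗ-renᵗ σ θ (con a)   = refl
  subᵗ-renᵗ σ θ (A · M)   = cong₂ _·_ (subᵗ-renᵗ σ θ A) (subᵒ-renᵒ σ θ M)
  subᵗ-renᵗ σ θ (Π A B)   = cong₂ Π (subᵗ-renᵗ σ θ A)
    (trans (subᵗ-renᵗ (lift σ) (refl ∷ θ) B) (subᵗ-cong (lift-⊙ι σ θ) B))
  subᵗ-renᵗ σ θ (name α)  = refl
  subᵗ-renᵗ σ θ (New α B) = cong (New α)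
    (trans (subᵗ-renᵗ (lift σ) (refl ∷ θ) B) (subᵗ-cong (lift-⊙ι σ θ) B))

  subᵒ-renᵒ : (σ : Sub t u) (θ : s ⊆ t) (M : Obj s) → subᵒ σ (renᵒ θ M) ≡ subᵒ (σ ⊙ ι θ) M
  subᵒ-renᵒ σ θ (con c)   = refl
  subᵒ-renᵒ σ θ (` x)     = refl
  subᵒ-renᵒ σ θ (ƛ A M)   = cong₂ ƛ (subᵗ-renᵗ σ θ A)
    (trans (subᵒ-renᵒ (lift σ) (refl ∷ θ) M) (subᵒ-cong (lift-⊙ι σ θ) M))
  subᵒ-renᵒ σ θ (M · N)   = cong₂ _·_ (subᵒ-renᵒ σ θ M) (subᵒ-renᵒ σ θ N)
  subᵒ-renᵒ σ θ (nm a)    = refl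
  subᵒ-renᵒ σ θ (⟨ α ⟩ M) = cong (⟨ α ⟩_)
    (trans (subᵒ-renᵒ (lift σ) (refl ∷ θ) M) (subᵒ-cong (lift-⊙ι σ θ) M))
  subᵒ-renᵒ σ θ (M ＠ a)  = cong (_＠ σ (lookup θ a)) (subᵒ-renᵒ σ θ M)

ι-⊙ι : (θ : s ⊆ t) (θ′ : t ⊆ u) → ι θ′ ⊙ ι θ ≗ ι (⊆-trans θ θ′)
ι-⊙ι θ θ′ {var} i = cong `_ (sym (lookup-⊆-trans θ′ i))
ι-⊙ι θ θ′ {nm} i = sym (lookup-⊆-trans θ′ i)

renᵒ-renᵒ-weaken : (θ : s ⊆ t) (M : Obj s) →
  renᵒ (refl ∷ θ) (renᵒ (weaken {k}) M) ≡ renᵒ (weaken {k}) (renᵒ θ M)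
renᵒ-renᵒ-weaken {k = k} θ M = trans (renᵒ-sub _ (renᵒ weaken M)) (trans (subᵒ-renᵒ _ weaken M)
   (trans (subᵒ-cong e M) (sym (trans (renᵒ-sub weaken (renᵒ θ M)) (subᵒ-renᵒ _ θ M)))))
  where
  e : ι (refl ∷ θ) ⊙ ι (weaken {k}) ≗ ι (weaken {k}) ⊙ ι θ
  e {var} i rewrite lookup-⊆-refl (lookup θ i) | lookup-⊆-refl i = refl
  e {nm} i rewrite lookup-⊆-refl (lookup θ i) | lookup-⊆-refl i = refl

renⁱ-renⁱ-weaken : (θ : s ⊆ t) (i : Image l s) →
  renⁱ {l} (refl ∷ θ) (renⁱ {l} (weaken {k}) i) ≡ renⁱ {l} (weaken {k}) (renⁱ {l} θ i)
renⁱ-renⁱ-weaken {l = var} θ M = renᵒ-renᵒ-weaken θ M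
renⁱ-renⁱ-weaken {l = nm} θ a = cong there
  (trans (cong (lookup θ) (lookup-⊆-refl a)) (sym (lookup-⊆-refl (lookup θ a))))

lift-ι⊙ : (θ : t ⊆ u) (σ : Sub s t) → ι (refl ∷ θ) ⊙ lift {k} σ ≗ lift (ι θ ⊙ σ)
lift-ι⊙ θ σ {var} (here refl) = refl
lift-ι⊙ θ σ {nm} (here refl) = refl
lift-ι⊙ {k = k} θ σ {l} (there i) =
  trans (sym (renⁱ-sub {k = l} (refl ∷ θ) (renⁱ {l} weaken (σ i))))
    (trans (renⁱ-renⁱ-weaken {l = l} θ (σ i)) (cong (renⁱ {l} weaken) (renⁱ-sub {k = l} θ (σ i))))

mutual
  renᵗ-subᵗ : (θ : t ⊆ u) (σ : Sub s t) (A : Ty s) → renᵗ θ (subᵗ σ A) ≡ subᵗ (ι θ ⊙ σ) A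
  renᵗ-subᵗ θ σ (con a)   = refl
  renᵗ-subᵗ θ σ (A · M)   = cong₂ _·_ (renᵗ-subᵗ θ σ A) (renᵒ-subᵒ θ σ M)
  renᵗ-subᵗ θ σ (Π A B)   = cong₂ Π (renᵗ-subᵗ θ σ A)
    (trans (renᵗ-subᵗ (refl ∷ θ) (lift σ) B) (subᵗ-cong (lift-ι⊙ θ σ) B))
  renᵗ-subᵗ θ σ (name α)  = refl
  renᵗ-subᵗ θ σ (New α B) = cong (New α)
    (trans (renᵗ-subᵗ (refl ∷ θ) (lift σ) B) (subᵗ-cong (lift-ι⊙ θ σ) B))

  renᵒ-subᵒ : (θ : t ⊆ u) (σ : Sub s t) (M : Obj s) → renᵒ θ (subᵒ σ M) ≡ subᵒ (ι θ ⊙ σ) M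
  renᵒ-subᵒ θ σ (con c)   = refl
  renᵒ-subᵒ θ σ (` x)     = renᵒ-sub θ (σ x)
  renᵒ-subᵒ θ σ (ƛ A M)   = cong₂ ƛ (renᵗ-subᵗ θ σ A)
    (trans (renᵒ-subᵒ (refl ∷ θ) (lift σ) M) (subᵒ-cong (lift-ι⊙ θ σ) M))
  renᵒ-subᵒ θ σ (M · N)   = cong₂ _·_ (renᵒ-subᵒ θ σ M) (renᵒ-subᵒ θ σ N)
  renᵒ-subᵒ θ σ (nm a)    = refl
  renᵒ-subᵒ θ σ (⟨ α ⟩ M) = cong (⟨ α ⟩_)
    (trans (renᵒ-subᵒ (refl ∷ θ) (lift σ) M) (subᵒ-cong (lift-ι⊙ θ σ) M))
  renᵒ-subᵒ θ σ (M ＠ a)  = cong (_＠ _) (renᵒ-subᵒ θ σ M)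

lift-⊙ : (τ : Sub t u) (σ : Sub s t) → lift {k} τ ⊙ lift σ ≗ lift (τ ⊙ σ)
lift-⊙ τ σ {var} (here refl) = refl
lift-⊙ τ σ {nm} (here refl) = refl
lift-⊙ {k = k} τ σ {var} (there x) =
  trans (subᵒ-renᵒ (lift τ) weaken (σ x)) (trans (subᵒ-cong e (σ x)) (sym (renᵒ-subᵒ weaken τ (σ x))))
  where
  e : lift {k} τ ⊙ ι (weaken {k}) ≗ ι (weaken {k}) ⊙ τ
  e {var} i rewrite lookup-⊆-refl i = renᵒ-sub weaken (τ i)
  e {nm} i rewrite lookup-⊆-refl i = refl
lift-⊙ τ σ {nm} (there a) = cong (λ j → there (lookup ⊆-refl (τ j))) (lookup-⊆-refl (σ a))

mutual
  subᵗ-subᵗ : (τ : Sub t u) (σ : Sub s t) (A : Ty s) → subᵗ τ (subᵗ σ A) ≡ subᵗ (τ ⊙ σ) A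
  subᵗ-subᵗ τ σ (con a)   = refl
  subᵗ-subᵗ τ σ (A · M)   = cong₂ _·_ (subᵗ-subᵗ τ σ A) (subᵒ-subᵒ τ σ M)
  subᵗ-subᵗ τ σ (Π A B)   = cong₂ Π (subᵗ-subᵗ τ σ A)
    (trans (subᵗ-subᵗ (lift τ) (lift σ) B) (subᵗ-cong (lift-⊙ τ σ) B))
  subᵗ-subᵗ τ σ (name α)  = refl
  subᵗ-subᵗ τ σ (New α B) = cong (New α)
    (trans (subᵗ-subᵗ (lift τ) (lift σ) B) (subᵗ-cong (lift-⊙ τ σ) B))

  subᵒ-subᵒ : (τ : Sub t u) (σ : Sub s t) (M : Obj s) → subᵒ τ (subᵒ σ M) ≡ subᵒ (τ ⊙ σ) M
  subᵒ-subᵒ τ σ (con c)   = refl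
  subᵒ-subᵒ τ σ (` x)     = refl
  subᵒ-subᵒ τ σ (ƛ A M)   = cong₂ ƛ (subᵗ-subᵗ τ σ A)
    (trans (subᵒ-subᵒ (lift τ) (lift σ) M) (subᵒ-cong (lift-⊙ τ σ) M))
  subᵒ-subᵒ τ σ (M · N)   = cong₂ _·_ (subᵒ-subᵒ τ σ M) (subᵒ-subᵒ τ σ N)
  subᵒ-subᵒ τ σ (nm a)    = refl
  subᵒ-subᵒ τ σ (⟨ α ⟩ M) = cong (⟨ α ⟩_)
    (trans (subᵒ-subᵒ (lift τ) (lift σ) M) (subᵒ-cong (lift-⊙ τ σ) M))
  subᵒ-subᵒ τ σ (M ＠ a)  = cong (_＠ _) (subᵒ-subᵒ τ σ M)

lift-index : lift {k} (index {s = s}) ≗ index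
lift-index (here refl) = refl
lift-index {k = k} {l} (there i) = trans (renⁱ-index (weaken {k}) i) (cong (λ j → index (there j)) (lookup-⊆-refl i))

idˢ : Sub s s
idˢ {k = k} i = index {k} i

mutual
  subᵗ-id : (A : Ty s) → subᵗ idˢ A ≡ A
  subᵗ-id (con a)   = refl
  subᵗ-id (A · M)   = cong₂ _·_ (subᵗ-id A) (subᵒ-id M)
  subᵗ-id (Π A B)   = cong₂ Π (subᵗ-id A) (trans (subᵗ-cong lift-index B) (subᵗ-id B))
  subᵗ-id (name α)  = refl
  subᵗ-id (New α B) = cong (New α) (trans (subᵗ-cong lift-index B) (subᵗ-id B))

  subᵒ-id : (M : Obj s) → subᵒ idˢ M ≡ M
  subᵒ-id (con c)   = refl
  subᵒ-id (` x)     = refl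
  subᵒ-id (ƛ A M)   = cong₂ ƛ (subᵗ-id A) (trans (subᵒ-cong lift-index M) (subᵒ-id M))
  subᵒ-id (M · N)   = cong₂ _·_ (subᵒ-id M) (subᵒ-id N)
  subᵒ-id (nm a)    = refl
  subᵒ-id (⟨ α ⟩ M) = cong (⟨ α ⟩_) (trans (subᵒ-cong lift-index M) (subᵒ-id M))
  subᵒ-id (M ＠ a)  = cong (_＠ a) (subᵒ-id M)

-- The tag lets each law below be stated once for objects, families and kinds.
data Cat : Set where
  ob ty ki : Cat

Exp : Cat → Scope → Set
Exp ob = Obj
Exp ty = Ty
Exp ki = Kind

ren : ∀ c → s ⊆ t → Exp c s → Exp c t
ren ob = renᵒ
ren ty = renᵗ
ren ki = renᵏ

sub : ∀ c → Sub s t → Exp c s → Exp c t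
sub ob σ = subᵒ σ
sub ty σ = subᵗ σ
sub ki σ = subᵏ σ

sub-cong : ∀ c {σ τ : Sub s t} → σ ≗ τ → (X : Exp c s) → sub c σ X ≡ sub c τ X
sub-cong ob e = subᵒ-cong e
sub-cong ty e = subᵗ-cong e
sub-cong ki e = subᵏ-cong e

ren≡sub : ∀ c (θ : s ⊆ t) (X : Exp c s) → ren c θ X ≡ sub c (ι θ) X
ren≡sub ob = renᵒ-sub
ren≡sub ty = renᵗ-sub
ren≡sub ki = renᵏ-sub

sub-sub : ∀ c (τ : Sub t u) (σ : Sub s t) (X : Exp c s) → sub c τ (sub c σ X) ≡ sub c (τ ⊙ σ) X
sub-sub ob τ σ = subᵒ-subᵒ τ σ
sub-sub ty τ σ = subᵗ-subᵗ τ σ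
sub-sub ki τ σ = go τ σ
  where
  go : (τ : Sub t u) (σ : Sub s t) (K : Kind s) → subᵏ τ (subᵏ σ K) ≡ subᵏ (τ ⊙ σ) K
  go τ σ type    = refl
  go τ σ (Π A K) = cong₂ Π (subᵗ-subᵗ τ σ A)
    (trans (go (lift τ) (lift σ) K) (subᵏ-cong (lift-⊙ τ σ) K))

sub-id : ∀ c (X : Exp c s) → sub c idˢ X ≡ X
sub-id ob = subᵒ-id
sub-id ty = subᵗ-id
sub-id ki type    = refl
sub-id ki (Π A K) = cong₂ Π (subᵗ-id A) (trans (subᵏ-cong lift-index K) (sub-id ki K))

sub-ren : ∀ c (σ : Sub t u) (θ : s ⊆ t) (X : Exp c s) → sub c σ (ren c θ X) ≡ sub c (σ ⊙ ι θ) X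
sub-ren c σ θ X = trans (cong (sub c σ) (ren≡sub c θ X)) (sub-sub c σ (ι θ) X)

ren-sub : ∀ c (θ : t ⊆ u) (σ : Sub s t) (X : Exp c s) → ren c θ (sub c σ X) ≡ sub c (ι θ ⊙ σ) X
ren-sub c θ σ X = trans (ren≡sub c θ (sub c σ X)) (sub-sub c (ι θ) σ X)

ren-ren : ∀ c (θ : s ⊆ t) (θ′ : t ⊆ u) (X : Exp c s) → ren c θ′ (ren c θ X) ≡ ren c (⊆-trans θ θ′) X
ren-ren c θ θ′ X = trans (ren≡sub c θ′ (ren c θ X))
  (trans (sub-ren c (ι θ′) θ X) (trans (sub-cong c (ι-⊙ι θ θ′) X) (sym (ren≡sub c (⊆-trans θ θ′) X))))

ren-refl : ∀ c (X : Exp c s) → ren c ⊆-refl X ≡ X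
ren-refl c X = trans (ren≡sub c ⊆-refl X) (trans (sub-cong c (λ i → cong index (lookup-⊆-refl i)) X) (sub-id c X))

lift-weaken : (σ : Sub s t) → lift {k} σ ⊙ ι weaken ≗ ι weaken ⊙ σ
lift-weaken σ {var} i rewrite lookup-⊆-refl i = renᵒ-sub weaken (σ i)
lift-weaken σ {nm} i rewrite lookup-⊆-refl i = refl

sub-weaken : ∀ c (σ : Sub s t) (X : Exp c s) →
  sub c (lift {k} σ) (ren c weaken X) ≡ ren c weaken (sub c σ X)
sub-weaken c σ X = trans (sub-ren c (lift σ) weaken X)
  (trans (sub-cong c (lift-weaken σ) X) (sym (ren-sub c weaken σ X)))

single-weaken : (i : Image k s) → single {k} i ⊙ ι weaken ≗ idˢ
single-weaken i {var} j = cong `_ (lookup-⊆-refl j)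
single-weaken i {nm} j = lookup-⊆-refl j

weaken-single : ∀ c (i : Image k s) (X : Exp c s) → sub c (single {k} i) (ren c weaken X) ≡ X
weaken-single c i X = trans (sub-ren c (single i) weaken X)
  (trans (sub-cong c (single-weaken i) X) (sub-id c X))

renⁱ-single : (i : Image k s) (j : Image l s) → subⁱ {k = l} (single {k} i) (renⁱ {l} weaken j) ≡ j
renⁱ-single {l = var} i M = weaken-single ob i M
renⁱ-single {l = nm} i a = lookup-⊆-refl a

sub-single-comm : (σ : Sub s t) (i : Image k s) →
  σ ⊙ single {k} i ≗ single {k} (subⁱ {k = k} σ i) ⊙ lift σ
sub-single-comm σ i {var} (here refl) = refl
sub-single-comm σ i {nm} (here refl) = refl
sub-single-comm {k = k} σ i {l} (there j) = trans (subⁱ-index {k = l} σ j) (sym (renⁱ-single {k = k} {l = l} (subⁱ {k = k} σ i) (σ j)))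

sub-single : ∀ c (σ : Sub s t) (i : Image k s) (X : Exp c (k ∷ s)) →
  sub c σ (sub c (single {k} i) X) ≡ sub c (single {k} (subⁱ {k = k} σ i)) (sub c (lift σ) X)
sub-single {k = k} c σ i X = trans (sub-sub c σ (single i) X)
  (trans (sub-cong c (sub-single-comm σ i) X) (sym (sub-sub c (single {k} (subⁱ {k = k} σ i)) (lift σ) X)))

sub-minimum : ∀ c (σ : Sub s t) (X : Exp c []) → sub c σ (ren c (minimum s) X) ≡ ren c (minimum t) X
sub-minimum {s} {t} c σ X = trans (sub-ren c σ (minimum s) X)
  (trans (sub-cong c {τ = ι (minimum t)} (λ ()) X) (sym (ren≡sub c (minimum t) X)))

-- The hypothesis says that `σ` restricted along `φ` factors through `θ` as `σ′`. This square is all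
-- that a concretion, whose head lives in the smaller scope, asks of a substitution.
sub-ren-comm : ∀ c {σ : Sub t u} {φ : s ⊆ t} {θ : v ⊆ u} {σ′ : Sub s v} →
  σ ⊙ ι φ ≗ ι θ ⊙ σ′ → (X : Exp c s) → sub c σ (ren c φ X) ≡ ren c θ (sub c σ′ X)
sub-ren-comm c {σ} {φ} {θ} {σ′} e X = trans (sub-ren c σ φ X) (trans (sub-cong c e X) (sym (ren-sub c θ σ′ X)))

lift-comm : {σ : Sub t u} {φ : s ⊆ t} {θ : v ⊆ u} {σ′ : Sub s v} →
  σ ⊙ ι φ ≗ ι θ ⊙ σ′ → lift {k} σ ⊙ ι (refl ∷ φ) ≗ ι (refl ∷ θ) ⊙ lift σ′
lift-comm {σ = σ} {φ} {θ} {σ′} e =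
  ≗-trans (lift-⊙ι σ φ) (≗-trans (lift-cong e) (≗-sym (lift-ι⊙ θ σ′)))

-- How a substitution acts on the types and contracta of concretions, σ′ being its restriction.
sub-ren-single : ∀ c {σ : Sub t u} {φ : s ⊆ t} {θ : v ⊆ u} {σ′ : Sub s v} →
  σ ⊙ ι φ ≗ ι θ ⊙ σ′ → (i : Image k t) (X : Exp c (k ∷ s)) →
  sub c σ (sub c (single {k} i) (ren c (refl ∷ φ) X)) ≡
  sub c (single {k} (subⁱ {k = k} σ i)) (ren c (refl ∷ θ) (sub c (lift σ′) X))
sub-ren-single {k = k} c {σ} {φ} {θ} {σ′} e i X =
  trans (sub-single {k = k} c σ i (ren c (refl ∷ φ) X))
    (cong (sub c (single {k} (subⁱ {k = k} σ i))) (sub-ren-comm c (lift-comm e) X))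

-- Arises whenever an abstraction is weakened and then applied to the variable or name just bound:
-- the contractum is the original body.
single-here : ∀ {k s} → single {k} (index (here refl)) ⊙ ι (refl ∷ weaken {k} {s}) ≗ idˢ
single-here {k} {s} {var} (here refl) = refl
single-here {k} {s} {nm} (here refl) = refl
single-here {k} {s} {var} (there i) = cong (λ j → ` there j) (lookup-⊆-refl i)
single-here {k} {s} {nm} (there i) = cong there (lookup-⊆-refl i)

ren-single-here : ∀ c (X : Exp c (k ∷ s)) →
  sub c (single {k} (index (here refl))) (ren c (refl ∷ weaken {k}) X) ≡ X
ren-single-here {k = k} c X = trans (sub-ren c (single {k} (index (here refl))) (refl ∷ weaken) X)
  (trans (sub-cong c (single-here {k}) X) (sub-id c X))

·ᵗ-inj : {A B : Ty s} {M N : Obj s} → A Ty.· M ≡ B · N → A ≡ B × M ≡ N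
·ᵗ-inj refl = refl , refl

Πᵗ-inj : {A A′ : Ty s} {B B′ : Ty (var ∷ s)} → Ty.Π A B ≡ Π A′ B′ → A ≡ A′ × B ≡ B′
Πᵗ-inj refl = refl , refl

New-inj : ∀ {α β} {A B : Ty (nm ∷ s)} → New α A ≡ New β B → α ≡ β × A ≡ B
New-inj refl = refl , refl

`-inj : {x y : var ∈ s} → ` x ≡ ` y → x ≡ y
`-inj refl = refl

ƛ-inj : {A B : Ty s} {M N : Obj (var ∷ s)} → ƛ A M ≡ ƛ B N → A ≡ B × M ≡ N
ƛ-inj refl = refl , refl

·ᵒ-inj : {M M′ N N′ : Obj s} → M Obj.· N ≡ M′ · N′ → M ≡ M′ × N ≡ N′
·ᵒ-inj refl = refl , refl

nm-inj : {a b : nm ∈ s} → nm a ≡ nm b → a ≡ b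
nm-inj refl = refl

⟨⟩-inj : ∀ {α β} {M N : Obj (nm ∷ s)} → ⟨ α ⟩ M ≡ ⟨ β ⟩ N → α ≡ β × M ≡ N
⟨⟩-inj refl = refl , refl

＠-inj : {M N : Obj s} {a b : nm ∈ s} → M ＠ a ≡ N ＠ b → M ≡ N × a ≡ b
＠-inj refl = refl , refl

mutual
  -- The typing rule for concretion mentions its head only as `renᵒ θ M`, so inversion yields an
  -- equation between renamed objects; injectivity identifies the heads themselves.
  renᵗ-inj : (θ : s ⊆ t) {A B : Ty s} → renᵗ θ A ≡ renᵗ θ B → A ≡ B
  renᵗ-inj θ {con a} {con b} refl = refl
  renᵗ-inj θ {A · M} {B · N} e = let e₁ , e₂ = ·ᵗ-inj e in
    cong₂ _·_ (renᵗ-inj θ e₁) (renᵒ-inj θ e₂)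
  renᵗ-inj θ {Π A A′} {Π B B′} e = let e₁ , e₂ = Πᵗ-inj e in
    cong₂ Π (renᵗ-inj θ e₁) (renᵗ-inj (refl ∷ θ) e₂)
  renᵗ-inj θ {name α} {name α′} refl = refl
  renᵗ-inj θ {New α A} {New α′ B} e = let e₁ , e₂ = New-inj e in
    cong₂ New e₁ (renᵗ-inj (refl ∷ θ) e₂)

  renᵒ-inj : (θ : s ⊆ t) {M N : Obj s} → renᵒ θ M ≡ renᵒ θ N → M ≡ N
  renᵒ-inj θ {con a} {con b} refl = refl
  renᵒ-inj θ {` x} {` y} e = cong `_ (lookup-injective {τ = θ} (`-inj e))
  renᵒ-inj θ {ƛ A M} {ƛ B N} e = let e₁ , e₂ = ƛ-inj e in
    cong₂ ƛ (renᵗ-inj θ e₁) (renᵒ-inj (refl ∷ θ) e₂)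
  renᵒ-inj θ {M · M′} {N · N′} e = let e₁ , e₂ = ·ᵒ-inj e in
    cong₂ _·_ (renᵒ-inj θ e₁) (renᵒ-inj θ e₂)
  renᵒ-inj θ {nm a} {nm b} e = cong nm (lookup-injective {τ = θ} (nm-inj e))
  renᵒ-inj θ {⟨ α ⟩ M} {⟨ α′ ⟩ N} e = let e₁ , e₂ = ⟨⟩-inj e in
    cong₂ ⟨_⟩_ e₁ (renᵒ-inj (refl ∷ θ) e₂)
  renᵒ-inj θ {M ＠ a} {N ＠ b} e = let e₁ , e₂ = ＠-inj e in
    cong₂ _＠_ (renᵒ-inj θ e₁) (lookup-injective {τ = θ} e₂)

-- Contexts, restriction and well-formed substitutions

variable
  Γ Δ Γ′ Δ′ : Ctx s
  α α′ : NameTy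
  A B A′ B′ C : Ty s
  M N M′ N′ P Q : Obj s
  K L K′ : Kind s
  θ φ : s ⊆ t
  a b : nm ∈ s

-- Stated as one equation of tuples, so that matching on `refl` unifies scope, context, embedding
-- and name type together although they depend on one another.
restriction-unique : ∀ {s s₁ s₂} {Γ : Ctx s} {Γ₁ : Ctx s₁} {Γ₂ : Ctx s₂} {θ₁ θ₂ a α₁ α₂} →
  Γ ⊢ a ∶ α₁ ╲ Γ₁ via θ₁ → Γ ⊢ a ∶ α₂ ╲ Γ₂ via θ₂ →
  _≡_ {A = Σ[ t ∈ Scope ] Ctx t × t ⊆ s × NameTy}
    (s₁ , Γ₁ , θ₁ , α₁) (s₂ , Γ₂ , θ₂ , α₂)
restriction-unique here here = refl
restriction-unique (there# r) (there# q) with refl ← restriction-unique r q = refl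
restriction-unique (there r) (there q) with refl ← restriction-unique r q = refl

restricted-name : Γ ⊢ a ∶ α ╲ Γ′ via θ → Γ ∋# a ∶ α
restricted-name here       = here
restricted-name (there# r) = there# (restricted-name r)
restricted-name (there r)  = there (restricted-name r)

infix 4 _⊆ᶜ_via_

data _⊆ᶜ_via_ : Ctx s → Ctx t → s ⊆ t → Set where
  ∙     : ∙ ⊆ᶜ ∙ via []
  keep  : Γ ⊆ᶜ Δ via θ → Γ ▸ A ⊆ᶜ Δ ▸ renᵗ θ A via (refl ∷ θ)
  keep# : Γ ⊆ᶜ Δ via θ → Γ # α ⊆ᶜ Δ # α via (refl ∷ θ)
  skip  : Γ ⊆ᶜ Δ via θ → Γ ⊆ᶜ Δ ▸ A via (var ∷ʳ θ)
  skip# : Γ ⊆ᶜ Δ via θ → Γ ⊆ᶜ Δ # α via (nm ∷ʳ θ)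

⊆ᶜ-refl : (Γ : Ctx s) → Γ ⊆ᶜ Γ via ⊆-refl
⊆ᶜ-refl ∙       = ∙
⊆ᶜ-refl (Γ ▸ A) = subst (λ B → Γ ▸ A ⊆ᶜ Γ ▸ B via ⊆-refl) (ren-refl ty A) (keep (⊆ᶜ-refl Γ))
⊆ᶜ-refl (Γ # α) = keep# (⊆ᶜ-refl Γ)

⊆ᶜ-weaken : Γ ⊆ᶜ Γ ▸ A via weaken
⊆ᶜ-weaken = skip (⊆ᶜ-refl _)

restriction-⊆ᶜ : Γ ⊢ a ∶ α ╲ Γ′ via θ → Γ′ ⊆ᶜ Γ via θ
restriction-⊆ᶜ here       = skip# (⊆ᶜ-refl _)
restriction-⊆ᶜ (there# r) = keep# (restriction-⊆ᶜ r)
restriction-⊆ᶜ (there r)  = skip (restriction-⊆ᶜ r)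

cast-∋ : ∀ {x : var ∈ s} → A ≡ B → Γ ∋ x ∶ A → Γ ∋ x ∶ B
cast-∋ refl p = p

renᵗ-weaken : ∀ (θ : s ⊆ t) (A : Ty s) → renᵗ (weaken {k}) (renᵗ θ A) ≡ renᵗ (k ∷ʳ θ) A
renᵗ-weaken {k = k} θ A = trans (ren≡sub ty weaken (renᵗ θ A)) (trans (sub-ren ty (ι weaken) θ A)
  (trans (sub-cong ty (λ { {var} i → cong (λ j → ` there j) (lookup-⊆-refl (lookup θ i))
                         ; {nm} i → cong there (lookup-⊆-refl (lookup θ i)) }) A)
    (sym (ren≡sub ty (k ∷ʳ θ) A))))

renᵗ-weaken-comm : ∀ (θ : s ⊆ t) (A : Ty s) → renᵗ (weaken {k}) (renᵗ θ A) ≡ renᵗ (refl ∷ θ) (renᵗ weaken A)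
renᵗ-weaken-comm {k = k} θ A = sym (trans (ren≡sub ty (refl ∷ θ) (renᵗ weaken A))
  (trans (sub-cong ty (≗-sym (lift-ι θ)) (renᵗ weaken A)) (trans (sub-weaken ty (ι θ) A) (cong (renᵗ weaken) (sym (ren≡sub ty θ A))))))

ren-∋ : ∀ {x : var ∈ s} → Γ ⊆ᶜ Δ via θ → Γ ∋ x ∶ A → Δ ∋ lookup θ x ∶ renᵗ θ A
ren-∋ {θ = refl ∷ θ} (keep w) here = cast-∋ (renᵗ-weaken-comm θ _) here
ren-∋ {θ = refl ∷ θ} (keep w) (there p) = cast-∋ (renᵗ-weaken-comm θ _) (there (ren-∋ w p))
ren-∋ {θ = refl ∷ θ} (keep# w) (there# p) = cast-∋ (renᵗ-weaken-comm θ _) (there# (ren-∋ w p))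
ren-∋ {θ = var ∷ʳ θ} (skip w) p = cast-∋ (renᵗ-weaken θ _) (there (ren-∋ w p))
ren-∋ {θ = nm ∷ʳ θ} (skip# w) p = cast-∋ (renᵗ-weaken θ _) (there# (ren-∋ w p))

ren-∋# : Γ ⊆ᶜ Δ via θ → Γ ∋# a ∶ α → Δ ∋# lookup θ a ∶ α
ren-∋# (keep w)  (there p)  = there (ren-∋# w p)
ren-∋# (keep# w) here       = here
ren-∋# (keep# w) (there# p) = there# (ren-∋# w p)
ren-∋# (skip w)  p          = there (ren-∋# w p)
ren-∋# (skip# w) p          = there# (ren-∋# w p)

record RenRestriction {s t u} (Γ′ : Ctx s) (Δ : Ctx t) (θ : u ⊆ t) (φ : s ⊆ u) (b : nm ∈ t) (α : NameTy) : Set where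
  constructor restricted
  field
    {scope}  : Scope
    {ctx}    : Ctx scope
    {emb}    : scope ⊆ t
    {emb′}   : s ⊆ scope
    restr    : Δ ⊢ b ∶ α ╲ ctx via emb
    incl     : Γ′ ⊆ᶜ ctx via emb′
    commutes : ∀ {k} (i : k ∈ s) → lookup θ (lookup φ i) ≡ lookup emb (lookup emb′ i)

-- Restriction discards the name and the variables declared after it. Of the entries that `Δ` adds,
-- later variables are dropped and other names are kept, and nothing belonging to `Γ′` is lost.
ren-restriction : Γ ⊆ᶜ Δ via θ → Γ ⊢ a ∶ α ╲ Γ′ via φ → RenRestriction Γ′ Δ θ φ (lookup θ a) α
ren-restriction (keep w) (there r) with restricted r′ w′ e ← ren-restriction w r =
  restricted (there r′) w′ (λ i → cong there (e i))
ren-restriction {θ = refl ∷ θ} (keep# w) here =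
  restricted here w (λ i → cong there (trans (cong (lookup θ) (lookup-⊆-refl i)) (sym (lookup-⊆-refl _))))
ren-restriction (keep# w) (there# r) with restricted r′ w′ e ← ren-restriction w r =
  restricted (there# r′) (keep# w′) λ { (here refl) → refl ; (there i) → cong there (e i) }
ren-restriction (skip w) r with restricted r′ w′ e ← ren-restriction w r =
  restricted (there r′) w′ (λ i → cong there (e i))
ren-restriction (skip# w) r with restricted r′ w′ e ← ren-restriction w r =
  restricted (there# r′) (skip# w′) (λ i → cong there (e i))

record Exchange {s t u} (Δ : Ctx s) (a b : nm ∈ s) (α β : NameTy) (Δ₂ : Ctx t) (θ₁ : u ⊆ s) (θ₂ : t ⊆ u) : Set where
  constructor exchanged
  field
    {scope}  : Scope
    {ctx}    : Ctx scope
    {emb}    : scope ⊆ s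
    {emb′}   : t ⊆ scope
    {b′}     : nm ∈ scope
    restr    : Δ ⊢ a ∶ α ╲ ctx via emb
    restr′   : ctx ⊢ b′ ∶ β ╲ Δ₂ via emb′
    image    : lookup emb b′ ≡ b
    commutes : ∀ {k} (i : k ∈ t) → lookup θ₁ (lookup θ₂ i) ≡ lookup emb (lookup emb′ i)

-- In either order, restricting by two names removes both names and the variables declared after the
-- older one, so the same `Δ₂` is reached.
exchange : ∀ {s t u} {Δ : Ctx s} {Δ₁ : Ctx u} {Δ₂ : Ctx t} {a b α β θ₁ θ₂} →
  Δ ⊢ b ∶ β ╲ Δ₁ via θ₁ → Δ₁ ⊢ a ∶ α ╲ Δ₂ via θ₂ → Exchange Δ (lookup θ₁ a) b α β Δ₂ θ₁ θ₂
exchange {a = a} {θ₂ = θ₂} here q rewrite lookup-⊆-refl a =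
  exchanged (there# q) here refl
    (λ i → cong there (trans (lookup-⊆-refl _) (cong (lookup θ₂) (sym (lookup-⊆-refl i)))))
exchange (there# r) here =
  exchanged here r (cong there (lookup-⊆-refl _))
    (λ i → cong there (trans (cong (lookup _) (lookup-⊆-refl i)) (sym (lookup-⊆-refl _))))
exchange (there# r) (there# q) with exchanged r′ q′ e c ← exchange r q =
  exchanged (there# r′) (there# q′) (cong there e) λ { (here refl) → refl ; (there i) → cong there (c i) }
exchange (there r) q with exchanged r′ q′ e c ← exchange r q =
  exchanged (there r′) q′ (cong there e) (λ i → cong there (c i))

tl : Sub (k ∷ s) t → Sub s t
tl σ {l} i = σ {l} (there i)

tl-lift : (σ : Sub s t) → tl (lift {k} σ) ≗ ι weaken ⊙ σ
tl-lift σ {l} i = renⁱ-sub {k = l} weaken (σ i)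

-- For Γ # α, what is substituted for Γ must live in the restriction by the image of the name,
-- which is how freshness survives substitution.
data SubRel (P : ∀ {t} → Ctx t → Obj t → Obj t → Ty t → Set) :
    Ctx t → Ctx s → Sub s t → Sub s t → Set where
  []  : ∀ {σ σ′ : Sub [] t} → SubRel P Δ ∙ σ σ′
  _∷_ : ∀ {σ σ′ : Sub (var ∷ s) t} →
        SubRel P Δ Γ (tl σ) (tl σ′) →
        P Δ (σ (here refl)) (σ′ (here refl)) (subᵗ (tl σ) A) →
        SubRel P Δ (Γ ▸ A) σ σ′
  name : ∀ {σ σ′ : Sub (nm ∷ s) t} {τ τ′ : Sub s u} {Δ : Ctx t} {Δ′ : Ctx u} {θ : u ⊆ t} →
        Δ ⊢ σ (here refl) ∶ α ╲ Δ′ via θ →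
        SubRel P Δ′ Γ τ τ′ →
        tl σ ≗ ι θ ⊙ τ → tl σ′ ≗ ι θ ⊙ τ′ → σ′ (here refl) ≡ σ (here refl) →
        SubRel P Δ (Γ # α) σ σ′

cast-restriction : a ≡ b → Γ ⊢ a ∶ α ╲ Γ′ via θ → Γ ⊢ b ∶ α ╲ Γ′ via θ
cast-restriction refl r = r

record SubRestriction (P : ∀ {t} → Ctx t → Obj t → Obj t → Ty t → Set) {s t u}
    (Γ′ : Ctx s) (Δ : Ctx t) (σ σ′ : Sub u t) (φ : s ⊆ u) (b : nm ∈ t) (α : NameTy) : Set where
  constructor restricted
  field
    {scope}   : Scope
    {ctx}     : Ctx scope
    {emb}     : scope ⊆ t
    {left}    : Sub s scope
    {right}   : Sub s scope
    restr     : Δ ⊢ b ∶ α ╲ ctx via emb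
    rel       : SubRel P ctx Γ′ left right
    commutes  : σ ⊙ ι φ ≗ ι emb ⊙ left
    commutes′ : σ′ ⊙ ι φ ≗ ι emb ⊙ right

⊙ι-weaken : ∀ (σ : Sub (k ∷ s) t) (θ : u ⊆ s) → σ ⊙ ι (k ∷ʳ θ) ≗ tl σ ⊙ ι θ
⊙ι-weaken σ θ {var} i = refl
⊙ι-weaken σ θ {nm} i = refl

⊙-congˡ : {σ τ : Sub t u} → σ ≗ τ → (ρ : Sub s t) → σ ⊙ ρ ≗ τ ⊙ ρ
⊙-congˡ e ρ {k} i = subⁱ-cong {k = k} e (ρ i)

⊙-congʳ : {σ τ : Sub s t} → σ ≗ τ → (ρ : Sub t u) → ρ ⊙ σ ≗ ρ ⊙ τ
⊙-congʳ e ρ {k} i = cong (subⁱ {k = k} ρ) (e i)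

⊙-assoc : (ρ : Sub u v) (τ : Sub t u) (σ : Sub s t) → (ρ ⊙ τ) ⊙ σ ≗ ρ ⊙ (τ ⊙ σ)
⊙-assoc ρ τ σ {var} i = sym (subᵒ-subᵒ ρ τ (σ i))
⊙-assoc ρ τ σ {nm} i = refl

⊙-identityʳ : (σ : Sub s t) → σ ⊙ idˢ ≗ σ
⊙-identityʳ σ {var} i = refl
⊙-identityʳ σ {nm} i = refl

ι-square : ∀ {θ₁ : t ⊆ u} {θ₂ : s ⊆ t} {θ₃ : v ⊆ u} {θ₄ : s ⊆ v} →
  (∀ {k} (i : k ∈ s) → lookup θ₁ (lookup θ₂ i) ≡ lookup θ₃ (lookup θ₄ i)) → ι θ₁ ⊙ ι θ₂ ≗ ι θ₃ ⊙ ι θ₄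
ι-square c {var} i = cong `_ (c i)
ι-square c {nm} i = c i

restrict-rest : ∀ {s t u w v x} {σ : Sub (k ∷ s) t} {θ₁ : w ⊆ t} {τ : Sub s w} {φ : u ⊆ s}
  {θ₂ : v ⊆ w} {τ₁ : Sub u v} {θ₃ : x ⊆ t} {θ₄ : v ⊆ x} →
  tl σ ≗ ι θ₁ ⊙ τ → τ ⊙ ι φ ≗ ι θ₂ ⊙ τ₁ → ι θ₁ ⊙ ι θ₂ ≗ ι θ₃ ⊙ ι θ₄ →
  tl σ ⊙ ι φ ≗ ι θ₃ ⊙ (ι θ₄ ⊙ τ₁)
restrict-rest {θ₁ = θ₁} {τ} {φ} {θ₂} {τ₁} {θ₃} {θ₄} e f c =
  ≗-trans (⊙-congˡ e (ι φ)) (≗-trans (⊙-assoc (ι θ₁) τ (ι φ)) (≗-trans (⊙-congʳ f (ι θ₁))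
   (≗-trans (≗-sym (⊙-assoc (ι θ₁) (ι θ₂) τ₁)) (≗-trans (⊙-congˡ c τ₁) (⊙-assoc (ι θ₃) (ι θ₄) τ₁)))))

cons : Image k t → Sub s t → Sub (k ∷ s) t
cons i σ (here refl) = i
cons i σ (there j)   = σ j

module _ {P : ∀ {t} → Ctx t → Obj t → Obj t → Ty t → Set} where

  -- When a newer name follows `a`, the substitution has already fixed a restriction of `Δ` at the
  -- image of that name, and the induction hypothesis restricts further inside it. `exchange`
  -- reverses the order, so that the image of `a` is removed first and the image of the newer name
  -- survives as `b′`.
  sub-restriction : ∀ {s t u} {Γ : Ctx u} {Δ : Ctx t} {Γ′ : Ctx s} {σ σ′ : Sub u t} {a φ} →
    SubRel P Δ Γ σ σ′ → Γ ⊢ a ∶ α ╲ Γ′ via φ → SubRestriction P Γ′ Δ σ σ′ φ (σ a) α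
  sub-restriction {σ = σ} {σ′} {φ = _ ∷ʳ φ} (rel ∷ p) (there r)
    with restricted r′ rel′ e e′ ← sub-restriction rel r =
    restricted r′ rel′ (≗-trans (⊙ι-weaken σ φ) e) (≗-trans (⊙ι-weaken σ′ φ) e′)
  sub-restriction {σ = σ} {σ′} (name {τ = τ} {τ′} {θ = θ} r rel e e′ h) here =
    restricted r rel (≗-trans (⊙ι-weaken σ ⊆-refl) (≗-trans (⊙-congʳ ι-refl (tl σ)) (≗-trans (⊙-identityʳ (tl σ)) e)))
                     (≗-trans (⊙ι-weaken σ′ ⊆-refl) (≗-trans (⊙-congʳ ι-refl (tl σ′)) (≗-trans (⊙-identityʳ (tl σ′)) e′)))
    where
    ι-refl : ι (⊆-refl {x = s}) ≗ idˢ
    ι-refl i = cong index (lookup-⊆-refl i)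
  sub-restriction {σ = σ} {σ′} {there a} {refl ∷ φ} (name {τ = τ} {τ′} r rel e e′ h) (there# q)
    with restricted {left = τ₁} {τ₁′} q′ rel′ f f′ ← sub-restriction rel q
    with exchanged {emb = θ₃} {θ₄} {b′} r₃ r₄ im c ← exchange r q′ =
    restricted {left = cons b′ (ι θ₄ ⊙ τ₁)} {cons b′ (ι θ₄ ⊙ τ₁′)}
      (cast-restriction (sym (e a)) r₃)
      (name r₄ rel′ (λ i → refl) (λ i → refl) refl)
      (λ { {var} (there i) → restrict-rest {σ = σ} {φ = φ} {θ₃ = θ₃} {θ₄ = θ₄} e f (ι-square c) i
         ; {nm} (there i) → restrict-rest {σ = σ} {φ = φ} {θ₃ = θ₃} {θ₄ = θ₄} e f (ι-square c) i
         ; {nm} (here refl) → sym im })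
      (λ { {var} (there i) → restrict-rest {σ = σ′} {φ = φ} {θ₃ = θ₃} {θ₄ = θ₄} e′ f′ (ι-square c) i
         ; {nm} (there i) → restrict-rest {σ = σ′} {φ = φ} {θ₃ = θ₃} {θ₄ = θ₄} e′ f′ (ι-square c) i
         ; {nm} (here refl) → trans h (sym im) })

-- Preservation of judgments under renaming and substitution

variable
  Σ : Sig
  σ τ σ′ τ′ : Sub s t
  L′ : Kind s

castᵏ : K ≡ L → Σ ⨾ Γ ⊢ᵏ K → Σ ⨾ Γ ⊢ᵏ L
castᵏ refl D = D

castᵗ : A ≡ B → K ≡ L → Σ ⨾ Γ ⊢ᵗ A ∶ K → Σ ⨾ Γ ⊢ᵗ B ∶ L
castᵗ refl refl D = D

castᵒ : M ≡ N → A ≡ B → Σ ⨾ Γ ⊢ᵒ M ∶ A → Σ ⨾ Γ ⊢ᵒ N ∶ B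
castᵒ refl refl D = D

cast≈ᵗ : A ≡ A′ → B ≡ B′ → K ≡ L → Σ ⨾ Γ ⊢ᵗ A ≈ B ∶ K → Σ ⨾ Γ ⊢ᵗ A′ ≈ B′ ∶ L
cast≈ᵗ refl refl refl D = D

cast≈ᵒ : M ≡ M′ → N ≡ N′ → A ≡ B → Σ ⨾ Γ ⊢ᵒ M ≈ N ∶ A → Σ ⨾ Γ ⊢ᵒ M′ ≈ N′ ∶ B
cast≈ᵒ refl refl refl D = D

mutual
  reflᵏ : Σ ⨾ Γ ⊢ᵏ K → Σ ⨾ Γ ⊢ᵏ K ≈ K
  reflᵏ type    = type
  reflᵏ (Π D E) = Π D (reflᵗ D) (reflᵏ E)

  reflᵗ : Σ ⨾ Γ ⊢ᵗ A ∶ K → Σ ⨾ Γ ⊢ᵗ A ≈ A ∶ K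
  reflᵗ (con p)    = con p
  reflᵗ (app D E)  = app (reflᵗ D) (reflᵒ E)
  reflᵗ (Π D E)    = Π D (reflᵗ D) (reflᵗ E)
  reflᵗ (name p)   = name p
  reflᵗ (New p D)  = New p (reflᵗ D)
  reflᵗ (conv D e) = conv (reflᵗ D) (≈-sym e)

  reflᵒ : Σ ⨾ Γ ⊢ᵒ M ∶ A → Σ ⨾ Γ ⊢ᵒ M ≈ M ∶ A
  reflᵒ (con p)    = con p
  reflᵒ (var p)    = var p
  reflᵒ (nm p)     = nm p
  reflᵒ (lam D E)  = lam D (reflᵗ D) (reflᵗ D) (reflᵒ E)
  reflᵒ (app D E)  = app (reflᵒ D) (reflᵒ E)
  reflᵒ (abs p D)  = abs p (reflᵒ D)
  reflᵒ (conc r D) = conc r (reflᵒ D)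
  reflᵒ (conv D e) = conv (reflᵒ D) e

record MorRestriction (Mor : ∀ {s t} → Ctx t → Ctx s → Sub s t → Set) {s t u}
    (Γ′ : Ctx s) (Δ : Ctx t) (σ : Sub u t) (φ : s ⊆ u) (b : nm ∈ t) (α : NameTy) : Set where
  constructor restricted
  field
    {scope}   : Scope
    {ctx}     : Ctx scope
    {emb}     : scope ⊆ t
    {mor}     : Sub s scope
    restr     : Δ ⊢ b ∶ α ╲ ctx via emb
    isMor     : Mor ctx Γ′ mor
    commutes  : σ ⊙ ι φ ≗ ι emb ⊙ mor

-- What the proof that a substitution preserves all judgments uses of it.  Renamings come first,
-- since lifting substitutions under binders weakens them.
record IsMorphism (Σ : Sig) (Mor : ∀ {s t} → Ctx t → Ctx s → Sub s t → Set) : Set where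
  field
    on-var  : ∀ {s t} {Γ : Ctx s} {Δ : Ctx t} {σ : Sub s t} {x A} →
              Mor Δ Γ σ → Γ ∋ x ∶ A → Σ ⨾ Δ ⊢ᵒ σ x ∶ subᵗ σ A
    on-name : ∀ {s t} {Γ : Ctx s} {Δ : Ctx t} {σ : Sub s t} {a α} →
              Mor Δ Γ σ → Γ ∋# a ∶ α → Δ ∋# σ a ∶ α
    under   : ∀ {s t} {Γ : Ctx s} {Δ : Ctx t} {σ : Sub s t} {A} →
              Mor Δ Γ σ → Mor (Δ ▸ subᵗ σ A) (Γ ▸ A) (lift σ)
    under#  : ∀ {s t} {Γ : Ctx s} {Δ : Ctx t} {σ : Sub s t} {α} →
              Mor Δ Γ σ → Mor (Δ # α) (Γ # α) (lift σ)
    restr   : ∀ {s t u} {Γ : Ctx s} {Δ : Ctx t} {Γ′ : Ctx u} {σ : Sub s t} {φ a α} →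
              Mor Δ Γ σ → Γ ⊢ a ∶ α ╲ Γ′ via φ → MorRestriction Mor Γ′ Δ σ φ (σ a) α

module Preservation {Mor : ∀ {s t} → Ctx t → Ctx s → Sub s t → Set} (isMor : IsMorphism Σ Mor) where
  open IsMorphism isMor

  mutual
    mor-ᵏ : Mor Δ Γ σ → Σ ⨾ Γ ⊢ᵏ K → Σ ⨾ Δ ⊢ᵏ subᵏ σ K
    mor-ᵏ m type    = type
    mor-ᵏ m (Π D E) = Π (mor-ᵗ m D) (mor-ᵏ (under m) E)

    mor-ᵗ : Mor Δ Γ σ → Σ ⨾ Γ ⊢ᵗ A ∶ K → Σ ⨾ Δ ⊢ᵗ subᵗ σ A ∶ subᵏ σ K
    mor-ᵗ {σ = σ} m (con {K = K} p) = castᵗ refl (sym (sub-minimum ki σ K)) (con p)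
    mor-ᵗ {σ = σ} m (app {K = K} {M = M} D E) =
      castᵗ refl (sym (sub-single ki σ M K)) (app (mor-ᵗ m D) (mor-ᵒ m E))
    mor-ᵗ m (Π D E)    = Π (mor-ᵗ m D) (mor-ᵗ (under m) E)
    mor-ᵗ m (name p)   = name p
    mor-ᵗ m (New p D)  = New p (mor-ᵗ (under# m) D)
    mor-ᵗ m (conv D e) = conv (mor-ᵗ m D) (mor-≈ᵏ m e)

    mor-ᵒ : Mor Δ Γ σ → Σ ⨾ Γ ⊢ᵒ M ∶ A → Σ ⨾ Δ ⊢ᵒ subᵒ σ M ∶ subᵗ σ A
    mor-ᵒ {σ = σ} m (con {A = A} p) = castᵒ refl (sym (sub-minimum ty σ A)) (con p)
    mor-ᵒ m (var p)    = on-var m p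
    mor-ᵒ m (nm p)     = nm (on-name m p)
    mor-ᵒ m (lam D E)  = lam (mor-ᵗ m D) (mor-ᵒ (under m) E)
    mor-ᵒ {σ = σ} m (app {B = B} {N = N} D E) =
      castᵒ refl (sym (sub-single ty σ N B)) (app (mor-ᵒ m D) (mor-ᵒ m E))
    mor-ᵒ m (abs p D)  = abs p (mor-ᵒ (under# m) D)
    mor-ᵒ {σ = σ} m (conc {θ = θ} {a = a} {B = B} {M = M} r D)
      with restricted {emb = θ′} r′ m′ e ← restr m r =
      castᵒ (cong (_＠ _) (sym (sub-ren-comm ob {θ = θ′} e M)))
        (sym (sub-ren-single ty {θ = θ′} e a B)) (conc r′ (mor-ᵒ m′ D))
    mor-ᵒ m (conv D e) = conv (mor-ᵒ m D) (mor-≈ᵗ m e)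

    mor-≈ᵏ : Mor Δ Γ σ → Σ ⨾ Γ ⊢ᵏ K ≈ L → Σ ⨾ Δ ⊢ᵏ subᵏ σ K ≈ subᵏ σ L
    mor-≈ᵏ m (≈-sym e)     = ≈-sym (mor-≈ᵏ m e)
    mor-≈ᵏ m (≈-trans e f) = ≈-trans (mor-≈ᵏ m e) (mor-≈ᵏ m f)
    mor-≈ᵏ m type          = type
    mor-≈ᵏ m (Π D e f)     = Π (mor-ᵗ m D) (mor-≈ᵗ m e) (mor-≈ᵏ (under m) f)

    mor-≈ᵗ : Mor Δ Γ σ → Σ ⨾ Γ ⊢ᵗ A ≈ B ∶ K → Σ ⨾ Δ ⊢ᵗ subᵗ σ A ≈ subᵗ σ B ∶ subᵏ σ K
    mor-≈ᵗ m (≈-sym e)     = ≈-sym (mor-≈ᵗ m e)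
    mor-≈ᵗ m (≈-trans e f) = ≈-trans (mor-≈ᵗ m e) (mor-≈ᵗ m f)
    mor-≈ᵗ m (conv e f)    = conv (mor-≈ᵗ m e) (mor-≈ᵏ m f)
    mor-≈ᵗ {σ = σ} m (con {K = K} p) = cast≈ᵗ refl refl (sym (sub-minimum ki σ K)) (con p)
    mor-≈ᵗ {σ = σ} m (app {K = K} {M = M} e f) =
      cast≈ᵗ refl refl (sym (sub-single ki σ M K)) (app (mor-≈ᵗ m e) (mor-≈ᵒ m f))
    mor-≈ᵗ m (Π D e f)     = Π (mor-ᵗ m D) (mor-≈ᵗ m e) (mor-≈ᵗ (under m) f)
    mor-≈ᵗ {σ = σ} m (ext {A₁ = A₁} {A₂} D e) = ext (mor-ᵗ m D)
      (cast≈ᵗ (cong (_· _) (sub-weaken ty σ A₁)) (cong (_· _) (sub-weaken ty σ A₂)) refl (mor-≈ᵗ (under m) e))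
    mor-≈ᵗ m (name p)      = name p
    mor-≈ᵗ m (New p e)     = New p (mor-≈ᵗ (under# m) e)

    mor-≈ᵒ : Mor Δ Γ σ → Σ ⨾ Γ ⊢ᵒ M ≈ N ∶ A → Σ ⨾ Δ ⊢ᵒ subᵒ σ M ≈ subᵒ σ N ∶ subᵗ σ A
    mor-≈ᵒ m (≈-sym e)     = ≈-sym (mor-≈ᵒ m e)
    mor-≈ᵒ m (≈-trans e f) = ≈-trans (mor-≈ᵒ m e) (mor-≈ᵒ m f)
    mor-≈ᵒ m (conv e f)    = conv (mor-≈ᵒ m e) (mor-≈ᵗ m f)
    mor-≈ᵒ m (var p)       = reflᵒ (on-var m p)
    mor-≈ᵒ {σ = σ} m (con {A = A} p) = cast≈ᵒ refl refl (sym (sub-minimum ty σ A)) (con p)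
    mor-≈ᵒ {σ = σ} m (app {B = B} {M₂ = M₂} e f) =
      cast≈ᵒ refl refl (sym (sub-single ty σ M₂ B)) (app (mor-≈ᵒ m e) (mor-≈ᵒ m f))
    mor-≈ᵒ m (lam D e e′ f) = lam (mor-ᵗ m D) (mor-≈ᵗ m e) (mor-≈ᵗ m e′) (mor-≈ᵒ (under m) f)
    mor-≈ᵒ {σ = σ} m (β {B = B} {M₁ = M₁} {N₁ = N₁} {N₂} D e f) =
      cast≈ᵒ refl (sym (sub-single ob σ N₁ N₂)) (sym (sub-single ty σ M₁ B))
        (β (mor-ᵗ m D) (mor-≈ᵒ (under m) e) (mor-≈ᵒ m f))
    mor-≈ᵒ {σ = σ} m (ext {M = M} {N} D E F e) = ext (mor-ᵗ m D) (mor-ᵒ m E) (mor-ᵒ m F)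
      (cast≈ᵒ (cong (_· _) (sub-weaken ob σ M)) (cong (_· _) (sub-weaken ob σ N)) refl (mor-≈ᵒ (under m) e))
    mor-≈ᵒ m (nm p)        = nm (on-name m p)
    mor-≈ᵒ m (abs p e)     = abs p (mor-≈ᵒ (under# m) e)
    mor-≈ᵒ {σ = σ} m (conc {b = b} {A = A} {M} {N} r f)
      with restricted {emb = θ′} r′ m′ e ← restr m r =
      cast≈ᵒ (cong (_＠ _) (sym (sub-ren-comm ob {θ = θ′} e M))) (cong (_＠ _) (sym (sub-ren-comm ob {θ = θ′} e N)))
        (sym (sub-ren-single ty {θ = θ′} e b A)) (conc r′ (mor-≈ᵒ m′ f))
    mor-≈ᵒ {σ = σ} m (β# {b = b} {A = A} {M} {N} r f)
      with restricted {emb = θ′} r′ m′ e ← restr m r =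
      cast≈ᵒ (cong (_＠ σ b) (sym (sub-ren-comm ob {θ = θ′} e (⟨ _ ⟩ M)))) (sym (sub-ren-single {k = nm} ob {θ = θ′} e b N))
        (sym (sub-ren-single ty {θ = θ′} e b A)) (β# r′ (mor-≈ᵒ (under# m′) f))
    mor-≈ᵒ {σ = σ} m (ext# {M = M} {N} p e) = ext# p
      (cast≈ᵒ (cong (_＠ _) (sub-weaken ob σ M)) (cong (_＠ _) (sub-weaken ob σ N)) refl (mor-≈ᵒ (under# m) e))

-- Agreement with an embedding is pointwise because `lift (ι θ)` equals `ι (refl ∷ θ)` only in that
-- sense; the predicate must be closed under binders.
record Renaming (Δ : Ctx t) (Γ : Ctx s) (σ : Sub s t) : Set where
  constructor renaming-via
  field
    {emb}  : s ⊆ t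
    embeds : Γ ⊆ᶜ Δ via emb
    is-ι   : σ ≗ ι emb

isMorphism-renaming : IsMorphism Σ Renaming
isMorphism-renaming = record
  { on-var  = λ { {A = A} (renaming-via w e) p → castᵒ (sym (e _)) (trans (ren≡sub ty _ A) (sub-cong ty (≗-sym e) A)) (var (ren-∋ w p)) }
  ; on-name = λ { (renaming-via w e) p → subst (_ ∋#_∶ _) (sym (e _)) (ren-∋# w p) }
  ; under   = λ { {Δ = Δ} {A = A} (renaming-via w e) → renaming-via
      (subst (λ B → _ ⊆ᶜ Δ ▸ B via _) (trans (ren≡sub ty _ A) (sub-cong ty (≗-sym e) A)) (keep w))
      (≗-trans (lift-cong e) (lift-ι _)) }
  ; under#  = λ { (renaming-via w e) → renaming-via (keep# w) (≗-trans (lift-cong e) (lift-ι _)) }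
  ; restr   = λ { {φ = φ} (renaming-via w e) r → let open RenRestriction (ren-restriction w r) in
      restricted (cast-restriction (sym (e _)) restr) (renaming-via incl (λ _ → refl))
        (≗-trans (⊙-congˡ e (ι φ)) (ι-square commutes)) }
  }

module _ {Σ : Sig} where
  open Preservation {Σ = Σ} isMorphism-renaming

  wkᵏ : Γ ⊆ᶜ Δ via θ → Σ ⨾ Γ ⊢ᵏ K → Σ ⨾ Δ ⊢ᵏ renᵏ θ K
  wkᵏ w D = castᵏ (sym (ren≡sub ki _ _)) (mor-ᵏ (renaming-via w (λ _ → refl)) D)

  wkᵗ : Γ ⊆ᶜ Δ via θ → Σ ⨾ Γ ⊢ᵗ A ∶ K → Σ ⨾ Δ ⊢ᵗ renᵗ θ A ∶ renᵏ θ K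
  wkᵗ w D = castᵗ (sym (ren≡sub ty _ _)) (sym (ren≡sub ki _ _)) (mor-ᵗ (renaming-via w (λ _ → refl)) D)

  wkᵒ : Γ ⊆ᶜ Δ via θ → Σ ⨾ Γ ⊢ᵒ M ∶ A → Σ ⨾ Δ ⊢ᵒ renᵒ θ M ∶ renᵗ θ A
  wkᵒ w D = castᵒ (sym (ren≡sub ob _ _)) (sym (ren≡sub ty _ _)) (mor-ᵒ (renaming-via w (λ _ → refl)) D)

  wk≈ᵗ : Γ ⊆ᶜ Δ via θ → Σ ⨾ Γ ⊢ᵗ A ≈ B ∶ K → Σ ⨾ Δ ⊢ᵗ renᵗ θ A ≈ renᵗ θ B ∶ renᵏ θ K
  wk≈ᵗ w D = cast≈ᵗ (sym (ren≡sub ty _ _)) (sym (ren≡sub ty _ _)) (sym (ren≡sub ki _ _))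
    (mor-≈ᵗ (renaming-via w (λ _ → refl)) D)

  wk≈ᵒ : Γ ⊆ᶜ Δ via θ → Σ ⨾ Γ ⊢ᵒ M ≈ N ∶ A → Σ ⨾ Δ ⊢ᵒ renᵒ θ M ≈ renᵒ θ N ∶ renᵗ θ A
  wk≈ᵒ w D = cast≈ᵒ (sym (ren≡sub ob _ _)) (sym (ren≡sub ob _ _)) (sym (ren≡sub ty _ _))
    (mor-≈ᵒ (renaming-via w (λ _ → refl)) D)

-- Typed substitutions and functionality

cast-rel : ∀ {P : ∀ {t} → Ctx t → Obj t → Obj t → Ty t → Set} →
  M ≡ M′ → N ≡ N′ → A ≡ B → P Δ M N A → P Δ M′ N′ B
cast-rel refl refl refl p = p

SubRel-resp : ∀ {P : ∀ {t} → Ctx t → Obj t → Obj t → Ty t → Set} →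
  SubRel P Δ Γ σ σ′ → σ ≗ τ → σ′ ≗ τ′ → SubRel P Δ Γ τ τ′
SubRel-resp [] e e′ = []
SubRel-resp {P = P} (_∷_ {A = A} rel p) e e′ = SubRel-resp rel (λ i → e (there i)) (λ i → e′ (there i)) ∷
  cast-rel {P = P} (e (here refl)) (e′ (here refl)) (subᵗ-cong (λ i → e (there i)) A) p
SubRel-resp (name r rel f f′ h) e e′ = name (cast-restriction (e (here refl)) r) rel
  (λ i → trans (sym (e (there i))) (f i)) (λ i → trans (sym (e′ (there i))) (f′ i))
  (trans (sym (e′ (here refl))) (trans h (e (here refl))))

SubRel-left : ∀ {P Q : ∀ {t} → Ctx t → Obj t → Obj t → Ty t → Set} →
  (∀ {t} {Δ : Ctx t} {M N A} → P Δ M N A → Q Δ M M A) →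
  SubRel P Δ Γ σ σ′ → SubRel Q Δ Γ σ σ
SubRel-left f [] = []
SubRel-left {P = P} {Q} f (rel ∷ p) = SubRel-left {P = P} {Q} f rel ∷ f p
SubRel-left {P = P} {Q} f (name r rel e e′ h) = name r (SubRel-left {P = P} {Q} f rel) e e refl

⊙-weaken : (σ : Sub (k ∷ s) t) → σ ⊙ ι weaken ≗ tl σ
⊙-weaken σ {var} i = cong (λ j → σ (there j)) (lookup-⊆-refl i)
⊙-weaken σ {nm} i = cong (λ j → σ (there j)) (lookup-⊆-refl i)

weaken-ι : (θ : s ⊆ t) → ι (weaken {k}) ⊙ ι θ ≗ ι (k ∷ʳ θ)
weaken-ι θ {var} i = cong (λ j → ` there j) (lookup-⊆-refl _)
weaken-ι θ {nm} i = cong there (lookup-⊆-refl _)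

weaken-rest : ∀ {w} {θ : t ⊆ u} {φ : v ⊆ t} {θ₁ : w ⊆ u} {θ₂ : v ⊆ w} {σ : Sub (nm ∷ s) t} {τ : Sub s v} →
  ι θ ⊙ ι φ ≗ ι θ₁ ⊙ ι θ₂ → tl σ ≗ ι φ ⊙ τ → tl (ι θ ⊙ σ) ≗ ι θ₁ ⊙ (ι θ₂ ⊙ τ)
weaken-rest {θ = θ} {φ} {θ₁} {θ₂} {τ = τ} c e =
  ≗-trans (⊙-congʳ e (ι θ)) (≗-trans (≗-sym (⊙-assoc (ι θ) (ι φ) τ))
    (≗-trans (⊙-congˡ c τ) (⊙-assoc (ι θ₁) (ι θ₂) τ)))

-- What going under binders and restricting require of the relation. It is instantiated by typing,
-- by typed equality, and by typing combined with a bound on normal forms.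
record Stable (P : ∀ {t} → Ctx t → Obj t → Obj t → Ty t → Set) : Set where
  field
    weakens : ∀ {s t} {Γ : Ctx s} {Δ : Ctx t} {θ M N A} →
              Γ ⊆ᶜ Δ via θ → P Γ M N A → P Δ (renᵒ θ M) (renᵒ θ N) (renᵗ θ A)
    vars    : ∀ {s} {Γ : Ctx s} {x A} → Γ ∋ x ∶ A → P Γ (` x) (` x) A

module SubRelProperties {P : ∀ {t} → Ctx t → Obj t → Obj t → Ty t → Set} (stable : Stable P) where
  open Stable stable

  SubRel-var : ∀ {x} → SubRel P Δ Γ σ σ′ → Γ ∋ x ∶ A → P Δ (σ x) (σ′ x) (subᵗ σ A)
  SubRel-var {σ = σ} (_∷_ {A = A} rel p) here =
    subst (P _ _ _) (sym (trans (sub-ren ty σ weaken A) (sub-cong ty (⊙-weaken σ) A))) p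
  SubRel-var {σ = σ} (rel ∷ _) (there {A = A} p) =
    subst (P _ _ _) (sym (trans (sub-ren ty σ weaken A) (sub-cong ty (⊙-weaken σ) A))) (SubRel-var rel p)
  SubRel-var {σ = σ} {σ′ = σ′} (name {τ = τ} {τ′} {θ = θ} r rel e e′ h) (there# {x = x} {A = A} p) =
    cast-rel {P = P}
      (sym (trans (e x) (sym (renᵒ-sub θ (τ x))))) (sym (trans (e′ x) (sym (renᵒ-sub θ (τ′ x)))))
      (sym (trans (sub-ren ty σ weaken A) (trans (sub-cong ty (≗-trans (⊙-weaken σ) e) A) (sym (ren-sub ty θ τ A)))))
      (weakens (restriction-⊆ᶜ r) (SubRel-var rel p))

  SubRel-name : SubRel P Δ Γ σ σ′ → Γ ∋# a ∶ α → Δ ∋# σ a ∶ α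
  SubRel-name (rel ∷ _) (there p) = SubRel-name rel p
  SubRel-name (name r rel e e′ h) here = restricted-name r
  SubRel-name (name r rel e e′ h) (there# {a = a} p) =
    subst (_ ∋#_∶ _) (sym (e a)) (ren-∋# (restriction-⊆ᶜ r) (SubRel-name rel p))

  SubRel-name≡ : SubRel P Δ Γ σ σ′ → Γ ∋# a ∶ α → σ′ a ≡ σ a
  SubRel-name≡ (rel ∷ _) (there p) = SubRel-name≡ rel p
  SubRel-name≡ (name r rel e e′ h) here = h
  SubRel-name≡ (name {θ = θ} r rel e e′ h) (there# {a = a} p) =
    trans (e′ a) (trans (cong (lookup θ) (SubRel-name≡ rel p)) (sym (e a)))

  SubRel-weaken : Δ ⊆ᶜ Δ′ via θ → SubRel P Δ Γ σ σ′ → SubRel P Δ′ Γ (ι θ ⊙ σ) (ι θ ⊙ σ′)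
  SubRel-weaken w [] = []
  SubRel-weaken {θ = θ} {σ = σ} {σ′} w (_∷_ {A = A} rel p) = SubRel-weaken w rel ∷
    cast-rel {P = P} (renᵒ-sub θ (σ (here refl))) (renᵒ-sub θ (σ′ (here refl))) (renᵗ-subᵗ θ (tl σ) A) (weakens w p)
  SubRel-weaken {θ = θ} {σ = σ} {σ′} w (name {τ = τ} {τ′} {θ = φ} r rel e e′ h)
    with restricted {emb = θ₁} {θ₂} r′ w′ c ← ren-restriction w r =
    name r′ (SubRel-weaken w′ rel) (weaken-rest {σ = σ} (ι-square c) e) (weaken-rest {σ = σ′} (ι-square c) e′) (cong (lookup θ) h)

  SubRel-lift : SubRel P Δ Γ σ σ′ → SubRel P (Δ ▸ subᵗ σ A) (Γ ▸ A) (lift σ) (lift σ′)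
  SubRel-lift {σ = σ} {σ′} {A = A} rel =
    SubRel-resp {P = P} (SubRel-weaken ⊆ᶜ-weaken rel) (≗-sym (tl-lift σ)) (≗-sym (tl-lift σ′)) ∷
    subst (P _ _ _) (trans (renᵗ-subᵗ weaken σ A) (subᵗ-cong (≗-sym (tl-lift σ)) A)) (vars here)

  SubRel-lift# : SubRel P Δ Γ σ σ′ → SubRel P (Δ # α) (Γ # α) (lift σ) (lift σ′)
  SubRel-lift# {σ = σ} {σ′} rel = name here rel (tl-lift σ) (tl-lift σ′) refl

  SubRel-ι : Γ ⊆ᶜ Δ via θ → SubRel P Δ Γ (ι θ) (ι θ)
  SubRel-ι ∙ = []
  SubRel-ι {θ = refl ∷ θ} (keep {Γ = Γ} {A = A} w) = SubRel-resp {P = P}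
    (subst (λ B → SubRel P (_ ▸ B) (Γ ▸ A) _ _) (sym (ren≡sub ty θ A)) (SubRel-lift (SubRel-ι w)))
    (lift-ι θ) (lift-ι θ)
  SubRel-ι {θ = refl ∷ θ} (keep# w) = SubRel-resp {P = P} (SubRel-lift# (SubRel-ι w)) (lift-ι θ) (lift-ι θ)
  SubRel-ι {θ = _ ∷ʳ θ} (skip w)  = SubRel-resp {P = P} (SubRel-weaken ⊆ᶜ-weaken (SubRel-ι w)) (weaken-ι θ) (weaken-ι θ)
  SubRel-ι {θ = _ ∷ʳ θ} (skip# w)  = SubRel-resp {P = P} (SubRel-weaken (skip# (⊆ᶜ-refl _)) (SubRel-ι w)) (weaken-ι θ) (weaken-ι θ)

  SubRel-id : SubRel P Γ Γ idˢ idˢ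
  SubRel-id = SubRel-resp {P = P} (SubRel-ι (⊆ᶜ-refl _))
    (λ i → cong index (lookup-⊆-refl i)) (λ i → cong index (lookup-⊆-refl i))

  SubRel-single : P Δ M N A → SubRel P Δ (Δ ▸ A) (single M) (single N)
  SubRel-single {A = A} p = SubRel-id ∷ subst (P _ _ _) (sym (subᵗ-id A)) p

  -- The domain is `Γ′ # α` rather than `Γ # α`: with the bound name sent to `a`, whatever replaces
  -- the remaining entries must live in the restriction by `a`.
  SubRel-single# : Γ ⊢ a ∶ α ╲ Γ′ via θ →
    SubRel P Γ (Γ′ # α) (single a ⊙ ι (refl ∷ θ)) (single a ⊙ ι (refl ∷ θ))
  SubRel-single# r = name r SubRel-id (λ { {var} i → refl ; {nm} i → refl }) (λ { {var} i → refl ; {nm} i → refl }) refl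

  -- Changing the type of the last variable is the identity substitution, so conversion of contexts
  -- becomes an instance of the substitution property for every judgment.
  SubRel-convert : P (Γ ▸ B) (` here refl) (` here refl) (renᵗ weaken A) → SubRel P (Γ ▸ B) (Γ ▸ A) idˢ idˢ
  SubRel-convert {A = A} p = SubRel-resp {P = P} (SubRel-ι ⊆ᶜ-weaken) e e ∷
    subst (P _ _ _) (trans (renᵗ-sub weaken A) (subᵗ-cong e A)) p
    where
    e : ι (weaken {k} {s}) ≗ tl idˢ
    e i = cong (λ j → index (there j)) (lookup-⊆-refl i)

-- `SubRel` is binary for the sake of functionality and equality; plain typed substitutions are its
-- diagonal, with the second object ignored.
Typed : Sig → Ctx t → Obj t → Obj t → Ty t → Set
Typed Σ Γ M N A = Σ ⨾ Γ ⊢ᵒ M ∶ A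

TSub : Sig → Ctx t → Ctx s → Sub s t → Set
TSub Σ Δ Γ σ = SubRel (Typed Σ) Δ Γ σ σ

stable-typed : Stable (Typed Σ)
stable-typed = record { weakens = wkᵒ ; vars = var }

isMorphism-TSub : IsMorphism Σ (TSub Σ)
isMorphism-TSub {Σ} = record
  { on-var  = SubRel-var
  ; on-name = SubRel-name
  ; under   = SubRel-lift
  ; under#  = SubRel-lift#
  ; restr   = λ m r → let open SubRestriction (sub-restriction m r) in
      restricted restr (SubRel-left {P = Typed Σ} {Q = Typed Σ} (λ D → D) rel) commutes
  }
  where open SubRelProperties (stable-typed {Σ})

-- The typing of the left object is carried along because regularity is not yet available; its proof
-- relies on functionality.
EqualTyped : Sig → Ctx t → Obj t → Obj t → Ty t → Set
EqualTyped Σ Γ M N A = (Σ ⨾ Γ ⊢ᵒ M ∶ A) × (Σ ⨾ Γ ⊢ᵒ M ≈ N ∶ A)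

ESub : Sig → Ctx t → Ctx s → Sub s t → Sub s t → Set
ESub Σ = SubRel (EqualTyped Σ)

stable-equal : Stable (EqualTyped Σ)
stable-equal = record
  { weakens = λ { w (D , e) → wkᵒ w D , wk≈ᵒ w e } ; vars = λ p → var p , var p }

module _ {Σ : Sig} where
  open Preservation {Σ = Σ} isMorphism-TSub public
    renaming (mor-ᵏ to tsubᵏ; mor-ᵗ to tsubᵗ; mor-ᵒ to tsubᵒ; mor-≈ᵏ to tsub≈ᵏ; mor-≈ᵗ to tsub≈ᵗ; mor-≈ᵒ to tsub≈ᵒ)
  module E = SubRelProperties (stable-equal {Σ})
  module T = SubRelProperties (stable-typed {Σ})

  ESub-left : ESub Σ Δ Γ σ σ′ → TSub Σ Δ Γ σ
  ESub-left = SubRel-left {P = EqualTyped Σ} {Q = Typed Σ} proj₁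

  mutual
    functionalᵏ : ESub Σ Δ Γ σ σ′ → Σ ⨾ Γ ⊢ᵏ K → Σ ⨾ Δ ⊢ᵏ subᵏ σ K ≈ subᵏ σ′ K
    functionalᵏ m type    = type
    functionalᵏ m (Π D E) = Π (tsubᵗ (ESub-left m) D) (functionalᵗ m D) (functionalᵏ (E.SubRel-lift m) E)

    functionalᵗ : ESub Σ Δ Γ σ σ′ → Σ ⨾ Γ ⊢ᵗ A ∶ K → Σ ⨾ Δ ⊢ᵗ subᵗ σ A ≈ subᵗ σ′ A ∶ subᵏ σ K
    functionalᵗ {σ = σ} m (con {K = K} p) = cast≈ᵗ refl refl (sym (sub-minimum ki σ K)) (con p)
    functionalᵗ {σ = σ} m (app {K = K} {M = M} D E) =
      cast≈ᵗ refl refl (sym (sub-single ki σ M K)) (app (functionalᵗ m D) (functionalᵒ m E))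
    functionalᵗ m (Π D E) = Π (tsubᵗ (ESub-left m) D) (functionalᵗ m D) (functionalᵗ (E.SubRel-lift m) E)
    functionalᵗ m (name p) = name p
    functionalᵗ m (New p D) = New p (functionalᵗ (E.SubRel-lift# m) D)
    functionalᵗ m (conv D e) = conv (functionalᵗ m D) (≈-sym (tsub≈ᵏ (ESub-left m) e))

    functionalᵒ : ESub Σ Δ Γ σ σ′ → Σ ⨾ Γ ⊢ᵒ M ∶ A → Σ ⨾ Δ ⊢ᵒ subᵒ σ M ≈ subᵒ σ′ M ∶ subᵗ σ A
    functionalᵒ {σ = σ} m (con {A = A} p) = cast≈ᵒ refl refl (sym (sub-minimum ty σ A)) (con p)
    functionalᵒ m (var p) = proj₂ (E.SubRel-var m p)
    functionalᵒ {σ = σ} m (nm p) = cast≈ᵒ refl (cong nm (sym (E.SubRel-name≡ m p))) refl (nm (E.SubRel-name m p))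
    functionalᵒ m (lam D E) = lam (tsubᵗ (ESub-left m) D) (tsub≈ᵗ (ESub-left m) (reflᵗ D)) (≈-sym (functionalᵗ m D))
      (functionalᵒ (E.SubRel-lift m) E)
    functionalᵒ {σ = σ} m (app {B = B} {N = N} D E) =
      cast≈ᵒ refl refl (sym (sub-single ty σ N B)) (app (functionalᵒ m D) (functionalᵒ m E))
    functionalᵒ m (abs p D) = abs p (functionalᵒ (E.SubRel-lift# m) D)
    functionalᵒ {σ = σ} {σ′} m (conc {a = a} {B = B} {M = M} r D)
      with restricted {emb = θ′} r′ m′ e e′ ← sub-restriction m r =
      cast≈ᵒ (cong (_＠ _) (sym (sub-ren-comm ob {θ = θ′} e M)))
        (cong₂ _＠_ (sym (sub-ren-comm ob {θ = θ′} e′ M)) (sym (E.SubRel-name≡ m (restricted-name r))))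
        (sym (sub-ren-single ty {θ = θ′} e a B)) (conc r′ (functionalᵒ m′ D))
    functionalᵒ m (conv D e) = conv (functionalᵒ m D) (tsub≈ᵗ (ESub-left m) e)

-- Regularity

infix 4 _⊑_

_⊑_ : Sig → Sig → Set
Σ ⊑ Σ′ = ∀ {d} → d ∈ Σ → d ∈ Σ′

mutual
  sig-wkᵏ : ∀ {Σ Σ′} → Σ ⊑ Σ′ → Σ ⨾ Γ ⊢ᵏ K → Σ′ ⨾ Γ ⊢ᵏ K
  sig-wkᵏ i type    = type
  sig-wkᵏ i (Π D E) = Π (sig-wkᵗ i D) (sig-wkᵏ i E)

  sig-wkᵗ : ∀ {Σ Σ′} → Σ ⊑ Σ′ → Σ ⨾ Γ ⊢ᵗ A ∶ K → Σ′ ⨾ Γ ⊢ᵗ A ∶ K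
  sig-wkᵗ i (con p)    = con (i p)
  sig-wkᵗ i (app D E)  = app (sig-wkᵗ i D) (sig-wkᵒ i E)
  sig-wkᵗ i (Π D E)    = Π (sig-wkᵗ i D) (sig-wkᵗ i E)
  sig-wkᵗ i (name p)   = name (i p)
  sig-wkᵗ i (New p D)  = New (i p) (sig-wkᵗ i D)
  sig-wkᵗ i (conv D e) = conv (sig-wkᵗ i D) (sig-wk≈ᵏ i e)

  sig-wkᵒ : ∀ {Σ Σ′} → Σ ⊑ Σ′ → Σ ⨾ Γ ⊢ᵒ M ∶ A → Σ′ ⨾ Γ ⊢ᵒ M ∶ A
  sig-wkᵒ i (con p)    = con (i p)
  sig-wkᵒ i (var p)    = var p
  sig-wkᵒ i (nm p)     = nm p
  sig-wkᵒ i (lam D E)  = lam (sig-wkᵗ i D) (sig-wkᵒ i E)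
  sig-wkᵒ i (app D E)  = app (sig-wkᵒ i D) (sig-wkᵒ i E)
  sig-wkᵒ i (abs p D)  = abs (i p) (sig-wkᵒ i D)
  sig-wkᵒ i (conc r D) = conc r (sig-wkᵒ i D)
  sig-wkᵒ i (conv D e) = conv (sig-wkᵒ i D) (sig-wk≈ᵗ i e)

  sig-wk≈ᵏ : ∀ {Σ Σ′} → Σ ⊑ Σ′ → Σ ⨾ Γ ⊢ᵏ K ≈ L → Σ′ ⨾ Γ ⊢ᵏ K ≈ L
  sig-wk≈ᵏ i (≈-sym e)     = ≈-sym (sig-wk≈ᵏ i e)
  sig-wk≈ᵏ i (≈-trans e f) = ≈-trans (sig-wk≈ᵏ i e) (sig-wk≈ᵏ i f)
  sig-wk≈ᵏ i type          = type
  sig-wk≈ᵏ i (Π D e f)     = Π (sig-wkᵗ i D) (sig-wk≈ᵗ i e) (sig-wk≈ᵏ i f)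

  sig-wk≈ᵗ : ∀ {Σ Σ′} → Σ ⊑ Σ′ → Σ ⨾ Γ ⊢ᵗ A ≈ B ∶ K → Σ′ ⨾ Γ ⊢ᵗ A ≈ B ∶ K
  sig-wk≈ᵗ i (≈-sym e)     = ≈-sym (sig-wk≈ᵗ i e)
  sig-wk≈ᵗ i (≈-trans e f) = ≈-trans (sig-wk≈ᵗ i e) (sig-wk≈ᵗ i f)
  sig-wk≈ᵗ i (conv e f)    = conv (sig-wk≈ᵗ i e) (sig-wk≈ᵏ i f)
  sig-wk≈ᵗ i (con p)       = con (i p)
  sig-wk≈ᵗ i (app e f)     = app (sig-wk≈ᵗ i e) (sig-wk≈ᵒ i f)
  sig-wk≈ᵗ i (Π D e f)     = Π (sig-wkᵗ i D) (sig-wk≈ᵗ i e) (sig-wk≈ᵗ i f)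
  sig-wk≈ᵗ i (ext D e)     = ext (sig-wkᵗ i D) (sig-wk≈ᵗ i e)
  sig-wk≈ᵗ i (name p)      = name (i p)
  sig-wk≈ᵗ i (New p e)     = New (i p) (sig-wk≈ᵗ i e)

  sig-wk≈ᵒ : ∀ {Σ Σ′} → Σ ⊑ Σ′ → Σ ⨾ Γ ⊢ᵒ M ≈ N ∶ A → Σ′ ⨾ Γ ⊢ᵒ M ≈ N ∶ A
  sig-wk≈ᵒ i (≈-sym e)       = ≈-sym (sig-wk≈ᵒ i e)
  sig-wk≈ᵒ i (≈-trans e f)   = ≈-trans (sig-wk≈ᵒ i e) (sig-wk≈ᵒ i f)
  sig-wk≈ᵒ i (conv e f)      = conv (sig-wk≈ᵒ i e) (sig-wk≈ᵗ i f)
  sig-wk≈ᵒ i (var p)         = var p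
  sig-wk≈ᵒ i (con p)         = con (i p)
  sig-wk≈ᵒ i (app e f)       = app (sig-wk≈ᵒ i e) (sig-wk≈ᵒ i f)
  sig-wk≈ᵒ i (lam D e e′ f)  = lam (sig-wkᵗ i D) (sig-wk≈ᵗ i e) (sig-wk≈ᵗ i e′) (sig-wk≈ᵒ i f)
  sig-wk≈ᵒ i (β D e f)       = β (sig-wkᵗ i D) (sig-wk≈ᵒ i e) (sig-wk≈ᵒ i f)
  sig-wk≈ᵒ i (ext D E F e)   = ext (sig-wkᵗ i D) (sig-wkᵒ i E) (sig-wkᵒ i F) (sig-wk≈ᵒ i e)
  sig-wk≈ᵒ i (nm p)          = nm p
  sig-wk≈ᵒ i (abs p e)       = abs (i p) (sig-wk≈ᵒ i e)
  sig-wk≈ᵒ i (conc r e)      = conc r (sig-wk≈ᵒ i e)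
  sig-wk≈ᵒ i (β# r e)        = β# r (sig-wk≈ᵒ i e)
  sig-wk≈ᵒ i (ext# p e)      = ext# (i p) (sig-wk≈ᵒ i e)

sig-obj : ∀ {c A} → ⊢ Σ sig → obj c A ∈ Σ → Σ ⨾ ∙ ⊢ᵗ A ∶ type
sig-obj (fam S _ D) (there p)     = sig-wkᵗ there (sig-obj S p)
sig-obj (obj S _ D) (here refl)   = sig-wkᵗ there D
sig-obj (obj S _ D) (there p)     = sig-wkᵗ there (sig-obj S p)
sig-obj (name S _)  (there p)     = sig-wkᵗ there (sig-obj S p)

sig-fam : ∀ {a K} → ⊢ Σ sig → fam a K ∈ Σ → Σ ⨾ ∙ ⊢ᵏ K
sig-fam (fam S _ D) (here refl)   = sig-wkᵏ there D
sig-fam (fam S _ D) (there p)     = sig-wkᵏ there (sig-fam S p)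
sig-fam (obj S _ D) (there p)     = sig-wkᵏ there (sig-fam S p)
sig-fam (name S _)  (there p)     = sig-wkᵏ there (sig-fam S p)

⊆ᶜ-minimum : (Γ : Ctx s) → ∙ ⊆ᶜ Γ via minimum s
⊆ᶜ-minimum ∙       = ∙
⊆ᶜ-minimum (Γ ▸ A) = skip (⊆ᶜ-minimum Γ)
⊆ᶜ-minimum (Γ # α) = skip# (⊆ᶜ-minimum Γ)

ctx-restrict : Σ ⊢ Γ ctx → Γ ⊢ a ∶ α ╲ Γ′ via θ → Σ ⊢ Γ′ ctx
ctx-restrict (G # p) here       = G
ctx-restrict (G # p) (there# r) = ctx-restrict G r # p
ctx-restrict (G ▸ _) (there r)  = ctx-restrict G r

ctx-var : ∀ {x} → Σ ⊢ Γ ctx → Γ ∋ x ∶ A → Σ ⨾ Γ ⊢ᵗ A ∶ type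
ctx-var (G ▸ D) here       = wkᵗ ⊆ᶜ-weaken D
ctx-var (G ▸ D) (there p)  = wkᵗ ⊆ᶜ-weaken (ctx-var G p)
ctx-var (G # _) (there# p) = wkᵗ (skip# (⊆ᶜ-refl _)) (ctx-var G p)

ctx-name : Σ ⊢ Γ ctx → Γ ∋# a ∶ α → name α ∈ Σ
ctx-name (G ▸ D) (there p)  = ctx-name G p
ctx-name (G # p) here       = p
ctx-name (G # _) (there# p) = ctx-name G p

module _ {Σ : Sig} where

  instᵗ : Σ ⨾ Γ ▸ A ⊢ᵗ B ∶ K → Σ ⨾ Γ ⊢ᵒ N ∶ A → Σ ⨾ Γ ⊢ᵗ B [ N ]ᵗ ∶ K [ N ]ᵏ
  instᵗ D E = tsubᵗ (T.SubRel-single {N = _} E) D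

  instᵏ : Σ ⨾ Γ ▸ A ⊢ᵏ K → Σ ⨾ Γ ⊢ᵒ N ∶ A → Σ ⨾ Γ ⊢ᵏ K [ N ]ᵏ
  instᵏ D E = tsubᵏ (T.SubRel-single {N = _} E) D

  instᵒ : Σ ⨾ Γ ▸ A ⊢ᵒ M ∶ B → Σ ⨾ Γ ⊢ᵒ N ∶ A → Σ ⨾ Γ ⊢ᵒ M [ N ]ᵒ ∶ B [ N ]ᵗ
  instᵒ D E = tsubᵒ (T.SubRel-single {N = _} E) D

  inst≈ᵗ : Σ ⨾ Γ ▸ A ⊢ᵗ B ∶ K → Σ ⨾ Γ ⊢ᵒ M ∶ A → Σ ⨾ Γ ⊢ᵒ M ≈ N ∶ A → Σ ⨾ Γ ⊢ᵗ B [ M ]ᵗ ≈ B [ N ]ᵗ ∶ K [ M ]ᵏ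
  inst≈ᵗ D E e = functionalᵗ (E.SubRel-single (E , e)) D

  inst≈ᵏ : Σ ⨾ Γ ▸ A ⊢ᵏ K → Σ ⨾ Γ ⊢ᵒ M ∶ A → Σ ⨾ Γ ⊢ᵒ M ≈ N ∶ A → Σ ⨾ Γ ⊢ᵏ K [ M ]ᵏ ≈ K [ N ]ᵏ
  inst≈ᵏ D E e = functionalᵏ (E.SubRel-single (E , e)) D

  inst#ᵗ : Γ ⊢ a ∶ α ╲ Γ′ via θ → Σ ⨾ Γ′ # α ⊢ᵗ B ∶ type → Σ ⨾ Γ ⊢ᵗ renᵗ (refl ∷ θ) B [# a ]ᵗ ∶ type
  inst#ᵗ {a = a} {θ = θ} {B = B} r D =
    castᵗ (sym (sub-ren ty (single a) (refl ∷ θ) B)) refl (tsubᵗ (T.SubRel-single# r) D)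

  inst#ᵒ : Γ ⊢ a ∶ α ╲ Γ′ via θ → Σ ⨾ Γ′ # α ⊢ᵒ M ∶ B →
    Σ ⨾ Γ ⊢ᵒ renᵒ (refl ∷ θ) M [# a ]ᵒ ∶ renᵗ (refl ∷ θ) B [# a ]ᵗ
  inst#ᵒ {a = a} {θ = θ} {M = M} {B = B} r D =
    castᵒ (sym (sub-ren ob (single {nm} a) (refl ∷ θ) M)) (sym (sub-ren ty (single {nm} a) (refl ∷ θ) B)) (tsubᵒ (T.SubRel-single# r) D)

  convert : Σ ⨾ Γ ⊢ᵗ A ≈ B ∶ type → TSub Σ (Γ ▸ B) (Γ ▸ A) idˢ
  convert e = T.SubRel-convert (conv (var here) (wk≈ᵗ ⊆ᶜ-weaken (≈-sym e)))

  convertᵗ : Σ ⨾ Γ ⊢ᵗ A ≈ B ∶ type → Σ ⨾ Γ ▸ A ⊢ᵗ C ∶ K → Σ ⨾ Γ ▸ B ⊢ᵗ C ∶ K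
  convertᵗ e D = castᵗ (subᵗ-id _) (sub-id ki _) (tsubᵗ (convert e) D)

  convertᵏ : Σ ⨾ Γ ⊢ᵗ A ≈ B ∶ type → Σ ⨾ Γ ▸ A ⊢ᵏ K → Σ ⨾ Γ ▸ B ⊢ᵏ K
  convertᵏ e D = castᵏ (sub-id ki _) (tsubᵏ (convert e) D)

  convertᵒ : Σ ⨾ Γ ⊢ᵗ A ≈ B ∶ type → Σ ⨾ Γ ▸ A ⊢ᵒ M ∶ C → Σ ⨾ Γ ▸ B ⊢ᵒ M ∶ C
  convertᵒ e D = castᵒ (subᵒ-id _) (subᵗ-id _) (tsubᵒ (convert e) D)

  convert≈ᵗ : Σ ⨾ Γ ⊢ᵗ A ≈ B ∶ type → Σ ⨾ Γ ▸ A ⊢ᵗ C ≈ A′ ∶ K → Σ ⨾ Γ ▸ B ⊢ᵗ C ≈ A′ ∶ K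
  convert≈ᵗ e D = cast≈ᵗ (subᵗ-id _) (subᵗ-id _) (sub-id ki _) (tsub≈ᵗ (convert e) D)

Π-formation : Σ ⨾ Γ ⊢ᵗ Π A B ∶ K → (Σ ⨾ Γ ⊢ᵗ A ∶ type) × (Σ ⨾ Γ ▸ A ⊢ᵗ B ∶ type)
Π-formation (Π D E)    = D , E
Π-formation (conv D _) = Π-formation D

New-formation : Σ ⨾ Γ ⊢ᵗ New α B ∶ K → (name α ∈ Σ) × (Σ ⨾ Γ # α ⊢ᵗ B ∶ type)
New-formation (New p D)  = p , D
New-formation (conv D _) = New-formation D

-- The alternative in `equal` is there because turning a syntactic equality of types into a
-- derivation needs the type to be well formed, and validity is proved only later, with the help of
-- this inversion.
record Concretion (Σ : Sig) (Γ : Ctx s) (M : Obj s) (a : nm ∈ s) (A : Ty s) : Set where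
  constructor concretion
  field
    {scope} : Scope
    {ctx}   : Ctx scope
    {emb}   : scope ⊆ s
    {nty}   : NameTy
    {body}  : Ty (nm ∷ scope)
    {head}  : Obj scope
    restr   : Γ ⊢ a ∶ nty ╲ ctx via emb
    typed   : Σ ⨾ ctx ⊢ᵒ head ∶ New nty body
    is-ren  : M ≡ renᵒ emb head
    equal   : (renᵗ (refl ∷ emb) body [# a ]ᵗ ≡ A) ⊎ (Σ ⨾ Γ ⊢ᵗ renᵗ (refl ∷ emb) body [# a ]ᵗ ≈ A ∶ type)

invert-＠ : Σ ⨾ Γ ⊢ᵒ M ＠ a ∶ A → Concretion Σ Γ M a A
invert-＠ (conc r D) = concretion r D refl (inj₁ refl)
invert-＠ (conv D e) with invert-＠ D
... | concretion r E eq (inj₁ refl) = concretion r E eq (inj₂ e)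
... | concretion r E eq (inj₂ f)    = concretion r E eq (inj₂ (≈-trans f e))

-- Recovers the typing that `ext#` does not assume. Restricting `Γ # α` by its newest name gives
-- back `Γ`, so inverting the concretion types some head over `Γ`, and injectivity of weakening
-- shows that this head is `M`.
New-intro-＠ : name α ∈ Σ → Σ ⨾ Γ # α ⊢ᵒ renᵒ weaken M ＠ here refl ∶ A → Σ ⨾ Γ ⊢ᵒ M ∶ New α A
New-intro-＠ {α = α} {Σ} {Γ = Γ} p D with invert-＠ D
... | concretion {body = B} here E eq f with refl ← renᵒ-inj weaken eq = convert-body f
  where
  convert-body : ∀ {A} → (renᵗ (refl ∷ weaken) B [# here refl ]ᵗ ≡ A) ⊎ (Σ ⨾ Γ # α ⊢ᵗ renᵗ (refl ∷ weaken) B [# here refl ]ᵗ ≈ A ∶ type) →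
    Σ ⨾ Γ ⊢ᵒ _ ∶ New α A
  convert-body (inj₁ refl) = castᵒ refl (cong (New α) (sym (ren-single-here ty B))) E
  convert-body (inj₂ f) = conv E (New p (cast≈ᵗ (ren-single-here ty B) refl refl f))

-- Extensionality of families has premises about A · x only; recovering the kind of A itself
-- from them would need strengthening, so families are only ever considered fully applied.
Saturated : (Σ : Sig) (Γ : Ctx s) → Ty s → Kind s → Set
Saturated Σ Γ A type    = Σ ⨾ Γ ⊢ᵗ A ∶ type
Saturated Σ Γ A (Π C K) = Saturated Σ (Γ ▸ C) (renᵗ weaken A · ` here refl) K

saturated-sub : TSub Σ Δ Γ σ → (K : Kind _) → Saturated Σ Γ A K → Saturated Σ Δ (subᵗ σ A) (subᵏ σ K)
saturated-sub m type D = tsubᵗ m D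
saturated-sub {Σ} {Δ = Δ} {σ = σ} {A = A} m (Π C K) D =
  subst (λ B → Saturated Σ (Δ ▸ subᵗ σ C) (B · ` here refl) (subᵏ (lift σ) K)) (sub-weaken ty σ A) (saturated-sub (T.SubRel-lift m) K D)

saturated-convert : Σ ⨾ Γ ⊢ᵗ B ≈ C ∶ type → Saturated Σ (Γ ▸ B) A K → Saturated Σ (Γ ▸ C) A K
saturated-convert {A = A} {K = K} e D =
  subst₂ (Saturated _ _) (subᵗ-id A) (sub-id ki K) (saturated-sub (convert e) K D)

mutual
  -- Equal kinds have equal domains one by one, so each variable to which the family is applied can
  -- be retyped. Both directions are proved together since `≈-sym` swaps them and the recursion must
  -- stay structural.
  saturated-≈ : Σ ⨾ Γ ⊢ᵏ K ≈ L → Saturated Σ Γ A K → Saturated Σ Γ A L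
  saturated-≈ (≈-sym e) D     = saturated-≈˘ e D
  saturated-≈ (≈-trans e f) D = saturated-≈ f (saturated-≈ e D)
  saturated-≈ type D          = D
  saturated-≈ (Π {L = L} _ e f) D = saturated-convert {K = L} e (saturated-≈ f D)

  saturated-≈˘ : Σ ⨾ Γ ⊢ᵏ K ≈ L → Saturated Σ Γ A L → Saturated Σ Γ A K
  saturated-≈˘ (≈-sym e) D     = saturated-≈ e D
  saturated-≈˘ (≈-trans e f) D = saturated-≈˘ e (saturated-≈˘ f D)
  saturated-≈˘ type D          = D
  saturated-≈˘ (Π {L = L} _ e f) D = saturated-≈˘ f (saturated-convert {K = L} (≈-sym e) D)

kinding-saturated : (K : Kind s) → Σ ⨾ Γ ⊢ᵗ A ∶ K → Saturated Σ Γ A K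
kinding-saturated type D    = D
kinding-saturated (Π C K) D = kinding-saturated K
  (castᵗ refl (ren-single-here ki K) (app (wkᵗ ⊆ᶜ-weaken D) (var here)))

saturated-app : (K : Kind (var ∷ s)) → Saturated Σ Γ A (Π C K) → Σ ⨾ Γ ⊢ᵒ M ∶ C → Saturated Σ Γ (A · M) (K [ M ]ᵏ)
saturated-app {Σ = Σ} {Γ = Γ} {A = A} {M = M} K D E = subst (λ B → Saturated Σ Γ (B · M) (K [ M ]ᵏ)) (weaken-single ty M A)
  (saturated-sub (T.SubRel-single {N = M} E) K D)

module Regularity {Σ : Sig} (S : ⊢ Σ sig) where
  mutual
    regularᵏ : Σ ⊢ Γ ctx → Σ ⨾ Γ ⊢ᵏ K ≈ L → (Σ ⨾ Γ ⊢ᵏ K) × (Σ ⨾ Γ ⊢ᵏ L)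
    regularᵏ G (≈-sym e) = let D , E = regularᵏ G e in E , D
    regularᵏ G (≈-trans e f) = proj₁ (regularᵏ G e) , proj₂ (regularᵏ G f)
    regularᵏ G type = type , type
    regularᵏ G (Π D e f) = let _ , F , _ = regularᵗ G e ; K , L = regularᵏ (G ▸ D) f in
      Π D K , Π F (convertᵏ e L)

    regularᵗ : Σ ⊢ Γ ctx → Σ ⨾ Γ ⊢ᵗ A ≈ B ∶ K → Saturated Σ Γ A K × Saturated Σ Γ B K × (Σ ⨾ Γ ⊢ᵏ K)
    regularᵗ G (≈-sym e) = let D , E , F = regularᵗ G e in E , D , F
    regularᵗ G (≈-trans e f) = let D , _ , F = regularᵗ G e ; _ , E , _ = regularᵗ G f in D , E , F
    regularᵗ G (conv e f) = let D , E , _ = regularᵗ G e in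
      saturated-≈ f D , saturated-≈ f E , proj₂ (regularᵏ G f)
    regularᵗ {Γ = Γ} G (con p) = kinding-saturated _ (con p) , kinding-saturated _ (con p) ,
      wkᵏ (⊆ᶜ-minimum Γ) (sig-fam S p)
    regularᵗ G (app {A = A} {B = B} {K = K} e f) with regularᵗ G e | regularᵒ G f
    ... | D , E , Π _ F | M , N , _ =
      -- The rule assigns `K [ M ]ᵏ` to both sides, whereas `B · N` arises at `K [ N ]ᵏ`;
      -- functionality of `K` connects the two.
      saturated-app {A = A} K D M , saturated-≈˘ (inst≈ᵏ F M f) (saturated-app {A = B} K E N) , instᵏ F M
    regularᵗ G (Π D e f) = let _ , E , _ = regularᵗ G e ; F , H , _ = regularᵗ (G ▸ D) f in
      Π D F , Π E (convertᵗ e H) , type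
    regularᵗ G (ext D e) = let E , F , H = regularᵗ (G ▸ D) e in E , F , Π D H
    regularᵗ G (name p) = name p , name p , type
    regularᵗ G (New p e) = let D , E , _ = regularᵗ (G # p) e in New p D , New p E , type

    regularᵒ : Σ ⊢ Γ ctx → Σ ⨾ Γ ⊢ᵒ M ≈ N ∶ A → (Σ ⨾ Γ ⊢ᵒ M ∶ A) × (Σ ⨾ Γ ⊢ᵒ N ∶ A) × (Σ ⨾ Γ ⊢ᵗ A ∶ type)
    regularᵒ G (≈-sym e) = let D , E , F = regularᵒ G e in E , D , F
    regularᵒ G (≈-trans e f) = let D , _ , F = regularᵒ G e ; _ , E , _ = regularᵒ G f in D , E , F
    regularᵒ G (conv e f) = let D , E , _ = regularᵒ G e in
      conv D f , conv E f , proj₁ (proj₂ (regularᵗ G f))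
    regularᵒ G (var p) = var p , var p , ctx-var G p
    regularᵒ {Γ = Γ} G (con p) = con p , con p , wkᵗ (⊆ᶜ-minimum Γ) (sig-obj S p)
    regularᵒ G (app e f) =
      let D , E , F = regularᵒ G e ; M , N , _ = regularᵒ G f ; _ , B = Π-formation F in
      app D M , conv (app E N) (≈-sym (inst≈ᵗ B M f)) , instᵗ B M
    regularᵒ G (lam D e e′ f) =
      let E , _ = regularᵗ G e ; E′ , _ = regularᵗ G e′ ; M , N , B = regularᵒ (G ▸ D) f in
      conv (lam E (convertᵒ (≈-sym e) M)) (Π E e (reflᵗ (convertᵗ (≈-sym e) B))) ,
      conv (lam E′ (convertᵒ (≈-sym e′) N)) (Π E′ e′ (reflᵗ (convertᵗ (≈-sym e′) B))) ,
      Π D B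
    regularᵒ G (β D e f) = let M₂ , N₂ , B = regularᵒ (G ▸ D) e ; M₁ , N₁ , _ = regularᵒ G f in
      app (lam D M₂) M₁ , conv (instᵒ N₂ N₁) (≈-sym (inst≈ᵗ B M₁ f)) , instᵗ B M₁
    regularᵒ G (ext D E F e) = E , F , validity G E
    regularᵒ G (nm p) = nm p , nm p , name (ctx-name G p)
    regularᵒ G (abs p e) = let D , E , F = regularᵒ (G # p) e in abs p D , abs p E , New p F
    regularᵒ G (conc r e) = let D , E , F = regularᵒ (ctx-restrict G r) e ; _ , B = New-formation F in
      conc r D , conc r E , inst#ᵗ r B
    regularᵒ G (β# r e) = let p = ctx-name G (restricted-name r) ; D , E , F = regularᵒ (ctx-restrict G r # p) e in
      conc r (abs p D) , inst#ᵒ r E , inst#ᵗ r F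
    regularᵒ G (ext# p e) = let D , E , F = regularᵒ (G # p) e in
      New-intro-＠ p D , New-intro-＠ p E , New p F

    -- Interleaved with regularity: the type reached by `conv` is well formed because equality is
    -- regular, and the type in `ext` for objects is only known through a typing premise.
    validity : Σ ⊢ Γ ctx → Σ ⨾ Γ ⊢ᵒ M ∶ A → Σ ⨾ Γ ⊢ᵗ A ∶ type
    validity {Γ = Γ} G (con p) = wkᵗ (⊆ᶜ-minimum Γ) (sig-obj S p)
    validity G (var p) = ctx-var G p
    validity G (nm p) = name (ctx-name G p)
    validity G (lam D E) = Π D (validity (G ▸ D) E)
    validity G (app D E) = instᵗ (proj₂ (Π-formation (validity G D))) E
    validity G (abs p D) = New p (validity (G # p) D)
    validity G (conc r D) = inst#ᵗ r (proj₂ (New-formation (validity (ctx-restrict G r) D)))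
    validity G (conv D e) = proj₁ (proj₂ (regularᵗ G e))

-- Simple types, injectivity and inversion

infixr 5 _⇒_

data STy : Set where
  o   : STy
  _⇒_ : STy → STy → STy
  ν   : STy → STy

-- The value on Π A B · M and New α B · M is irrelevant, as these are ill-kinded; with this choice
-- equal families have equal erasures whatever their kind.
⌊_⌋ : Ty s → STy
⌊ con a ⌋   = o
⌊ A · M ⌋   = ⌊ A ⌋
⌊ Π A B ⌋   = ⌊ A ⌋ ⇒ ⌊ B ⌋
⌊ name α ⌋  = o
⌊ New α B ⌋ = ν ⌊ B ⌋

⌊_⌋ᵏ : Kind s → List STy
⌊ type ⌋ᵏ  = []
⌊ Π A K ⌋ᵏ = ⌊ A ⌋ ∷ ⌊ K ⌋ᵏ

⌊sub⌋ : (σ : Sub s t) (A : Ty s) → ⌊ subᵗ σ A ⌋ ≡ ⌊ A ⌋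
⌊sub⌋ σ (con a)   = refl
⌊sub⌋ σ (A · M)   = ⌊sub⌋ σ A
⌊sub⌋ σ (Π A B)   = cong₂ _⇒_ (⌊sub⌋ σ A) (⌊sub⌋ (lift σ) B)
⌊sub⌋ σ (name α)  = refl
⌊sub⌋ σ (New α B) = cong ν (⌊sub⌋ (lift σ) B)

⌊ren⌋ : (θ : s ⊆ t) (A : Ty s) → ⌊ renᵗ θ A ⌋ ≡ ⌊ A ⌋
⌊ren⌋ θ A = trans (cong ⌊_⌋ (renᵗ-sub θ A)) (⌊sub⌋ (ι θ) A)

⌊sub⌋ᵏ : (σ : Sub s t) (K : Kind s) → ⌊ subᵏ σ K ⌋ᵏ ≡ ⌊ K ⌋ᵏ
⌊sub⌋ᵏ σ type    = refl
⌊sub⌋ᵏ σ (Π A K) = cong₂ _∷_ (⌊sub⌋ σ A) (⌊sub⌋ᵏ (lift σ) K)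

⌊ren⌋ᵏ : (θ : s ⊆ t) (K : Kind s) → ⌊ renᵏ θ K ⌋ᵏ ≡ ⌊ K ⌋ᵏ
⌊ren⌋ᵏ θ K = trans (cong ⌊_⌋ᵏ (renᵏ-sub θ K)) (⌊sub⌋ᵏ (ι θ) K)

⌊⌋-≈ : Σ ⨾ Γ ⊢ᵗ A ≈ B ∶ K → ⌊ A ⌋ ≡ ⌊ B ⌋
⌊⌋-≈ (≈-sym e)     = sym (⌊⌋-≈ e)
⌊⌋-≈ (≈-trans e f) = trans (⌊⌋-≈ e) (⌊⌋-≈ f)
⌊⌋-≈ (conv e _)    = ⌊⌋-≈ e
⌊⌋-≈ (con _)       = refl
⌊⌋-≈ (app e _)     = ⌊⌋-≈ e
⌊⌋-≈ (Π _ e f)     = cong₂ _⇒_ (⌊⌋-≈ e) (⌊⌋-≈ f)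
⌊⌋-≈ (ext {A₁ = A₁} {A₂} _ e) = trans (sym (⌊ren⌋ weaken A₁)) (trans (⌊⌋-≈ e) (⌊ren⌋ weaken A₂))
⌊⌋-≈ (name _)      = refl
⌊⌋-≈ (New _ e)     = cong ν (⌊⌋-≈ e)

⌊⌋ᵏ-≈ : Σ ⨾ Γ ⊢ᵏ K ≈ L → ⌊ K ⌋ᵏ ≡ ⌊ L ⌋ᵏ
⌊⌋ᵏ-≈ (≈-sym e)     = sym (⌊⌋ᵏ-≈ e)
⌊⌋ᵏ-≈ (≈-trans e f) = trans (⌊⌋ᵏ-≈ e) (⌊⌋ᵏ-≈ f)
⌊⌋ᵏ-≈ type          = refl
⌊⌋ᵏ-≈ (Π _ e f)     = cong₂ _∷_ (⌊⌋-≈ e) (⌊⌋ᵏ-≈ f)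

⌊⌋ᵏ-type : ⌊ K ⌋ᵏ ≡ [] → K ≡ type
⌊⌋ᵏ-type {K = type} refl = refl

-- There is no reduction at the level of families, so Π-types are only equal to Π-types.
mutual
  Π-≈ : ∀ {A₁ A₂} → ⌊ K ⌋ᵏ ≡ [] → Σ ⨾ Γ ⊢ᵗ A ≈ B ∶ K → A ≡ Π A₁ A₂ →
    ∃[ B₁ ] ∃[ B₂ ] B ≡ Π B₁ B₂ × (Σ ⨾ Γ ⊢ᵗ A₁ ≈ B₁ ∶ type) × (Σ ⨾ Γ ▸ A₁ ⊢ᵗ A₂ ≈ B₂ ∶ type)
  Π-≈ k (≈-sym e) refl = Π-≈˘ k e refl
  Π-≈ k (≈-trans e f) refl with _ , _ , refl , e₁ , e₂ ← Π-≈ k e refl with _ , _ , refl , f₁ , f₂ ← Π-≈ k f refl =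
    _ , _ , refl , ≈-trans e₁ f₁ , ≈-trans e₂ (convert≈ᵗ (≈-sym e₁) f₂)
  -- The condition on the erased kind is stable under conversion of kinds, and it is what excludes
  -- `ext`, whose kind is a Π.
  Π-≈ k (conv e f) refl = Π-≈ (trans (⌊⌋ᵏ-≈ f) k) e refl
  Π-≈ k (Π _ e f) refl = _ , _ , refl , e , f

  Π-≈˘ : ∀ {B₁ B₂} → ⌊ K ⌋ᵏ ≡ [] → Σ ⨾ Γ ⊢ᵗ A ≈ B ∶ K → B ≡ Π B₁ B₂ →
    ∃[ A₁ ] ∃[ A₂ ] A ≡ Π A₁ A₂ × (Σ ⨾ Γ ⊢ᵗ B₁ ≈ A₁ ∶ type) × (Σ ⨾ Γ ▸ B₁ ⊢ᵗ B₂ ≈ A₂ ∶ type)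
  Π-≈˘ k (≈-sym e) refl = Π-≈ k e refl
  Π-≈˘ k (≈-trans e f) refl with _ , _ , refl , f₁ , f₂ ← Π-≈˘ k f refl with _ , _ , refl , e₁ , e₂ ← Π-≈˘ k e refl =
    _ , _ , refl , ≈-trans f₁ e₁ , ≈-trans f₂ (convert≈ᵗ (≈-sym f₁) e₂)
  Π-≈˘ k (conv e f) refl = Π-≈˘ (trans (⌊⌋ᵏ-≈ f) k) e refl
  Π-≈˘ k (Π _ e f) refl = _ , _ , refl , ≈-sym e , convert≈ᵗ e (≈-sym f)

Π-injective : ∀ {A₁ A₂ B₁ B₂} → Σ ⨾ Γ ⊢ᵗ Π A₁ A₂ ≈ Π B₁ B₂ ∶ type →
  (Σ ⨾ Γ ⊢ᵗ A₁ ≈ B₁ ∶ type) × (Σ ⨾ Γ ▸ A₁ ⊢ᵗ A₂ ≈ B₂ ∶ type)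
Π-injective e with _ , _ , refl , f , g ← Π-≈ refl e refl = f , g

mutual
  New-≈ : ⌊ K ⌋ᵏ ≡ [] → Σ ⨾ Γ ⊢ᵗ A ≈ B ∶ K → A ≡ New α A′ →
    ∃[ B′ ] B ≡ New α B′ × (Σ ⨾ Γ # α ⊢ᵗ A′ ≈ B′ ∶ type)
  New-≈ k (≈-sym e) refl = New-≈˘ k e refl
  New-≈ k (≈-trans e f) refl with _ , refl , e₁ ← New-≈ k e refl with _ , refl , f₁ ← New-≈ k f refl =
    _ , refl , ≈-trans e₁ f₁
  New-≈ k (conv e f) refl = New-≈ (trans (⌊⌋ᵏ-≈ f) k) e refl
  New-≈ k (New _ e) refl = _ , refl , e

  New-≈˘ : ⌊ K ⌋ᵏ ≡ [] → Σ ⨾ Γ ⊢ᵗ A ≈ B ∶ K → B ≡ New α B′ →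
    ∃[ A′ ] A ≡ New α A′ × (Σ ⨾ Γ # α ⊢ᵗ B′ ≈ A′ ∶ type)
  New-≈˘ k (≈-sym e) refl = New-≈ k e refl
  New-≈˘ k (≈-trans e f) refl with _ , refl , f₁ ← New-≈˘ k f refl with _ , refl , e₁ ← New-≈˘ k e refl =
    _ , refl , ≈-trans f₁ e₁
  New-≈˘ k (conv e f) refl = New-≈˘ (trans (⌊⌋ᵏ-≈ f) k) e refl
  New-≈˘ k (New _ e) refl = _ , refl , ≈-sym e

New-injective : Σ ⨾ Γ ⊢ᵗ New α A ≈ New α′ B ∶ type → α ≡ α′ × (Σ ⨾ Γ # α ⊢ᵗ A ≈ B ∶ type)
New-injective e with _ , refl , f ← New-≈ refl e refl = refl , f

∋-unique : ∀ {x} → Γ ∋ x ∶ A → Γ ∋ x ∶ B → A ≡ B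
∋-unique here here = refl
∋-unique (there p) (there q) = cong (renᵗ weaken) (∋-unique p q)
∋-unique (there# p) (there# q) = cong (renᵗ weaken) (∋-unique p q)

∋#-unique : Γ ∋# a ∶ α → Γ ∋# a ∶ α′ → α ≡ α′
∋#-unique here here = refl
∋#-unique (there p) (there q) = ∋#-unique p q
∋#-unique (there# p) (there# q) = ∋#-unique p q

obj-unique : ∀ {c A B} → ⊢ Σ sig → obj c A ∈ Σ → obj c B ∈ Σ → A ≡ B
obj-unique (obj S f D) (here refl) (here refl) = refl
obj-unique (obj S f D) (here refl) (there q) = ⊥-elim (f q)
obj-unique (obj S f D) (there p) (here refl) = ⊥-elim (f p)
obj-unique (obj S f D) (there p) (there q) = obj-unique S p q
obj-unique (fam S f D) (there p) (there q) = obj-unique S p q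
obj-unique (name S f) (there p) (there q) = obj-unique S p q

fam-unique : ∀ {a K L} → ⊢ Σ sig → fam a K ∈ Σ → fam a L ∈ Σ → K ≡ L
fam-unique (fam S f D) (here refl) (here refl) = refl
fam-unique (fam S f D) (here refl) (there q) = ⊥-elim (f q)
fam-unique (fam S f D) (there p) (here refl) = ⊥-elim (f p)
fam-unique (fam S f D) (there p) (there q) = fam-unique S p q
fam-unique (obj S f D) (there p) (there q) = fam-unique S p q
fam-unique (name S f) (there p) (there q) = fam-unique S p q

module Inversion {Σ : Sig} (S : ⊢ Σ sig) where
  open Regularity S public

  invert-ƛ : Σ ⊢ Γ ctx → Σ ⨾ Γ ⊢ᵒ ƛ A M ∶ C →
    ∃[ B ] (Σ ⨾ Γ ⊢ᵗ A ∶ type) × (Σ ⨾ Γ ▸ A ⊢ᵒ M ∶ B) × (Σ ⨾ Γ ⊢ᵗ Π A B ≈ C ∶ type)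
  invert-ƛ G (lam D E) = _ , D , E , reflᵗ (Π D (validity (G ▸ D) E))
  invert-ƛ G (conv D e) with _ , E , F , f ← invert-ƛ G D = _ , E , F , ≈-trans f e

  invert-⟨⟩ : Σ ⊢ Γ ctx → Σ ⨾ Γ ⊢ᵒ ⟨ α ⟩ M ∶ C →
    ∃[ B ] (name α ∈ Σ) × (Σ ⨾ Γ # α ⊢ᵒ M ∶ B) × (Σ ⨾ Γ ⊢ᵗ New α B ≈ C ∶ type)
  invert-⟨⟩ G (abs p D) = _ , p , D , reflᵗ (New p (validity (G # p) D))
  invert-⟨⟩ G (conv D e) with _ , p , F , f ← invert-⟨⟩ G D = _ , p , F , ≈-trans f e

  invert-· : Σ ⊢ Γ ctx → Σ ⨾ Γ ⊢ᵒ M · N ∶ C →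
    ∃[ A ] ∃[ B ] (Σ ⨾ Γ ⊢ᵒ M ∶ Π A B) × (Σ ⨾ Γ ⊢ᵒ N ∶ A) × (Σ ⨾ Γ ⊢ᵗ B [ N ]ᵗ ≈ C ∶ type)
  invert-· G (app D E) = _ , _ , D , E , reflᵗ (validity G (app D E))
  invert-· G (conv D e) with _ , _ , E , F , f ← invert-· G D = _ , _ , E , F , ≈-trans f e

  invert-con : Σ ⊢ Γ ctx → ∀ {c} → Σ ⨾ Γ ⊢ᵒ con c ∶ C →
    ∃[ A ] (obj c A ∈ Σ) × (Σ ⨾ Γ ⊢ᵗ renᵗ (minimum _) A ≈ C ∶ type)
  invert-con G (con p) = _ , p , reflᵗ (validity G (con p))
  invert-con G (conv D e) with _ , p , f ← invert-con G D = _ , p , ≈-trans f e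

  invert-var : Σ ⊢ Γ ctx → ∀ {x} → Σ ⨾ Γ ⊢ᵒ ` x ∶ C → ∃[ A ] (Γ ∋ x ∶ A) × (Σ ⨾ Γ ⊢ᵗ A ≈ C ∶ type)
  invert-var G (var p) = _ , p , reflᵗ (validity G (var p))
  invert-var G (conv D e) with _ , p , f ← invert-var G D = _ , p , ≈-trans f e

  invert-nm : Σ ⊢ Γ ctx → Σ ⨾ Γ ⊢ᵒ nm a ∶ C → ∃[ α ] (Γ ∋# a ∶ α) × (Σ ⨾ Γ ⊢ᵗ name α ≈ C ∶ type)
  invert-nm G (nm p) = _ , p , reflᵗ (validity G (nm p))
  invert-nm G (conv D e) with _ , p , f ← invert-nm G D = _ , p , ≈-trans f e

  equal-＠ : Σ ⊢ Γ ctx → (c : Concretion Σ Γ M a A) → let open Concretion c in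
    Σ ⨾ Γ ⊢ᵗ renᵗ (refl ∷ emb) body [# a ]ᵗ ≈ A ∶ type
  equal-＠ G (concretion r D _ (inj₁ refl)) = reflᵗ (validity G (conc r D))
  equal-＠ G (concretion r D _ (inj₂ e)) = e

  unique-type : Σ ⊢ Γ ctx → Σ ⨾ Γ ⊢ᵒ M ∶ A → Σ ⨾ Γ ⊢ᵒ M ∶ B → Σ ⨾ Γ ⊢ᵗ A ≈ B ∶ type
  unique-type G (con p) E with _ , q , e ← invert-con G E with refl ← obj-unique S p q = e
  unique-type G (var p) E with _ , q , e ← invert-var G E with refl ← ∋-unique p q = e
  unique-type G (nm p) E with _ , q , e ← invert-nm G E with refl ← ∋#-unique p q = e
  unique-type G (lam D E) F with _ , _ , H , e ← invert-ƛ G F =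
    ≈-trans (Π D (reflᵗ D) (unique-type (G ▸ D) E H)) e
  unique-type G (app D E) F with _ , _ , H , I , e ← invert-· G F
    with f , g ← Π-injective (unique-type G D H) =
    ≈-trans (tsub≈ᵗ (T.SubRel-single {N = _} E) g) e
  unique-type G (abs p D) F with _ , _ , H , e ← invert-⟨⟩ G F =
    ≈-trans (New p (unique-type (G # p) D H)) e
  -- The name determines the restriction and renaming is injective, so both derivations type the
  -- same head in the same context and the induction hypothesis applies there.
  unique-type G (conc {θ = θ} {a = a} {B = B} {M = M} r D) F with invert-＠ F
  ... | c@(concretion {body = B′} r′ E eq _) with refl ← restriction-unique r r′ with refl ← renᵒ-inj θ eq
    with refl , g ← New-injective (unique-type (ctx-restrict G r) D E) =
    ≈-trans (cast≈ᵗ (sym (sub-ren ty (single a) (refl ∷ θ) B)) (sym (sub-ren ty (single a) (refl ∷ θ) B′)) refl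
      (tsub≈ᵗ (T.SubRel-single# r) g)) (equal-＠ G c)
  unique-type G (conv D e) E = ≈-trans (≈-sym e) (unique-type G D E)

  invert-Ty-con : ∀ {a} → Σ ⨾ Γ ⊢ᵗ con a ∶ K → ∃[ L ] (fam a L ∈ Σ) × (Σ ⨾ Γ ⊢ᵏ renᵏ (minimum _) L ≈ K)
  invert-Ty-con {Γ = Γ} (con p) = _ , p , reflᵏ (wkᵏ (⊆ᶜ-minimum Γ) (sig-fam S p))
  invert-Ty-con (conv D e) with _ , p , f ← invert-Ty-con D = _ , p , ≈-trans f (≈-sym e)

  Π-kind : Σ ⨾ Γ ⊢ᵏ Π A K → (Σ ⨾ Γ ⊢ᵗ A ∶ type) × (Σ ⨾ Γ ▸ A ⊢ᵏ K)
  Π-kind (Π D E) = D , E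

  kind-validity : Σ ⊢ Γ ctx → Σ ⨾ Γ ⊢ᵗ A ∶ K → Σ ⨾ Γ ⊢ᵏ K
  kind-validity {Γ = Γ} G (con p) = wkᵏ (⊆ᶜ-minimum Γ) (sig-fam S p)
  kind-validity G (app D E) = instᵏ (proj₂ (Π-kind (kind-validity G D))) E
  kind-validity G (Π D E) = type
  kind-validity G (name p) = type
  kind-validity G (New p D) = type
  kind-validity G (conv D e) = proj₁ (regularᵏ G e)

  invert-Ty-· : Σ ⊢ Γ ctx → Σ ⨾ Γ ⊢ᵗ A · N ∶ K →
    ∃[ C ] ∃[ L ] (Σ ⨾ Γ ⊢ᵗ A ∶ Π C L) × (Σ ⨾ Γ ⊢ᵒ N ∶ C) × (Σ ⨾ Γ ⊢ᵏ L [ N ]ᵏ ≈ K)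
  invert-Ty-· G (app D E) = _ , _ , D , E , reflᵏ (kind-validity G (app D E))
  invert-Ty-· G (conv D e) with _ , _ , E , F , f ← invert-Ty-· G D = _ , _ , E , F , ≈-trans f (≈-sym e)

  mutual
    Πᵏ-≈ : ∀ {A K} → Σ ⨾ Γ ⊢ᵏ L ≈ L′ → L ≡ Π A K →
      ∃[ B ] ∃[ K′ ] L′ ≡ Π B K′ × (Σ ⨾ Γ ⊢ᵗ A ≈ B ∶ type) × (Σ ⨾ Γ ▸ A ⊢ᵏ K ≈ K′)
    Πᵏ-≈ (≈-sym e) refl = Πᵏ-≈˘ e refl
    Πᵏ-≈ (≈-trans e f) refl with _ , _ , refl , e₁ , e₂ ← Πᵏ-≈ e refl with _ , _ , refl , f₁ , f₂ ← Πᵏ-≈ f refl =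
      _ , _ , refl , ≈-trans e₁ f₁ , ≈-trans e₂ (convert≈ᵏ (≈-sym e₁) f₂)
    Πᵏ-≈ (Π _ e f) refl = _ , _ , refl , e , f

    Πᵏ-≈˘ : ∀ {A K} → Σ ⨾ Γ ⊢ᵏ L′ ≈ L → L ≡ Π A K →
      ∃[ B ] ∃[ K′ ] L′ ≡ Π B K′ × (Σ ⨾ Γ ⊢ᵗ A ≈ B ∶ type) × (Σ ⨾ Γ ▸ A ⊢ᵏ K ≈ K′)
    Πᵏ-≈˘ (≈-sym e) refl = Πᵏ-≈ e refl
    Πᵏ-≈˘ (≈-trans e f) refl with _ , _ , refl , f₁ , f₂ ← Πᵏ-≈˘ f refl with _ , _ , refl , e₁ , e₂ ← Πᵏ-≈˘ e refl =
      _ , _ , refl , ≈-trans f₁ e₁ , ≈-trans f₂ (convert≈ᵏ (≈-sym f₁) e₂)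
    Πᵏ-≈˘ (Π _ e f) refl = _ , _ , refl , ≈-sym e , convert≈ᵏ e (≈-sym f)

    convert≈ᵏ : Σ ⨾ Γ ⊢ᵗ A ≈ B ∶ type → Σ ⨾ Γ ▸ A ⊢ᵏ K ≈ L → Σ ⨾ Γ ▸ B ⊢ᵏ K ≈ L
    convert≈ᵏ e D = subst₂ (λ K L → _ ⨾ _ ⊢ᵏ K ≈ L) (sub-id ki _) (sub-id ki _) (tsub≈ᵏ (convert e) D)

  unique-kind : Σ ⊢ Γ ctx → Σ ⨾ Γ ⊢ᵗ A ∶ K → Σ ⨾ Γ ⊢ᵗ A ∶ L → Σ ⨾ Γ ⊢ᵏ K ≈ L
  unique-kind G (con p) E with _ , q , e ← invert-Ty-con E with refl ← fam-unique S p q = e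
  unique-kind G (app D E) F with _ , _ , H , I , e ← invert-Ty-· G F
    with _ , _ , refl , _ , g ← Πᵏ-≈ (unique-kind G D H) refl =
    ≈-trans (tsub≈ᵏ (T.SubRel-single {N = _} E) g) e
  unique-kind G (Π D E) F = subst (_ ⨾ _ ⊢ᵏ _ ≈_) (sym (go F)) type
    where
    go : Σ ⨾ Γ ⊢ᵗ Π A B ∶ L → L ≡ type
    go (Π _ _) = refl
    go (conv D e) = ⌊⌋ᵏ-type (trans (⌊⌋ᵏ-≈ e) (cong ⌊_⌋ᵏ (go D)))
  unique-kind G (name p) F = subst (_ ⨾ _ ⊢ᵏ _ ≈_) (sym (go F)) type
    where
    go : Σ ⨾ Γ ⊢ᵗ name α ∶ L → L ≡ type
    go (name _) = refl
    go (conv D e) = ⌊⌋ᵏ-type (trans (⌊⌋ᵏ-≈ e) (cong ⌊_⌋ᵏ (go D)))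
  unique-kind G (New p D) F = subst (_ ⨾ _ ⊢ᵏ _ ≈_) (sym (go F)) type
    where
    go : Σ ⨾ Γ ⊢ᵗ New α B ∶ L → L ≡ type
    go (New _ _) = refl
    go (conv D e) = ⌊⌋ᵏ-type (trans (⌊⌋ᵏ-≈ e) (cong ⌊_⌋ᵏ (go D)))
  unique-kind G (conv D e) E = ≈-trans e (unique-kind G D E)

-- Normal forms and hereditary substitution

variable
  c : ObjConst
  ρ ϕ : STy
  κ : List STy

SCtx : Scope → Set
SCtx s = var ∈ s → STy

infixl 5 _▹_ _▹#

_▹_ : SCtx s → STy → SCtx (var ∷ s)
(Ξ ▹ ρ) (here refl) = ρ
(Ξ ▹ ρ) (there x)   = Ξ x

_▹# : SCtx s → SCtx (nm ∷ s)
(Ξ ▹#) (there x) = Ξ x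

⌊_⌋ᶜ : Ctx s → SCtx s
⌊ Γ ▸ A ⌋ᶜ = ⌊ Γ ⌋ᶜ ▹ ⌊ A ⌋
⌊ Γ # α ⌋ᶜ = ⌊ Γ ⌋ᶜ ▹#

variable
  Ξ Ξ′ Ξ″ : SCtx s

⌊⌋ᶜ-∋ : ∀ {x} → Γ ∋ x ∶ A → ⌊ Γ ⌋ᶜ x ≡ ⌊ A ⌋
⌊⌋ᶜ-∋ {Γ = Γ ▸ A} here = sym (⌊ren⌋ weaken A)
⌊⌋ᶜ-∋ (there {A = A} p) = trans (⌊⌋ᶜ-∋ p) (sym (⌊ren⌋ weaken A))
⌊⌋ᶜ-∋ (there# {A = A} p) = trans (⌊⌋ᶜ-∋ p) (sym (⌊ren⌋ weaken A))

⌊⌋ᶜ-⊆ᶜ : Γ ⊆ᶜ Δ via θ → (x : var ∈ _) → ⌊ Δ ⌋ᶜ (lookup θ x) ≡ ⌊ Γ ⌋ᶜ x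
⌊⌋ᶜ-⊆ᶜ {θ = refl ∷ θ} (keep {A = A} w) (here refl) = ⌊ren⌋ θ A
⌊⌋ᶜ-⊆ᶜ (keep w) (there x) = ⌊⌋ᶜ-⊆ᶜ w x
⌊⌋ᶜ-⊆ᶜ (keep# w) (there x) = ⌊⌋ᶜ-⊆ᶜ w x
⌊⌋ᶜ-⊆ᶜ (skip w) x = ⌊⌋ᶜ-⊆ᶜ w x
⌊⌋ᶜ-⊆ᶜ (skip# w) x = ⌊⌋ᶜ-⊆ᶜ w x

mutual
  -- A neutral object is normal only at `o`, which is what makes normal forms η-long. Only simple
  -- types are recorded, and in `lam` through an equation rather than as the index `⌊ A ⌋`, so that
  -- matching on the simple type succeeds.
  data Nf (Σ : Sig) (Ξ : SCtx s) : Obj s → STy → Set where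
    ne  : Ne Σ Ξ M o → Nf Σ Ξ M o
    lam : NfT Σ Ξ A [] → ⌊ A ⌋ ≡ ρ → Nf Σ (Ξ ▹ ρ) M ϕ → Nf Σ Ξ (ƛ A M) (ρ ⇒ ϕ)
    abs : Nf Σ (Ξ ▹#) M ρ → Nf Σ Ξ (⟨ α ⟩ M) (ν ρ)

  data Ne (Σ : Sig) (Ξ : SCtx s) : Obj s → STy → Set where
    var  : ∀ {x} → Ξ x ≡ ρ → Ne Σ Ξ (` x) ρ
    con  : obj c A ∈ Σ → ⌊ A ⌋ ≡ ρ → Ne Σ Ξ (con c) ρ
    nm   : Ne Σ Ξ (nm a) o
    app  : Ne Σ Ξ M (ρ ⇒ ϕ) → Nf Σ Ξ N ρ → Ne Σ Ξ (M · N) ϕ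
    conc : Ne Σ Ξ M (ν ρ) → Ne Σ Ξ (M ＠ a) ρ

  data NfT (Σ : Sig) (Ξ : SCtx s) : Ty s → List STy → Set where
    con  : ∀ {a} → fam a K ∈ Σ → ⌊ K ⌋ᵏ ≡ κ → NfT Σ Ξ (con a) κ
    app  : NfT Σ Ξ A (ρ ∷ κ) → Nf Σ Ξ M ρ → NfT Σ Ξ (A · M) κ
    Π    : NfT Σ Ξ A [] → NfT Σ (Ξ ▹ ⌊ A ⌋) B [] → NfT Σ Ξ (Π A B) []
    name : NfT Σ Ξ (name α) []
    New  : NfT Σ (Ξ ▹#) B [] → NfT Σ Ξ (New α B) []

mutual
  sig-Nf : ∀ {Σ Σ′} → Σ ⊑ Σ′ → Nf Σ Ξ M ρ → Nf Σ′ Ξ M ρ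
  sig-Nf i (ne n)       = ne (sig-Ne i n)
  sig-Nf i (lam A e n)  = lam (sig-NfT i A) e (sig-Nf i n)
  sig-Nf i (abs n)      = abs (sig-Nf i n)

  sig-Ne : ∀ {Σ Σ′} → Σ ⊑ Σ′ → Ne Σ Ξ M ρ → Ne Σ′ Ξ M ρ
  sig-Ne i (var e)   = var e
  sig-Ne i (con p e) = con (i p) e
  sig-Ne i nm        = nm
  sig-Ne i (app m n) = app (sig-Ne i m) (sig-Nf i n)
  sig-Ne i (conc m)  = conc (sig-Ne i m)

  sig-NfT : ∀ {Σ Σ′} → Σ ⊑ Σ′ → NfT Σ Ξ A κ → NfT Σ′ Ξ A κ
  sig-NfT i (con p e) = con (i p) e
  sig-NfT i (app A n) = app (sig-NfT i A) (sig-Nf i n)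
  sig-NfT i (Π A B)   = Π (sig-NfT i A) (sig-NfT i B)
  sig-NfT i name      = name
  sig-NfT i (New B)   = New (sig-NfT i B)

-- Substitutions that send variables to variables cannot create redexes. They include weakenings and
-- all replacements of names by names.
VarSub : SCtx s → SCtx t → Sub s t → Set
VarSub Ξ Ξ′ σ = ∀ x → ∃[ y ] σ x ≡ ` y × Ξ′ y ≡ Ξ x

VarSub-lift : {σ : Sub s t} → VarSub Ξ Ξ′ σ → VarSub (Ξ ▹ ρ) (Ξ′ ▹ ρ) (lift σ)
VarSub-lift v (here refl) = here refl , refl , refl
VarSub-lift v (there x) with y , e , f ← v x =
  there y , trans (cong (renᵒ weaken) e) (cong (λ z → ` there z) (lookup-⊆-refl y)) , f

VarSub-lift# : {σ : Sub s t} → VarSub Ξ Ξ′ σ → VarSub (Ξ ▹#) (Ξ′ ▹#) (lift σ)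
VarSub-lift# v (there x) with y , e , f ← v x =
  there y , trans (cong (renᵒ weaken) e) (cong (λ z → ` there z) (lookup-⊆-refl y)) , f

mutual
  Nf-sub : {σ : Sub s t} → VarSub Ξ Ξ′ σ → Nf Σ Ξ M ρ → Nf Σ Ξ′ (subᵒ σ M) ρ
  Nf-sub v (ne n)      = ne (Ne-sub v n)
  Nf-sub {σ = σ} v (lam {A = A} D e n) =
    lam (NfT-sub v D) (trans (⌊sub⌋ σ A) e) (Nf-sub (VarSub-lift v) n)
  Nf-sub v (abs n)     = abs (Nf-sub (VarSub-lift# v) n)

  Ne-sub : {σ : Sub s t} → VarSub Ξ Ξ′ σ → Ne Σ Ξ M ρ → Ne Σ Ξ′ (subᵒ σ M) ρ
  Ne-sub v (var {x = x} e) with y , f , g ← v x rewrite f = var (trans g e)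
  Ne-sub v (con p e) = con p e
  Ne-sub v nm        = nm
  Ne-sub v (app m n) = app (Ne-sub v m) (Nf-sub v n)
  Ne-sub v (conc m)  = conc (Ne-sub v m)

  NfT-sub : {σ : Sub s t} → VarSub Ξ Ξ′ σ → NfT Σ Ξ A κ → NfT Σ Ξ′ (subᵗ σ A) κ
  NfT-sub v (con p e) = con p e
  NfT-sub v (app A n) = app (NfT-sub v A) (Nf-sub v n)
  NfT-sub {σ = σ} v (Π {A = A} D E) =
    Π (NfT-sub v D) (subst (λ ρ → NfT _ (_ ▹ ρ) _ _) (sym (⌊sub⌋ σ A)) (NfT-sub (VarSub-lift v) E))
  NfT-sub v name      = name
  NfT-sub v (New B)   = New (NfT-sub (VarSub-lift# v) B)

VarSub-ι : (∀ x → Ξ′ (lookup θ x) ≡ Ξ x) → VarSub Ξ Ξ′ (ι θ)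
VarSub-ι e x = _ , refl , e x

Nf-ren : (∀ x → Ξ′ (lookup θ x) ≡ Ξ x) → Nf Σ Ξ M ρ → Nf Σ Ξ′ (renᵒ θ M) ρ
Nf-ren {θ = θ} e n = subst (λ M → Nf _ _ M _) (sym (renᵒ-sub θ _)) (Nf-sub (VarSub-ι {θ = θ} e) n)

Ne-ren : (∀ x → Ξ′ (lookup θ x) ≡ Ξ x) → Ne Σ Ξ M ρ → Ne Σ Ξ′ (renᵒ θ M) ρ
Ne-ren {θ = θ} e n = subst (λ M → Ne _ _ M _) (sym (renᵒ-sub θ _)) (Ne-sub (VarSub-ι {θ = θ} e) n)

NfT-ren : (∀ x → Ξ′ (lookup θ x) ≡ Ξ x) → NfT Σ Ξ A κ → NfT Σ Ξ′ (renᵗ θ A) κ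
NfT-ren {θ = θ} e n = subst (λ M → NfT _ _ M _) (sym (renᵗ-sub θ _)) (NfT-sub (VarSub-ι {θ = θ} e) n)

mutual
  -- A concretion is normal over `Γ` while its head is typed over a restriction of `Γ`; reflecting
  -- normality along the embedding, as in `Ne-unren`, lets inductions on typing reach the head.
  Nf-unsub : {σ : Sub s t} → VarSub Ξ Ξ′ σ → Nf Σ Ξ′ (subᵒ σ M) ρ → Nf Σ Ξ M ρ
  Nf-unsub {M = ƛ A M} {σ = σ} v (lam D e n) =
    lam (NfT-unsub v D) (trans (sym (⌊sub⌋ σ A)) e) (Nf-unsub (VarSub-lift v) n)
  Nf-unsub {M = ⟨ α ⟩ M} v (abs n) = abs (Nf-unsub (VarSub-lift# v) n)
  Nf-unsub {M = ` x} {σ = σ} v n with σ x | v x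
  Nf-unsub {M = ` x} v (ne (var e)) | _ | _ , refl , f = ne (var (trans (sym f) e))
  Nf-unsub {M = con c} {σ = σ} v (ne n) = ne (Ne-unsub {M = con c} {σ = σ} v n)
  Nf-unsub {M = _ · _} v (ne n) = ne (Ne-unsub v n)
  Nf-unsub {M = nm a} {σ = σ} v (ne n)  = ne (Ne-unsub {M = nm a} {σ = σ} v n)
  Nf-unsub {M = _ ＠ _} v (ne n) = ne (Ne-unsub v n)

  Ne-unsub : {σ : Sub s t} → VarSub Ξ Ξ′ σ → Ne Σ Ξ′ (subᵒ σ M) ρ → Ne Σ Ξ M ρ
  Ne-unsub {M = ` x} {σ = σ} v n with σ x | v x
  Ne-unsub {M = ` x} v (var e) | _ | _ , refl , f = var (trans (sym f) e)
  Ne-unsub {M = con _} v (con p e) = con p e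
  Ne-unsub {M = _ · _} v (app m n) = app (Ne-unsub v m) (Nf-unsub v n)
  Ne-unsub {M = nm _} v nm         = nm
  Ne-unsub {M = _ ＠ _} v (conc m) = conc (Ne-unsub v m)

  NfT-unsub : {σ : Sub s t} → VarSub Ξ Ξ′ σ → NfT Σ Ξ′ (subᵗ σ A) κ → NfT Σ Ξ A κ
  NfT-unsub {A = con _} v (con p e)   = con p e
  NfT-unsub {A = _ · _} v (app A n)   = app (NfT-unsub v A) (Nf-unsub v n)
  NfT-unsub {A = Π A _} {σ = σ} v (Π D E) =
    Π (NfT-unsub v D) (NfT-unsub (VarSub-lift v) (subst (λ ρ → NfT _ (_ ▹ ρ) _ _) (⌊sub⌋ σ A) E))
  NfT-unsub {A = name _} v name       = name
  NfT-unsub {A = New _ _} v (New B)   = New (NfT-unsub (VarSub-lift# v) B)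

Ne-unren : Γ ⊢ a ∶ α ╲ Γ′ via θ → Ne Σ ⌊ Γ ⌋ᶜ (renᵒ θ M) ρ → Ne Σ ⌊ Γ′ ⌋ᶜ M ρ
Ne-unren {θ = θ} r n = Ne-unsub (VarSub-ι {θ = θ} (⌊⌋ᶜ-⊆ᶜ (restriction-⊆ᶜ r))) (subst (λ M → Ne _ _ M _) (renᵒ-sub θ _) n)

size : STy → ℕ
size o       = 0
size (ρ ⇒ ϕ) = suc (size ρ ℕ.+ size ϕ)
size (ν ρ)   = suc (size ρ)

-- The bound n on the simple types of the normal objects substituted for variables is what
-- decreases when hereditary substitution contracts a redex it has created.
Bounded : ℕ → Sig → (Ξ : SCtx s) → Obj s → STy → Set
Bounded n Σ Ξ M ρ = Ne Σ Ξ M ρ ⊎ (Nf Σ Ξ M ρ × size ρ ≤ n)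

HTyped : ℕ → Sig → Ctx t → Obj t → Obj t → Ty t → Set
HTyped n Σ Γ M N A = (Σ ⨾ Γ ⊢ᵒ M ∶ A) × Bounded n Σ ⌊ Γ ⌋ᶜ M ⌊ A ⌋

Bounded-ren : ∀ {n} → (∀ x → Ξ′ (lookup θ x) ≡ Ξ x) → Bounded n Σ Ξ M ρ → Bounded n Σ Ξ′ (renᵒ θ M) ρ
Bounded-ren {θ = θ} e (inj₁ m) = inj₁ (Ne-ren {θ = θ} e m)
Bounded-ren {θ = θ} e (inj₂ (m , le)) = inj₂ (Nf-ren {θ = θ} e m , le)

stable-HTyped : ∀ {n} → Stable (HTyped n Σ)
stable-HTyped {Σ} {n} = record
  { weakens = λ { {θ = θ} {A = A} w (D , b) →
      wkᵒ w D , subst (Bounded n Σ _ _) (sym (⌊ren⌋ θ A)) (Bounded-ren {θ = θ} (⌊⌋ᶜ-⊆ᶜ w) b) }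
  ; vars = λ p → var p , inj₁ (var (⌊⌋ᶜ-∋ p)) }

HSub : ℕ → Sig → Ctx t → Ctx s → Sub s t → Set
HSub n Σ Δ Γ σ = SubRel (HTyped n Σ) Δ Γ σ σ

VarSub-single# : ∀ {u} {Ξ : SCtx s} {Ξ′ : SCtx u} {b : nm ∈ u} {θ : s ⊆ u} → (∀ x → Ξ′ (lookup θ x) ≡ Ξ x) →
  VarSub (Ξ ▹#) Ξ′ (single b ⊙ ι (refl ∷ θ))
VarSub-single# e (there x) = _ , refl , e x

Nf-inst# : ∀ {u} {Ξ : SCtx s} {Ξ′ : SCtx u} {b : nm ∈ u} {θ : s ⊆ u} → (∀ x → Ξ′ (lookup θ x) ≡ Ξ x) →
  Nf Σ (Ξ ▹#) M ρ → Nf Σ Ξ′ (renᵒ (refl ∷ θ) M [# b ]ᵒ) ρ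
Nf-inst# {M = M} {b = b} {θ} e n =
  subst (λ M → Nf _ _ M _) (sym (sub-ren ob (single {nm} b) (refl ∷ θ) M)) (Nf-sub (VarSub-single# {b = b} {θ} e) n)

module Hereditary {Σ : Sig} (S : ⊢ Σ sig) where
  open Inversion S
  module H {n} = SubRelProperties (stable-HTyped {Σ} {n})

  HSub-typed : ∀ {n} → HSub n Σ Δ Γ σ → TSub Σ Δ Γ σ
  HSub-typed {n = n} = SubRel-left {P = HTyped n Σ} {Q = Typed Σ} proj₁

  -- Contracting a concretion redex only replaces a name by a name, so the contractum is normal as
  -- it stands: no hereditary step and no decreasing measure are involved.
  concrete : Σ ⊢ Γ ctx → Γ ⊢ a ∶ α ╲ Γ′ via θ → Σ ⨾ Γ′ ⊢ᵒ M ≈ N ∶ New α B → Nf Σ ⌊ Γ′ ⌋ᶜ N (ν ρ) →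
    ∃[ P ] (Σ ⨾ Γ ⊢ᵒ renᵒ θ M ＠ a ≈ P ∶ renᵗ (refl ∷ θ) B [# a ]ᵗ) × Nf Σ ⌊ Γ ⌋ᶜ P ρ
  concrete {θ = θ} G r e (abs m)
    with _ , D , _ ← regularᵒ (ctx-restrict G r) e
    with _ , p , F , f ← invert-⟨⟩ (ctx-restrict G r) D with refl , g ← New-injective f =
    _ , ≈-trans (conc r e) (β# r (reflᵒ (conv F g))) ,
    Nf-inst# {θ = θ} (⌊⌋ᶜ-⊆ᶜ (restriction-⊆ᶜ r)) m

  mutual
    -- The recursion is lexicographic in the bound and the typing derivation. A contraction
    -- substitutes an argument whose simple type is strictly smaller than that of the function, so
    -- the bound drops; the traversals keep the bound and descend in the derivation.
    apply : ∀ n → size (ρ ⇒ ϕ) ≤ n → Σ ⊢ Γ ctx → Σ ⨾ Γ ⊢ᵒ M ≈ M′ ∶ Π A B → Nf Σ ⌊ Γ ⌋ᶜ M′ (ρ ⇒ ϕ) →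
      Σ ⨾ Γ ⊢ᵒ N ≈ N′ ∶ A → Nf Σ ⌊ Γ ⌋ᶜ N′ ρ →
      ∃[ P ] (Σ ⨾ Γ ⊢ᵒ M · N ≈ P ∶ B [ N ]ᵗ) × Nf Σ ⌊ Γ ⌋ᶜ P ϕ
    apply {ρ = ρ} {ϕ} {Γ = Γ} {N′ = N′} (suc n) (s≤s le) G e (lam {A = C} _ eq m) f k
      with _ , D , P ← regularᵒ G e | N , N″ , _ ← regularᵒ G f
      with _ , C , Q , g ← invert-ƛ G D with g₁ , g₂ ← Π-injective g
      with refl ← eq
      with T , h , n′ ← hereditaryᵒ n G
             (H.SubRel-single {N = N′} (N″ , inj₂ (subst (Nf Σ ⌊ Γ ⌋ᶜ N′) (⌊⌋-≈ g₁) k ,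
               subst (λ ρ → size ρ ≤ n) (⌊⌋-≈ g₁) (ℕ.m+n≤o⇒m≤o (size ρ) le))))
             (convertᵒ g₁ (conv Q g₂)) (subst (λ ρ → Nf Σ (⌊ Γ ⌋ᶜ ▹ ρ) _ ϕ) (⌊⌋-≈ g₁) m) =
      T , ≈-trans (app e f) (conv (≈-trans (β C (reflᵒ (conv Q g₂)) (reflᵒ (conv N″ (≈-sym g₁)))) h)
            (≈-sym (inst≈ᵗ (proj₂ (Π-formation P)) N f))) , n′

    hereditaryᵒ : ∀ n → Σ ⊢ Δ ctx → HSub n Σ Δ Γ σ → Σ ⨾ Γ ⊢ᵒ M ∶ A → Nf Σ ⌊ Γ ⌋ᶜ M ρ →
      ∃[ N ] (Σ ⨾ Δ ⊢ᵒ subᵒ σ M ≈ N ∶ subᵗ σ A) × Nf Σ ⌊ Δ ⌋ᶜ N ρ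
    hereditaryᵒ n G m D (ne k) with hereditary-ne n G m D k
    ... | N , e , inj₁ k′ = N , e , ne k′
    ... | N , e , inj₂ (k′ , _) = N , e , k′
    hereditaryᵒ {Δ = Δ} {σ = σ} n G m (lam {A = A} D E) (lam {ϕ = ϕ} K refl k)
      with A′ , e , K′ ← hereditaryᵗ n G m D K
      with N , f , k′ ← hereditaryᵒ n (G ▸ tsubᵗ (HSub-typed m) D) (H.SubRel-lift m) E k =
      _ , lam (tsubᵗ (HSub-typed m) D) (reflᵗ (tsubᵗ (HSub-typed m) D)) (≈-sym e) f ,
      lam K′ (trans (sym (⌊⌋-≈ e)) (⌊sub⌋ σ A)) (subst (λ ρ → Nf Σ (⌊ Δ ⌋ᶜ ▹ ρ) N ϕ) (⌊sub⌋ σ A) k′)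
    hereditaryᵒ n G m (abs p D) (abs k) with N , e , k′ ← hereditaryᵒ n (G # p) (H.SubRel-lift# m) D k =
      _ , abs p e , abs k′
    hereditaryᵒ n G m (conv D e) k with N , f , k′ ← hereditaryᵒ n G m D k =
      N , conv f (tsub≈ᵗ (HSub-typed m) e) , k′

    -- The result is neutral unless the head variable was replaced by a normal form. In that case
    -- eliminations only shrink the simple type of the head, so the bound on the replacement bounds
    -- every intermediate result, and this is the hypothesis that `apply` needs.
    hereditary-ne : ∀ n → Σ ⊢ Δ ctx → HSub n Σ Δ Γ σ → Σ ⨾ Γ ⊢ᵒ M ∶ A → Ne Σ ⌊ Γ ⌋ᶜ M ρ →
      ∃[ N ] (Σ ⨾ Δ ⊢ᵒ subᵒ σ M ≈ N ∶ subᵗ σ A) × Bounded n Σ ⌊ Δ ⌋ᶜ N ρ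
    hereditary-ne {σ = σ} n G m (con {A = A} p) (con q e) =
      _ , cast≈ᵒ refl refl (sym (sub-minimum ty σ A)) (con p) , inj₁ (con q e)
    hereditary-ne {Δ = Δ} {σ = σ} n G m (var {x = x} {A = A} p) (var e) with D , b ← H.SubRel-var m p =
      σ x , reflᵒ D , subst (Bounded n Σ ⌊ Δ ⌋ᶜ (σ x)) (trans (⌊sub⌋ σ A) (trans (sym (⌊⌋ᶜ-∋ p)) e)) b
    hereditary-ne n G m (nm p) nm = _ , nm (H.SubRel-name m p) , inj₁ nm
    hereditary-ne {σ = σ} n G m (app {B = B} {N = N} D E) (app {ρ = ρ} j k)
      with hereditary-ne n G m D j | hereditaryᵒ n G m E k
    ... | P , e , inj₁ b | Q , f , k′ =
      P · Q , cast≈ᵒ refl refl (sym (sub-single ty σ N B)) (app e f) , inj₁ (app b k′)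
    ... | P , e , inj₂ (b , le) | Q , f , k′ with T , g , b′ ← apply n le G e b f k′ =
      T , cast≈ᵒ refl refl (sym (sub-single ty σ N B)) g , inj₂ (b′ , ℕ.m+n≤o⇒n≤o (suc (size ρ)) le)
    hereditary-ne {σ = σ} n G m (conc {θ = θ} {a = a} {B = B} {M = M} r D) (conc j)
      with restricted {emb = θ′} r′ m′ e _ ← sub-restriction m r
      with hereditary-ne n (ctx-restrict G r′) (SubRel-left {P = HTyped n Σ} {Q = HTyped n Σ} (λ p → p) m′) D (Ne-unren r j)
    ... | P , f , inj₁ b =
      renᵒ θ′ P ＠ σ a ,
      cast≈ᵒ (cong (_＠ _) (sym (sub-ren-comm ob {θ = θ′} e M))) refl
        (sym (sub-ren-single ty {θ = θ′} e a B)) (conc r′ f) ,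
      inj₁ (conc (Ne-ren {θ = θ′} (⌊⌋ᶜ-⊆ᶜ (restriction-⊆ᶜ r′)) b))
    ... | P , f , inj₂ (b , le) with T , g , b′ ← concrete G r′ f b =
      T , cast≈ᵒ (cong (_＠ _) (sym (sub-ren-comm ob {θ = θ′} e M))) refl
        (sym (sub-ren-single ty {θ = θ′} e a B)) g , inj₂ (b′ , ℕ.≤-trans (ℕ.n≤1+n _) le)
    hereditary-ne n G m (conv D e) k with N , f , k′ ← hereditary-ne n G m D k =
      N , conv f (tsub≈ᵗ (HSub-typed m) e) , k′

    hereditaryᵗ : ∀ n → Σ ⊢ Δ ctx → HSub n Σ Δ Γ σ → Σ ⨾ Γ ⊢ᵗ A ∶ K → NfT Σ ⌊ Γ ⌋ᶜ A κ →
      ∃[ B ] (Σ ⨾ Δ ⊢ᵗ subᵗ σ A ≈ B ∶ subᵏ σ K) × NfT Σ ⌊ Δ ⌋ᶜ B κ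
    hereditaryᵗ {σ = σ} n G m (con {K = K} p) (con q e) =
      _ , cast≈ᵗ refl refl (sym (sub-minimum ki σ K)) (con p) , con q e
    hereditaryᵗ {σ = σ} n G m (app {K = K} {M = M} D E) (app j k)
      with _ , e , j′ ← hereditaryᵗ n G m D j
      with _ , f , k′ ← hereditaryᵒ n G m E k =
      _ , cast≈ᵗ refl refl (sym (sub-single ki σ M K)) (app e f) , app j′ k′
    hereditaryᵗ {Δ = Δ} {σ = σ} n G m (Π {A = A} D E) (Π K k)
      with A′ , e , K′ ← hereditaryᵗ n G m D K
      with N , f , k′ ← hereditaryᵗ n (G ▸ tsubᵗ (HSub-typed m) D) (H.SubRel-lift m) E k =
      _ , Π (tsubᵗ (HSub-typed m) D) e f , Π K′ (subst (λ ρ → NfT Σ (⌊ Δ ⌋ᶜ ▹ ρ) N []) (⌊⌋-≈ e) k′)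
    hereditaryᵗ n G m (name p) name = _ , name p , name
    hereditaryᵗ n G m (New p D) (New k) with N , e , k′ ← hereditaryᵗ n (G # p) (H.SubRel-lift# m) D k =
      _ , New p e , New k′
    hereditaryᵗ n G m (conv D e) k with N , f , k′ ← hereditaryᵗ n G m D k =
      N , conv f (≈-sym (tsub≈ᵏ (HSub-typed m) e)) , k′

-- Existence of normal forms

-- Π-types and `New`-types have kind `type`, so a normal family that still expects an argument is a
-- constant applied to objects. Types of arrow or ν erasure are therefore literally Π or `New`.
NfT-family : NfT Σ Ξ A (ρ ∷ κ) → ⌊ A ⌋ ≡ o
NfT-family (con _ _) = refl
NfT-family (app A _) = NfT-family A

⇒-inj : ∀ {ρ ρ′ ϕ ϕ′} → ρ ⇒ ϕ ≡ ρ′ ⇒ ϕ′ → ρ ≡ ρ′ × ϕ ≡ ϕ′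
⇒-inj refl = refl , refl

ν-inj : ∀ {ρ ρ′} → ν ρ ≡ ν ρ′ → ρ ≡ ρ′
ν-inj refl = refl

infixl 5 _▸_

-- η-expanding a variable writes the domains found in its type into annotations, so each variable
-- must come with a normal form of its type.
data NormalCtx (Σ : Sig) : Ctx s → Set where
  ∙   : NormalCtx Σ ∙
  _▸_ : NormalCtx Σ Γ → (∃[ B ] (Σ ⨾ Γ ⊢ᵗ A ≈ B ∶ type) × NfT Σ ⌊ Γ ⌋ᶜ B []) → NormalCtx Σ (Γ ▸ A)
  _#  : NormalCtx Σ Γ → NormalCtx Σ (Γ # α)

NormalSig : Sig → Set
NormalSig Σ = ∀ {c A} → obj c A ∈ Σ → ∃[ B ] (Σ ⨾ ∙ ⊢ᵗ A ≈ B ∶ type) × NfT Σ ⌊ ∙ ⌋ᶜ B []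

NormalCtx-restrict : NormalCtx Σ Γ → Γ ⊢ a ∶ α ╲ Γ′ via θ → NormalCtx Σ Γ′
NormalCtx-restrict (N #) here       = N
NormalCtx-restrict (N #) (there# r) = NormalCtx-restrict N r #
NormalCtx-restrict (N ▸ _) (there r) = NormalCtx-restrict N r

NormalType : (Σ : Sig) (Γ : Ctx s) → Ty s → Set
NormalType Σ Γ A = ∃[ B ] (Σ ⨾ Γ ⊢ᵗ A ≈ B ∶ type) × NfT Σ ⌊ Γ ⌋ᶜ B []

NormalType-wk : Γ ⊆ᶜ Δ via θ → NormalType Σ Γ A → NormalType Σ Δ (renᵗ θ A)
NormalType-wk {θ = θ} w (B , e , n) = renᵗ θ B , wk≈ᵗ w e , NfT-ren {θ = θ} (⌊⌋ᶜ-⊆ᶜ w) n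

NormalCtx-var : ∀ {x} → NormalCtx Σ Γ → Γ ∋ x ∶ A → NormalType Σ Γ A
NormalCtx-var (N ▸ n) here       = NormalType-wk ⊆ᶜ-weaken n
NormalCtx-var (N ▸ _) (there p)  = NormalType-wk ⊆ᶜ-weaken (NormalCtx-var N p)
NormalCtx-var (N #)   (there# p) = NormalType-wk (skip# (⊆ᶜ-refl _)) (NormalCtx-var N p)

module Normalisation {Σ : Sig} (S : ⊢ Σ sig) where
  open Inversion S
  open Hereditary S

  -- Recursion is on the simple type and not on the normal type: in the arrow case the bound
  -- variable is expanded at the weakened domain, which is no subterm of the type.
  η-expand : ∀ ρ → Σ ⊢ Γ ctx → Σ ⨾ Γ ⊢ᵗ A ∶ type → NfT Σ ⌊ Γ ⌋ᶜ A [] → ⌊ A ⌋ ≡ ρ →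
    Σ ⨾ Γ ⊢ᵒ M ∶ A → Ne Σ ⌊ Γ ⌋ᶜ M ρ → ∃[ N ] (Σ ⨾ Γ ⊢ᵒ M ≈ N ∶ A) × Nf Σ ⌊ Γ ⌋ᶜ N ρ
  η-expand o G K k e D j = _ , reflᵒ D , ne j
  η-expand {Γ = Γ} {M = M} (ρ ⇒ ϕ) G K (Π {A = A} {B = B} k k′) eq D j
    with eq₁ , eq₂ ← ⇒-inj eq
    with A′ , B′ ← Π-formation K
    with X , e , n ← η-expand ρ (G ▸ A′) (wkᵗ ⊆ᶜ-weaken A′)
         (NfT-ren {θ = weaken} (⌊⌋ᶜ-⊆ᶜ (⊆ᶜ-weaken {Γ = Γ} {A = A})) k) (trans (⌊ren⌋ weaken A) eq₁) (var here) (var eq₁)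
    with f ← cast≈ᵒ refl refl (ren-single-here ty B) (app (reflᵒ (wkᵒ ⊆ᶜ-weaken D)) e)
    with Y , g , n′ ← η-expand ϕ (G ▸ A′) B′ k′ eq₂ (proj₁ (proj₂ (regularᵒ (G ▸ A′) f)))
         (app (Ne-ren {θ = weaken} (⌊⌋ᶜ-⊆ᶜ (⊆ᶜ-weaken {Γ = Γ} {A = A})) j) n)
    with _ , Y′ , _ ← regularᵒ (G ▸ A′) g =
    ƛ A Y ,
    -- After application to the bound variable the left side is `M` at that variable, already
    -- expanded to `Y`, and the right side contracts to `Y`.
    ext A′ D (lam A′ Y′) (≈-trans f (≈-trans g (≈-sym
      (cast≈ᵒ refl (ren-single-here ob Y) (ren-single-here ty B)
        (β (wkᵗ ⊆ᶜ-weaken A′) (reflᵒ (wkᵒ (keep ⊆ᶜ-weaken) Y′)) (var here)))))) ,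
    lam k eq₁ (subst (λ ρ → Nf Σ (⌊ Γ ⌋ᶜ ▹ ρ) Y ϕ) eq₁ n′)
  η-expand {Γ = Γ} {M = M} (ν ρ) G K (New {B = B} {α = α} k) eq D j
    with p , B′ ← New-formation K
    with f ← castᵒ refl (ren-single-here ty B) (conc here D)
    with Y , g , n′ ← η-expand ρ (G # p) B′ k (ν-inj eq) f
         (conc (Ne-ren {θ = weaken} (⌊⌋ᶜ-⊆ᶜ (skip# {α = α} (⊆ᶜ-refl Γ))) j))
    with _ , Y′ , _ ← regularᵒ (G # p) g =
    ⟨ α ⟩ Y ,
    ext# p (≈-trans g (≈-sym
      (cast≈ᵒ refl (ren-single-here ob Y) (ren-single-here ty B) (β# here (reflᵒ Y′))))) ,
    abs n′
  η-expand (ρ ⇒ ϕ) G K (app k _) e D j with () ← trans (sym (NfT-family k)) e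
  η-expand (ν ρ) G K (app k _) e D j with () ← trans (sym (NfT-family k)) e

  η-expand-normal : Σ ⊢ Γ ctx → Σ ⨾ Γ ⊢ᵒ M ∶ A → Ne Σ ⌊ Γ ⌋ᶜ M ⌊ A ⌋ → NormalType Σ Γ A →
    ∃[ N ] (Σ ⨾ Γ ⊢ᵒ M ≈ N ∶ A) × Nf Σ ⌊ Γ ⌋ᶜ N ⌊ A ⌋
  η-expand-normal G D j (B , f , k) with _ , F , _ ← regularᵗ G f
    with P , g , n ← η-expand _ G F k (sym (⌊⌋-≈ f)) (conv D f) j = P , conv g (≈-sym f) , n

  module _ (NS : NormalSig Σ) where
    mutual
      normalᵒ : Σ ⊢ Γ ctx → NormalCtx Σ Γ → Σ ⨾ Γ ⊢ᵒ M ∶ A → ∃[ N ] (Σ ⨾ Γ ⊢ᵒ M ≈ N ∶ A) × Nf Σ ⌊ Γ ⌋ᶜ N ⌊ A ⌋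
      normalᵒ {Γ = Γ} G N (con {A = A} p) with B , e , k ← NS p =
        η-expand-normal G (con p) (con p (sym (⌊ren⌋ (minimum _) A)))
          (renᵗ (minimum _) B , wk≈ᵗ (⊆ᶜ-minimum Γ) e , NfT-ren {θ = minimum _} (λ ()) k)
      normalᵒ G N (var p) = η-expand-normal G (var p) (var (⌊⌋ᶜ-∋ p)) (NormalCtx-var N p)
      normalᵒ G N (nm p) = _ , nm p , ne nm
      normalᵒ G N (lam D E) with A′ , e , k ← normalᵗ G N D
        with M′ , f , n ← normalᵒ (G ▸ D) (N ▸ (A′ , e , k)) E =
        ƛ A′ M′ , lam D (reflᵗ D) (≈-sym e) f , lam k (sym (⌊⌋-≈ e)) n
      normalᵒ {Γ = Γ} G N (app {B = B} {N = P} D E) with M′ , e , m ← normalᵒ G N D | N′ , f , n ← normalᵒ G N E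
        -- The bound is the size of the simple type of the function itself, the least one that
        -- `apply` accepts.
        with T , g , k ← apply _ ℕ.≤-refl G e m f n = T , g , subst (Nf Σ ⌊ Γ ⌋ᶜ T) (sym (⌊sub⌋ (single P) B)) k
      normalᵒ G N (abs p D) with M′ , e , n ← normalᵒ (G # p) (N #) D = _ , abs p e , abs n
      normalᵒ {Γ = Γ} G N (conc {θ = θ} {a = a} {B = B} r D)
        with M′ , e , m ← normalᵒ (ctx-restrict G r) (NormalCtx-restrict N r) D
        with T , g , k ← concrete G r e m =
        T , g , subst (Nf Σ ⌊ Γ ⌋ᶜ T) (sym (trans (⌊sub⌋ (single a) (renᵗ (refl ∷ θ) B)) (⌊ren⌋ (refl ∷ θ) B))) k
      normalᵒ G N (conv D e) with M′ , f , n ← normalᵒ G N D = M′ , conv f e , subst (Nf _ _ _) (⌊⌋-≈ e) n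

      normalᵗ : Σ ⊢ Γ ctx → NormalCtx Σ Γ → Σ ⨾ Γ ⊢ᵗ A ∶ K → ∃[ B ] (Σ ⨾ Γ ⊢ᵗ A ≈ B ∶ K) × NfT Σ ⌊ Γ ⌋ᶜ B ⌊ K ⌋ᵏ
      normalᵗ G N (con {K = K} p) = _ , con p , con p (sym (⌊ren⌋ᵏ (minimum _) K))
      normalᵗ {Γ = Γ} G N (app {K = K} {M = P} D E) with A′ , e , m ← normalᵗ G N D | N′ , f , n ← normalᵒ G N E =
        A′ · N′ , app e f , subst (NfT Σ ⌊ Γ ⌋ᶜ (A′ · N′)) (sym (⌊sub⌋ᵏ (single P) K)) (app m n)
      normalᵗ {Γ = Γ} G N (Π D E) with A′ , e , k ← normalᵗ G N D
        with B′ , f , n ← normalᵗ (G ▸ D) (N ▸ (A′ , e , k)) E =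
        Π A′ B′ , Π D e f , Π k (subst (λ ρ → NfT Σ (⌊ Γ ⌋ᶜ ▹ ρ) B′ []) (⌊⌋-≈ e) n)
      normalᵗ G N (name p) = _ , name p , name
      normalᵗ G N (New p D) with M′ , e , n ← normalᵗ (G # p) (N #) D = _ , New p e , New n
      normalᵗ G N (conv D e) with M′ , f , n ← normalᵗ G N D =
        M′ , conv f (≈-sym e) , subst (NfT _ _ _) (sym (⌊⌋ᵏ-≈ e)) n

    normalCtx : Σ ⊢ Γ ctx → NormalCtx Σ Γ
    normalCtx ∙       = ∙
    normalCtx (G ▸ D) = normalCtx G ▸ normalᵗ G (normalCtx G) D
    normalCtx (G # p) = normalCtx G #

normalSig : ⊢ Σ sig → NormalSig Σ
normalSig (fam S _ _) (there p) with A , e , n ← normalSig S p = A , sig-wk≈ᵗ there e , sig-NfT there n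
-- The type of a constant is well formed over the earlier declarations alone, so it is normalised
-- there and carried to the larger signature.
normalSig (obj S _ D) (here refl) with A , e , n ← Normalisation.normalᵗ S (normalSig S) ∙ ∙ D =
  A , sig-wk≈ᵗ there e , sig-NfT there n
normalSig (obj S _ _) (there p) with A , e , n ← normalSig S p = A , sig-wk≈ᵗ there e , sig-NfT there n
normalSig (name S _) (there p) with A , e , n ← normalSig S p = A , sig-wk≈ᵗ there e , sig-NfT there n

module Existence {Σ : Sig} (S : ⊢ Σ sig) where
  open Normalisation S

  exists-normalᵒ : Σ ⊢ Γ ctx → Σ ⨾ Γ ⊢ᵒ M ∶ A → ∃[ N ] (Σ ⨾ Γ ⊢ᵒ M ≈ N ∶ A) × Nf Σ ⌊ Γ ⌋ᶜ N ⌊ A ⌋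
  exists-normalᵒ G = normalᵒ (normalSig S) G (normalCtx (normalSig S) G)

  exists-normalᵗ : Σ ⊢ Γ ctx → Σ ⨾ Γ ⊢ᵗ A ∶ K → ∃[ B ] (Σ ⨾ Γ ⊢ᵗ A ≈ B ∶ K) × NfT Σ ⌊ Γ ⌋ᶜ B ⌊ K ⌋ᵏ
  exists-normalᵗ G = normalᵗ (normalSig S) G (normalCtx (normalSig S) G)

-- A logical relation for equality

ren-single : ∀ c (θ : s ⊆ t) (i : Image k s) (X : Exp c (k ∷ s)) →
  ren c θ (sub c (single {k} i) X) ≡ sub c (single {k} (renⁱ {k} θ i)) (ren c (refl ∷ θ) X)
ren-single {k = k} c θ i X = trans (ren≡sub c θ _) (trans (sub-single {k = k} c (ι θ) i X)
  (trans (cong (λ j → sub c (single {k} j) _) (sym (renⁱ-sub {k = k} θ i)))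
    (cong (sub c (single {k} (renⁱ {k} θ i))) (trans (sub-cong c (lift-ι θ) X) (sym (ren≡sub c (refl ∷ θ) X))))))

single-lift : (σ : Sub s t) (i : Image k t) → single {k} i ⊙ lift σ ≗ cons {k = k} i σ
single-lift σ i {var} (here refl) = refl
single-lift σ i {nm} (here refl) = refl
single-lift {k = k} σ i {l} (there j) = renⁱ-single {k = k} {l = l} i (σ j)

sub-lift-single : ∀ c (σ : Sub s t) (i : Image k t) (X : Exp c (k ∷ s)) →
  sub c (single {k} i) (sub c (lift σ) X) ≡ sub c (cons {k = k} i σ) X
sub-lift-single {k = k} c σ i X = trans (sub-sub c (single {k} i) (lift σ) X) (sub-cong c (single-lift {k = k} σ i) X)

ren-lift : ∀ c (θ : t ⊆ u) (σ : Sub s t) (X : Exp c (k ∷ s)) →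
  ren c (refl ∷ θ) (sub c (lift σ) X) ≡ sub c (lift (ι θ ⊙ σ)) X
ren-lift c θ σ X = trans (ren-sub c (refl ∷ θ) (lift σ) X) (sub-cong c (lift-ι⊙ θ σ) X)

sub-cons-single : ∀ c (σ : Sub s t) (i : Image k s) (X : Exp c (k ∷ s)) →
  sub c σ (sub c (single {k} i) X) ≡ sub c (cons {k = k} (subⁱ {k = k} σ i) σ) X
sub-cons-single {k = k} c σ i X = trans (sub-single {k = k} c σ i X) (sub-lift-single {k = k} c σ (subⁱ {k = k} σ i) X)

cons-weaken : (σ : Sub s t) (i : Image k t) → cons {k = k} i σ ⊙ ι weaken ≗ σ
cons-weaken {k = k} σ i {var} j = cong σ (lookup-⊆-refl j)
cons-weaken {k = k} σ i {nm} j = cong σ (lookup-⊆-refl j)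

sub-cons-weaken : ∀ c (σ : Sub s t) (i : Image k t) (X : Exp c s) →
  sub c (cons {k = k} i σ) (ren c weaken X) ≡ sub c σ X
sub-cons-weaken {k = k} c σ i X = trans (sub-ren c (cons {k = k} i σ) weaken X) (sub-cong c (cons-weaken {k = k} σ i) X)

cons-ren : (σ : Sub t u) (θ : s ⊆ t) (i : Image k u) → cons {k = k} i σ ⊙ ι (refl ∷ θ) ≗ cons {k = k} i (σ ⊙ ι θ)
cons-ren σ θ i {var} (here refl) = refl
cons-ren σ θ i {nm} (here refl) = refl
cons-ren σ θ i {var} (there j) = refl
cons-ren σ θ i {nm} (there j) = refl

sub-cons-ren : ∀ c (σ : Sub t u) (θ : s ⊆ t) (i : Image k u) (X : Exp c (k ∷ s)) →
  sub c (cons {k = k} i σ) (ren c (refl ∷ θ) X) ≡ sub c (cons {k = k} i (σ ⊙ ι θ)) X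
sub-cons-ren {k = k} c σ θ i X =
  trans (sub-ren c (cons {k = k} i σ) (refl ∷ θ) X) (sub-cong c (cons-ren {k = k} σ θ i) X)

infix 3 _⟶_

data _⟶_ {s} : Obj s → Obj s → Set where
  β    : ƛ A M · N ⟶ M [ N ]ᵒ
  β#   : (⟨ α ⟩ M) ＠ a ⟶ M [# a ]ᵒ
  app  : M ⟶ M′ → M · N ⟶ M′ · N
  conc : M ⟶ M′ → M ＠ a ⟶ M′ ＠ a

β-to : M [ N ]ᵒ ≡ P → ƛ A M · N ⟶ P
β-to refl = β

β#-to : M [# a ]ᵒ ≡ P → (⟨ α ⟩ M) ＠ a ⟶ P
β#-to refl = β#

⟶-deterministic : M ⟶ N → M ⟶ P → N ≡ P
⟶-deterministic β β = refl
⟶-deterministic β# β# = refl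
⟶-deterministic (app r) (app q) = cong (_· _) (⟶-deterministic r q)
⟶-deterministic (conc r) (conc q) = cong (_＠ _) (⟶-deterministic r q)

⟶-ren : (θ : s ⊆ t) → M ⟶ N → renᵒ θ M ⟶ renᵒ θ N
⟶-ren θ (β {M = M} {N = N}) = β-to (sym (ren-single ob θ N M))
⟶-ren θ (β# {M = M} {a = a}) = β#-to (sym (ren-single {k = nm} ob θ a M))
⟶-ren θ (app r)  = app (⟶-ren θ r)
⟶-ren θ (conc r) = conc (⟶-ren θ r)

-- Annotations of normal forms are replaced by dummies.
mutual
  stripᵒ : Obj s → Obj s
  stripᵒ (con c)   = con c
  stripᵒ (` x)     = ` x
  stripᵒ (ƛ A M)   = ƛ (con 0) (stripᵒ M)
  stripᵒ (M · N)   = stripᵒ M · stripᵒ N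
  stripᵒ (nm a)    = nm a
  stripᵒ (⟨ α ⟩ M) = ⟨ 0 ⟩ stripᵒ M
  stripᵒ (M ＠ a)  = stripᵒ M ＠ a

  stripᵗ : Ty s → Ty s
  stripᵗ (con a)   = con a
  stripᵗ (A · M)   = stripᵗ A · stripᵒ M
  stripᵗ (Π A B)   = Π (stripᵗ A) (stripᵗ B)
  stripᵗ (name α)  = name α
  stripᵗ (New α B) = New α (stripᵗ B)

stripᵒ-ren : (θ : s ⊆ t) (M : Obj s) → stripᵒ (renᵒ θ M) ≡ renᵒ θ (stripᵒ M)
stripᵒ-ren θ (con c)   = refl
stripᵒ-ren θ (` x)     = refl
stripᵒ-ren θ (ƛ A M)   = cong (ƛ (con 0)) (stripᵒ-ren (refl ∷ θ) M)
stripᵒ-ren θ (M · N)   = cong₂ _·_ (stripᵒ-ren θ M) (stripᵒ-ren θ N)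
stripᵒ-ren θ (nm a)    = refl
stripᵒ-ren θ (⟨ α ⟩ M) = cong (⟨ 0 ⟩_) (stripᵒ-ren (refl ∷ θ) M)
stripᵒ-ren θ (M ＠ a)  = cong (_＠ _) (stripᵒ-ren θ M)

infix 3 _⨾_⊢_⇓_∶_ _⨾_⊢_⇓ⁿ_∶_ _⨾_⊢_⇓ᵗ_∶_

-- Harper and Pfenning's algorithmic equality, presented as evaluation to a stripped normal form.
mutual
  data _⨾_⊢_⇓_∶_ (Σ : Sig) {s} (Ξ : SCtx s) : Obj s → Obj s → STy → Set where
    step : M ⟶ N → Σ ⨾ Ξ ⊢ N ⇓ P ∶ o → Σ ⨾ Ξ ⊢ M ⇓ P ∶ o
    ne   : Σ ⨾ Ξ ⊢ M ⇓ⁿ P ∶ o → Σ ⨾ Ξ ⊢ M ⇓ P ∶ o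
    lam  : Σ ⨾ Ξ ▹ ρ ⊢ renᵒ weaken M · ` here refl ⇓ P ∶ ϕ → Σ ⨾ Ξ ⊢ M ⇓ ƛ (con 0) P ∶ ρ ⇒ ϕ
    abs  : Σ ⨾ Ξ ▹# ⊢ renᵒ weaken M ＠ here refl ⇓ P ∶ ρ → Σ ⨾ Ξ ⊢ M ⇓ ⟨ 0 ⟩ P ∶ ν ρ

  data _⨾_⊢_⇓ⁿ_∶_ (Σ : Sig) {s} (Ξ : SCtx s) : Obj s → Obj s → STy → Set where
    var  : ∀ {x} → Ξ x ≡ ρ → Σ ⨾ Ξ ⊢ ` x ⇓ⁿ ` x ∶ ρ
    con  : obj c A ∈ Σ → ⌊ A ⌋ ≡ ρ → Σ ⨾ Ξ ⊢ con c ⇓ⁿ con c ∶ ρ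
    nm   : Σ ⨾ Ξ ⊢ nm a ⇓ⁿ nm a ∶ o
    app  : Σ ⨾ Ξ ⊢ M ⇓ⁿ P ∶ ρ ⇒ ϕ → Σ ⨾ Ξ ⊢ N ⇓ Q ∶ ρ → Σ ⨾ Ξ ⊢ M · N ⇓ⁿ P · Q ∶ ϕ
    conc : Σ ⨾ Ξ ⊢ M ⇓ⁿ P ∶ ν ρ → Σ ⨾ Ξ ⊢ M ＠ a ⇓ⁿ P ＠ a ∶ ρ

data _⨾_⊢_⇓ᵗ_∶_ (Σ : Sig) {s} (Ξ : SCtx s) : Ty s → Ty s → List STy → Set where
  con  : ∀ {a} → fam a K ∈ Σ → ⌊ K ⌋ᵏ ≡ κ → Σ ⨾ Ξ ⊢ con a ⇓ᵗ con a ∶ κ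
  app  : Σ ⨾ Ξ ⊢ A ⇓ᵗ B ∶ ρ ∷ κ → Σ ⨾ Ξ ⊢ M ⇓ P ∶ ρ → Σ ⨾ Ξ ⊢ A · M ⇓ᵗ B · P ∶ κ
  Π    : Σ ⨾ Ξ ⊢ A ⇓ᵗ A′ ∶ [] → ⌊ A ⌋ ≡ ρ → Σ ⨾ Ξ ▹ ρ ⊢ B ⇓ᵗ B′ ∶ [] → Σ ⨾ Ξ ⊢ Π A B ⇓ᵗ Π A′ B′ ∶ []
  name : Σ ⨾ Ξ ⊢ name α ⇓ᵗ name α ∶ []
  New  : Σ ⨾ Ξ ▹# ⊢ B ⇓ᵗ B′ ∶ [] → Σ ⨾ Ξ ⊢ New α B ⇓ᵗ New α B′ ∶ []

⇓ⁿ-irreducible : Σ ⨾ Ξ ⊢ M ⇓ⁿ P ∶ ρ → ¬ (M ⟶ N)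
⇓ⁿ-irreducible (app () _) β
⇓ⁿ-irreducible (app d _) (app r) = ⇓ⁿ-irreducible d r
⇓ⁿ-irreducible (conc ()) β#
⇓ⁿ-irreducible (conc d) (conc r) = ⇓ⁿ-irreducible d r

infix 4 _≤ˢ_via_

_≤ˢ_via_ : SCtx s → SCtx t → s ⊆ t → Set
Ξ ≤ˢ Ξ′ via θ = ∀ x → Ξ′ (lookup θ x) ≡ Ξ x

≤ˢ-under : Ξ ≤ˢ Ξ′ via θ → Ξ ▹ ρ ≤ˢ Ξ′ ▹ ρ via (refl ∷ θ)
≤ˢ-under e (here refl) = refl
≤ˢ-under e (there x)   = e x

≤ˢ-under# : Ξ ≤ˢ Ξ′ via θ → Ξ ▹# ≤ˢ Ξ′ ▹# via (refl ∷ θ)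
≤ˢ-under# e (there x) = e x

≤ˢ-refl : Ξ ≤ˢ Ξ via ⊆-refl
≤ˢ-refl {Ξ = Ξ} x = cong Ξ (lookup-⊆-refl x)

≤ˢ-weaken : Ξ ≤ˢ Ξ ▹ ρ via weaken
≤ˢ-weaken {Ξ = Ξ} x = cong Ξ (lookup-⊆-refl x)

≤ˢ-weaken# : Ξ ≤ˢ Ξ ▹# via weaken
≤ˢ-weaken# {Ξ = Ξ} x = cong Ξ (lookup-⊆-refl x)

≤ˢ-trans : Ξ ≤ˢ Ξ′ via θ → Ξ′ ≤ˢ Ξ″ via φ → Ξ ≤ˢ Ξ″ via (⊆-trans θ φ)
≤ˢ-trans {Ξ″ = Ξ″} {φ = φ} e f x = trans (cong Ξ″ (lookup-⊆-trans φ x)) (trans (f _) (e x))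

mutual
  ⇓-ren : Ξ ≤ˢ Ξ′ via θ → Σ ⨾ Ξ ⊢ M ⇓ P ∶ ρ → Σ ⨾ Ξ′ ⊢ renᵒ θ M ⇓ renᵒ θ P ∶ ρ
  ⇓-ren {θ = θ} e (step r d) = step (⟶-ren θ r) (⇓-ren {θ = θ} e d)
  ⇓-ren {θ = θ} e (ne d) = ne (⇓ⁿ-ren {θ = θ} e d)
  ⇓-ren {θ = θ} e (lam {M = M} d) = lam (subst (λ M → _ ⨾ _ ⊢ M · _ ⇓ _ ∶ _) (renᵒ-renᵒ-weaken θ M)
    (⇓-ren {θ = refl ∷ θ} (≤ˢ-under {θ = θ} e) d))
  ⇓-ren {θ = θ} e (abs {M = M} d) = abs (subst (λ M → _ ⨾ _ ⊢ M ＠ _ ⇓ _ ∶ _) (renᵒ-renᵒ-weaken θ M)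
    (⇓-ren {θ = refl ∷ θ} (≤ˢ-under# {θ = θ} e) d))

  ⇓ⁿ-ren : Ξ ≤ˢ Ξ′ via θ → Σ ⨾ Ξ ⊢ M ⇓ⁿ P ∶ ρ → Σ ⨾ Ξ′ ⊢ renᵒ θ M ⇓ⁿ renᵒ θ P ∶ ρ
  ⇓ⁿ-ren e (var f)   = var (trans (e _) f)
  ⇓ⁿ-ren e (con p f) = con p f
  ⇓ⁿ-ren e nm        = nm
  ⇓ⁿ-ren {θ = θ} e (app d f) = app (⇓ⁿ-ren {θ = θ} e d) (⇓-ren {θ = θ} e f)
  ⇓ⁿ-ren {θ = θ} e (conc d)  = conc (⇓ⁿ-ren {θ = θ} e d)

⇓ᵗ-ren : Ξ ≤ˢ Ξ′ via θ → Σ ⨾ Ξ ⊢ A ⇓ᵗ B ∶ κ → Σ ⨾ Ξ′ ⊢ renᵗ θ A ⇓ᵗ renᵗ θ B ∶ κ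
⇓ᵗ-ren e (con p f) = con p f
⇓ᵗ-ren {θ = θ} e (app d f) = app (⇓ᵗ-ren {θ = θ} e d) (⇓-ren {θ = θ} e f)
⇓ᵗ-ren {θ = θ} e (Π {A = A} d f g) =
  Π (⇓ᵗ-ren {θ = θ} e d) (trans (⌊ren⌋ θ A) f) (⇓ᵗ-ren {θ = refl ∷ θ} (≤ˢ-under {θ = θ} e) g)
⇓ᵗ-ren e name = name
⇓ᵗ-ren {θ = θ} e (New d) = New (⇓ᵗ-ren {θ = refl ∷ θ} (≤ˢ-under# {θ = θ} e) d)

-- Evaluation takes reduction steps only at `o`. At other types the step is pushed under the
-- η-expansion, where it remains a weak head step.
⇓-expand : ∀ ρ {s} {Ξ : SCtx s} {M N P} → M ⟶ N → Σ ⨾ Ξ ⊢ N ⇓ P ∶ ρ → Σ ⨾ Ξ ⊢ M ⇓ P ∶ ρ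
⇓-expand o r d = step r d
⇓-expand (ρ ⇒ ϕ) r (lam d) = lam (⇓-expand ϕ (app (⟶-ren weaken r)) d)
⇓-expand (ν ρ) r (abs d) = abs (⇓-expand ρ (conc (⟶-ren weaken r)) d)

mutual
  -- Evaluation applies an abstraction to its bound variable or name; the redex so created contracts
  -- to the body, and head expansion absorbs that step.
  Nf-⇓ : Nf Σ Ξ M ρ → Σ ⨾ Ξ ⊢ M ⇓ stripᵒ M ∶ ρ
  Nf-⇓ (ne n) = ne (Ne-⇓ n)
  Nf-⇓ (lam {M = M} _ _ n) = lam (⇓-expand _ (β-to (ren-single-here ob M)) (Nf-⇓ n))
  Nf-⇓ (abs {M = M} n) = abs (⇓-expand _ (β#-to (ren-single-here ob M)) (Nf-⇓ n))

  Ne-⇓ : Ne Σ Ξ M ρ → Σ ⨾ Ξ ⊢ M ⇓ⁿ stripᵒ M ∶ ρ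
  Ne-⇓ (var e)   = var e
  Ne-⇓ (con p e) = con p e
  Ne-⇓ nm        = nm
  Ne-⇓ (app m n) = app (Ne-⇓ m) (Nf-⇓ n)
  Ne-⇓ (conc m)  = conc (Ne-⇓ m)

NfT-⇓ : NfT Σ Ξ A κ → Σ ⨾ Ξ ⊢ A ⇓ᵗ stripᵗ A ∶ κ
NfT-⇓ (con p e) = con p e
NfT-⇓ (app A n) = app (NfT-⇓ A) (Nf-⇓ n)
NfT-⇓ (Π A B)   = Π (NfT-⇓ A) refl (NfT-⇓ B)
NfT-⇓ name      = name
NfT-⇓ (New B)   = New (NfT-⇓ B)

-- New α B is interpreted by all functions from names: the freshness condition
-- plays no role for equality.
LR : (Σ : Sig) → STy → SCtx s → Obj s → Obj s → Set
LR Σ o       Ξ M N = ∃[ P ] (Σ ⨾ Ξ ⊢ M ⇓ P ∶ o) × (Σ ⨾ Ξ ⊢ N ⇓ P ∶ o)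
LR Σ (ρ ⇒ ϕ) Ξ M N = ∀ {t} {Ξ′ : SCtx t} θ → Ξ ≤ˢ Ξ′ via θ → ∀ {P Q} →
                     LR Σ ρ Ξ′ P Q → LR Σ ϕ Ξ′ (renᵒ θ M · P) (renᵒ θ N · Q)
LR Σ (ν ρ)   Ξ M N = ∀ {t} {Ξ′ : SCtx t} θ → Ξ ≤ˢ Ξ′ via θ → ∀ a →
                     LR Σ ρ Ξ′ (renᵒ θ M ＠ a) (renᵒ θ N ＠ a)

-- Families are related as functions at Π-kinds because the extensionality rule equates them through
-- their applications; only at kind `type` is a common evaluation required.
LRᵗ : (Σ : Sig) → List STy → SCtx s → Ty s → Ty s → Set
LRᵗ Σ []      Ξ A B = ∃[ C ] (Σ ⨾ Ξ ⊢ A ⇓ᵗ C ∶ []) × (Σ ⨾ Ξ ⊢ B ⇓ᵗ C ∶ [])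
LRᵗ Σ (ρ ∷ κ) Ξ A B = ∀ {t} {Ξ′ : SCtx t} θ → Ξ ≤ˢ Ξ′ via θ → ∀ {P Q} →
                      LR Σ ρ Ξ′ P Q → LRᵗ Σ κ Ξ′ (renᵗ θ A · P) (renᵗ θ B · Q)

LR-ren : ∀ ρ (θ : s ⊆ t) → Ξ ≤ˢ Ξ′ via θ → LR Σ ρ Ξ M N → LR Σ ρ Ξ′ (renᵒ θ M) (renᵒ θ N)
LR-ren o θ e (P , d , f) = renᵒ θ P , ⇓-ren {θ = θ} e d , ⇓-ren {θ = θ} e f
LR-ren {Σ = Σ} {M = M} {N = N} (ρ ⇒ ϕ) θ e h {Ξ′ = Ξ″} φ f {P} {Q} pq =
  subst₂ (λ M N → LR Σ ϕ _ (M · P) (N · Q)) (sym (ren-ren ob θ φ M)) (sym (ren-ren ob θ φ N))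
    (h (⊆-trans θ φ) (≤ˢ-trans {θ = θ} {Ξ″ = Ξ″} {φ = φ} e f) pq)
LR-ren {Σ = Σ} {M = M} {N = N} (ν ρ) θ e h {Ξ′ = Ξ″} φ f a =
  subst₂ (λ M N → LR Σ ρ _ (M ＠ a) (N ＠ a)) (sym (ren-ren ob θ φ M)) (sym (ren-ren ob θ φ N))
    (h (⊆-trans θ φ) (≤ˢ-trans {θ = θ} {Ξ″ = Ξ″} {φ = φ} e f) a)

LR-sym : ∀ ρ {s} {Ξ : SCtx s} {M N} → LR Σ ρ Ξ M N → LR Σ ρ Ξ N M
LR-sym o (P , d , f) = P , f , d
LR-sym (ρ ⇒ ϕ) h θ e pq = LR-sym ϕ (h θ e (LR-sym ρ pq))
LR-sym (ν ρ) h θ e a = LR-sym ρ (h θ e a)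

LR-expand : ∀ ρ {s} {Ξ : SCtx s} {M M′ N} → M ⟶ M′ → LR Σ ρ Ξ M′ N → LR Σ ρ Ξ M N
LR-expand o r (P , d , f) = P , step r d , f
LR-expand (ρ ⇒ ϕ) r h θ e pq = LR-expand ϕ (app (⟶-ren θ r)) (h θ e pq)
LR-expand (ν ρ) r h θ e a = LR-expand ρ (conc (⟶-ren θ r)) (h θ e a)

mutual
  -- Mutual because arrows are contravariant: to reflect at `ρ ⇒ ϕ` the arguments are reified at
  -- `ρ`, and to reify there a fresh variable is reflected at `ρ`.
  reflect : ∀ ρ {s} {Ξ : SCtx s} {M N P} → Σ ⨾ Ξ ⊢ M ⇓ⁿ P ∶ ρ → Σ ⨾ Ξ ⊢ N ⇓ⁿ P ∶ ρ → LR Σ ρ Ξ M N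
  reflect o d f = _ , ne d , ne f
  reflect (ρ ⇒ ϕ) d f θ e pq with _ , p , q ← reify ρ pq =
    reflect ϕ (app (⇓ⁿ-ren {θ = θ} e d) p) (app (⇓ⁿ-ren {θ = θ} e f) q)
  reflect (ν ρ) d f θ e a = reflect ρ (conc (⇓ⁿ-ren {θ = θ} e d)) (conc (⇓ⁿ-ren {θ = θ} e f))

  reify : ∀ ρ {s} {Ξ : SCtx s} {M N} → LR Σ ρ Ξ M N → ∃[ P ] (Σ ⨾ Ξ ⊢ M ⇓ P ∶ ρ) × (Σ ⨾ Ξ ⊢ N ⇓ P ∶ ρ)
  reify o h = h
  reify (ρ ⇒ ϕ) {Ξ = Ξ} h
    with _ , d , f ← reify ϕ (h {Ξ′ = Ξ ▹ ρ} weaken (≤ˢ-weaken {Ξ = Ξ} {ρ = ρ}) (reflect ρ (var refl) (var refl))) =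
    _ , lam d , lam f
  reify (ν ρ) {Ξ = Ξ} h
    with _ , d , f ← reify ρ (h {Ξ′ = Ξ ▹#} weaken (≤ˢ-weaken# {Ξ = Ξ}) (here refl)) = _ , abs d , abs f

LRᵗ-sym : ∀ κ {s} {Ξ : SCtx s} {A B} → LRᵗ Σ κ Ξ A B → LRᵗ Σ κ Ξ B A
LRᵗ-sym [] (P , d , f) = P , f , d
LRᵗ-sym (ρ ∷ κ) h θ e pq = LRᵗ-sym κ (h θ e (LR-sym ρ pq))

reflectᵗ : ∀ κ {s} {Ξ : SCtx s} {A B C} → Σ ⨾ Ξ ⊢ A ⇓ᵗ C ∶ κ → Σ ⨾ Ξ ⊢ B ⇓ᵗ C ∶ κ → LRᵗ Σ κ Ξ A B
reflectᵗ [] d f = _ , d , f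
reflectᵗ (ρ ∷ κ) d f θ e pq with _ , p , q ← reify ρ pq =
  reflectᵗ κ (app (⇓ᵗ-ren {θ = θ} e d) p) (app (⇓ᵗ-ren {θ = θ} e f) q)

record RelSub (Σ : Sig) (Ξ : SCtx s) (Ξ′ : SCtx t) (σ σ′ : Sub s t) : Set where
  constructor relsub
  field
    on-var  : (x : var ∈ s) → LR Σ (Ξ x) Ξ′ (σ x) (σ′ x)
    on-name : (a : nm ∈ s) → σ′ a ≡ σ a

RelSub-ren : Ξ′ ≤ˢ Ξ″ via θ → RelSub Σ Ξ Ξ′ σ σ′ → RelSub Σ Ξ Ξ″ (ι θ ⊙ σ) (ι θ ⊙ σ′)
RelSub-ren {θ = θ} {Σ = Σ} {Ξ = Ξ} {σ = σ} {σ′} e (relsub v n) = relsub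
  (λ x → subst₂ (LR Σ (Ξ x) _) (renᵒ-sub θ (σ x)) (renᵒ-sub θ (σ′ x)) (LR-ren (Ξ x) θ e (v x)))
  (λ a → cong (lookup θ) (n a))

RelSub-cons : RelSub Σ Ξ Ξ′ σ σ′ → LR Σ ρ Ξ′ P Q → RelSub Σ (Ξ ▹ ρ) Ξ′ (cons P σ) (cons Q σ′)
RelSub-cons (relsub v n) pq = relsub (λ { (here refl) → pq ; (there x) → v x }) (λ { (there a) → n a })

RelSub-cons# : RelSub Σ Ξ Ξ′ σ σ′ → ∀ {a b} → b ≡ a → RelSub Σ (Ξ ▹#) Ξ′ (cons a σ) (cons b σ′)
RelSub-cons# (relsub v n) e = relsub (λ { (there x) → v x }) (λ { (here refl) → e ; (there a) → n a })

RelSub-resp : RelSub Σ Ξ Ξ′ σ σ′ → σ ≗ τ → σ′ ≗ τ′ → RelSub Σ Ξ Ξ′ τ τ′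
RelSub-resp {Σ = Σ} {Ξ = Ξ} (relsub v n) e f = relsub
  (λ x → subst₂ (LR Σ (Ξ x) _) (e x) (f x) (v x))
  (λ a → trans (sym (f a)) (trans (n a) (e a)))

cons-lift : (σ : Sub s t) → cons {k = k} (index (here refl)) (ι weaken ⊙ σ) ≗ lift σ
cons-lift σ (here refl) = refl
cons-lift σ {l} (there i) = sym (renⁱ-sub {k = l} weaken (σ i))

RelSub-lift : RelSub Σ Ξ Ξ′ σ σ′ → RelSub Σ (Ξ ▹ ρ) (Ξ′ ▹ ρ) (lift σ) (lift σ′)
RelSub-lift {Ξ′ = Ξ′} {σ = σ} {σ′} {ρ = ρ} m = RelSub-resp
  (RelSub-cons (RelSub-ren {θ = weaken} (≤ˢ-weaken {Ξ = Ξ′} {ρ = ρ}) m) (reflect ρ (var refl) (var refl)))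
  (cons-lift σ) (cons-lift σ′)

RelSub-lift# : RelSub Σ Ξ Ξ′ σ σ′ → RelSub Σ (Ξ ▹#) (Ξ′ ▹#) (lift σ) (lift σ′)
RelSub-lift# {Ξ′ = Ξ′} {σ = σ} {σ′} m = RelSub-resp
  (RelSub-cons# (RelSub-ren {θ = weaken} (≤ˢ-weaken# {Ξ = Ξ′}) m) refl)
  (cons-lift σ) (cons-lift σ′)

RelSub-sym : RelSub Σ Ξ Ξ′ σ σ′ → RelSub Σ Ξ Ξ′ σ′ σ
RelSub-sym {Ξ = Ξ} (relsub v n) = relsub (λ x → LR-sym (Ξ x) (v x)) (λ a → sym (n a))

-- In contrast with `SubRel`, the target need not be restricted: the related objects are raw and
-- freshness is not tracked, so precomposition with the embedding suffices.
RelSub-restrict : Γ ⊢ a ∶ α ╲ Γ′ via θ → RelSub Σ ⌊ Γ ⌋ᶜ Ξ σ σ′ → RelSub Σ ⌊ Γ′ ⌋ᶜ Ξ (σ ⊙ ι θ) (σ′ ⊙ ι θ)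
RelSub-restrict {Σ = Σ} {Ξ = Ξ} {σ = σ} {σ′} r (relsub v n) = relsub
  (λ x → subst (λ ρ → LR Σ ρ Ξ (σ _) (σ′ _)) (⌊⌋ᶜ-⊆ᶜ (restriction-⊆ᶜ r) x) (v _)) (λ a → n _)

-- Evaluation is complete for definitional equality

module Completeness {Σ : Sig} (S : ⊢ Σ sig) where
  mutual
    ⇓-unique : Σ ⨾ Ξ ⊢ M ⇓ P ∶ ρ → Σ ⨾ Ξ ⊢ M ⇓ Q ∶ ρ → P ≡ Q
    ⇓-unique (step r d) (step q f) rewrite ⟶-deterministic r q = ⇓-unique d f
    ⇓-unique (step r d) (ne f) = ⊥-elim (⇓ⁿ-irreducible f r)
    ⇓-unique (ne d) (step q f) = ⊥-elim (⇓ⁿ-irreducible d q)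
    ⇓-unique (ne d) (ne f) = proj₁ (⇓ⁿ-unique d f)
    ⇓-unique (lam d) (lam f) = cong (ƛ (con 0)) (⇓-unique d f)
    ⇓-unique (abs d) (abs f) = cong (⟨ 0 ⟩_) (⇓-unique d f)

    -- Neutral objects also determine their simple type. In an application this fixes the type at
    -- which the argument is evaluated, without which the two evaluations of the argument could not
    -- be compared.
    ⇓ⁿ-unique : Σ ⨾ Ξ ⊢ M ⇓ⁿ P ∶ ρ → Σ ⨾ Ξ ⊢ M ⇓ⁿ Q ∶ ϕ → P ≡ Q × ρ ≡ ϕ
    ⇓ⁿ-unique (var e) (var f) = refl , trans (sym e) f
    ⇓ⁿ-unique (con p e) (con q f) = refl , trans (sym e) (trans (cong ⌊_⌋ (obj-unique S p q)) f)
    ⇓ⁿ-unique nm nm = refl , refl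
    ⇓ⁿ-unique (app d e) (app f g) with refl , refl ← ⇓ⁿ-unique d f = cong (_ ·_) (⇓-unique e g) , refl
    ⇓ⁿ-unique (conc d) (conc f) with refl , refl ← ⇓ⁿ-unique d f = refl , refl

  ⇓ᵗ-unique : ∀ {κ′} → Σ ⨾ Ξ ⊢ A ⇓ᵗ B ∶ κ → Σ ⨾ Ξ ⊢ A ⇓ᵗ C ∶ κ′ → B ≡ C × κ ≡ κ′
  ⇓ᵗ-unique (con p e) (con q f) = refl , trans (sym e) (trans (cong ⌊_⌋ᵏ (fam-unique S p q)) f)
  ⇓ᵗ-unique (app d e) (app f g) with refl , refl ← ⇓ᵗ-unique d f = cong (_ ·_) (⇓-unique e g) , refl
  ⇓ᵗ-unique (Π d refl e) (Π f refl g) = cong₂ Π (proj₁ (⇓ᵗ-unique d f)) (proj₁ (⇓ᵗ-unique e g)) , refl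
  ⇓ᵗ-unique name name = refl , refl
  ⇓ᵗ-unique (New d) (New f) = cong (New _) (proj₁ (⇓ᵗ-unique d f)) , refl

  LR-trans : ∀ ρ {s} {Ξ : SCtx s} {M N P} → LR Σ ρ Ξ M N → LR Σ ρ Ξ N P → LR Σ ρ Ξ M P
  LR-trans o (V , d , e) (W , f , g) with refl ← ⇓-unique e f = V , d , g
  -- The two halves meet at `N` applied to the right argument, so the second needs that argument
  -- related to itself, which symmetry and transitivity at `ρ` provide.
  LR-trans (ρ ⇒ ϕ) h i θ e pq = LR-trans ϕ (h θ e pq) (i θ e (LR-trans ρ (LR-sym ρ pq) pq))
  LR-trans (ν ρ) h i θ e a = LR-trans ρ (h θ e a) (i θ e a)

  LRᵗ-trans : ∀ κ {s} {Ξ : SCtx s} {A B C} → LRᵗ Σ κ Ξ A B → LRᵗ Σ κ Ξ B C → LRᵗ Σ κ Ξ A C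
  LRᵗ-trans [] (V , d , e) (W , f , g) with refl , _ ← ⇓ᵗ-unique e f = V , d , g
  LRᵗ-trans (ρ ∷ κ) h i θ e pq = LRᵗ-trans κ (h θ e pq) (i θ e (LR-trans ρ (LR-sym ρ pq) pq))

  RelSub-diag : RelSub Σ Ξ Ξ′ σ σ′ → RelSub Σ Ξ Ξ′ σ′ σ′
  RelSub-diag {Ξ = Ξ} (relsub v n) = relsub (λ x → LR-trans (Ξ x) (LR-sym (Ξ x) (v x)) (v x)) (λ a → refl)

  apply-refl : LR Σ (ρ ⇒ ϕ) Ξ M N → LR Σ ρ Ξ P Q → LR Σ ϕ Ξ (M · P) (N · Q)
  apply-refl {ϕ = ϕ} {Ξ = Ξ} {M = M} {N = N} {P = P} {Q = Q} h pq =
    subst₂ (λ M N → LR Σ ϕ Ξ (M · P) (N · Q)) (ren-refl ob M) (ren-refl ob N) (h ⊆-refl (≤ˢ-refl {Ξ = Ξ}) pq)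

  concrete-refl : LR Σ (ν ρ) Ξ M N → ∀ a → LR Σ ρ Ξ (M ＠ a) (N ＠ a)
  concrete-refl {ρ = ρ} {Ξ = Ξ} {M = M} {N = N} h a =
    subst₂ (λ M N → LR Σ ρ Ξ (M ＠ a) (N ＠ a)) (ren-refl ob M) (ren-refl ob N) (h ⊆-refl (≤ˢ-refl {Ξ = Ξ}) a)

  expand-β : (M : Obj (var ∷ s)) (σ : Sub s t) → LR Σ ρ Ξ (subᵒ (cons P σ) M) N → LR Σ ρ Ξ (ƛ A (subᵒ (lift σ) M) · P) N
  expand-β {ρ = ρ} {Ξ = Ξ} {P = P} {N = N} M σ h =
    LR-expand ρ β (subst (λ M → LR Σ ρ Ξ M N) (sym (sub-lift-single {k = var} ob σ P M)) h)

  expand-β# : (M : Obj (nm ∷ s)) (σ : Sub s t) → LR Σ ρ Ξ (subᵒ (cons a σ) M) N → LR Σ ρ Ξ ((⟨ α ⟩ subᵒ (lift σ) M) ＠ a) N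
  expand-β# {ρ = ρ} {Ξ = Ξ} {a = a} {N = N} M σ h =
    LR-expand ρ β# (subst (λ M → LR Σ ρ Ξ M N) (sym (sub-lift-single {k = nm} ob σ a M)) h)

  -- Induction on the equality derivation with two different substitutions. Symmetry swaps them;
  -- transitivity changes substitution in its first half and uses the diagonal of the second
  -- substitution in the other. The rules `lam`, `abs` and both β-rules rest on closure under head
  -- expansion.
  fundamentalᵒ : Σ ⨾ Γ ⊢ᵒ M ≈ N ∶ A → RelSub Σ ⌊ Γ ⌋ᶜ Ξ σ σ′ → LR Σ ⌊ A ⌋ Ξ (subᵒ σ M) (subᵒ σ′ N)
  fundamentalᵒ {A = A} (≈-sym e) m = LR-sym ⌊ A ⌋ (fundamentalᵒ e (RelSub-sym m))
  fundamentalᵒ {A = A} (≈-trans e f) m = LR-trans ⌊ A ⌋ (fundamentalᵒ e m) (fundamentalᵒ f (RelSub-diag m))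
  fundamentalᵒ {Ξ = Ξ} (conv e f) m = subst (λ ρ → LR Σ ρ Ξ _ _) (⌊⌋-≈ f) (fundamentalᵒ e m)
  fundamentalᵒ {Ξ = Ξ} (var {x = x} p) m = subst (λ ρ → LR Σ ρ Ξ _ _) (⌊⌋ᶜ-∋ p) (RelSub.on-var m x)
  fundamentalᵒ (con {A = A} p) m = reflect _ (con p (sym (⌊ren⌋ (minimum _) A))) (con p (sym (⌊ren⌋ (minimum _) A)))
  fundamentalᵒ {Ξ = Ξ} (app {B = B} {M₂ = M₂} e f) m =
    subst (λ ρ → LR Σ ρ Ξ _ _) (sym (⌊sub⌋ (single M₂) B)) (apply-refl (fundamentalᵒ e m) (fundamentalᵒ f m))
  fundamentalᵒ {Ξ = Ξ} {σ = σ} {σ′} (lam {A = A} {B = B} {M = M} {N} _ _ _ e) m {Ξ′ = Ξ′} θ f {P} {Q} pq =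
    subst₂ (λ M N → LR Σ ⌊ B ⌋ Ξ′ (ƛ _ M · P) (ƛ _ N · Q)) (sym (ren-lift ob θ σ M)) (sym (ren-lift ob θ σ′ N))
      (expand-β M (ι θ ⊙ σ) (LR-sym ⌊ B ⌋ (expand-β N (ι θ ⊙ σ′) (LR-sym ⌊ B ⌋
        (fundamentalᵒ e (RelSub-cons (RelSub-ren {θ = θ} f m) pq))))))
  fundamentalᵒ {Ξ = Ξ} {σ = σ} {σ′} (β {B = B} {M₁ = M₁} {M₂} {N₁} {N₂} _ e f) m =
    subst (λ ρ → LR Σ ρ Ξ _ _) (sym (⌊sub⌋ (single M₁) B))
      (expand-β M₂ σ (subst (LR Σ ⌊ B ⌋ Ξ _) (sym (sub-cons-single {k = var} ob σ′ N₁ N₂))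
        (fundamentalᵒ e (RelSub-cons m (fundamentalᵒ f m)))))
  fundamentalᵒ {σ = σ} {σ′} (ext {B = B} {M} {N} _ _ _ e) m {Ξ′ = Ξ′} θ f {P} {Q} pq =
    subst₂ (λ M N → LR Σ ⌊ B ⌋ Ξ′ (M · P) (N · Q))
      (trans (sub-cons-weaken {k = var} ob (ι θ ⊙ σ) P M) (sym (ren-sub ob θ σ M)))
      (trans (sub-cons-weaken {k = var} ob (ι θ ⊙ σ′) Q N) (sym (ren-sub ob θ σ′ N)))
      (fundamentalᵒ e (RelSub-cons (RelSub-ren {θ = θ} f m) pq))
  fundamentalᵒ {σ = σ} (nm {a = a} p) m rewrite RelSub.on-name m a = _ , ne nm , ne nm
  fundamentalᵒ {σ = σ} {σ′} (abs {A = A} {M} {N} _ e) m {Ξ′ = Ξ′} θ f a =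
    subst₂ (λ M N → LR Σ ⌊ A ⌋ Ξ′ ((⟨ _ ⟩ M) ＠ a) ((⟨ _ ⟩ N) ＠ a)) (sym (ren-lift ob θ σ M)) (sym (ren-lift ob θ σ′ N))
      (expand-β# {a = a} M (ι θ ⊙ σ) (LR-sym ⌊ A ⌋ (expand-β# {a = a} N (ι θ ⊙ σ′) (LR-sym ⌊ A ⌋
        (fundamentalᵒ e (RelSub-cons# (RelSub-ren {θ = θ} f m) refl))))))
  fundamentalᵒ {Ξ = Ξ} {σ = σ} {σ′} (conc {θ = θ} {b = b} {A = A} {M} {N} r e) m =
    subst (λ ρ → LR Σ ρ Ξ _ _) (sym (trans (⌊sub⌋ (single b) (renᵗ (refl ∷ θ) A)) (⌊ren⌋ (refl ∷ θ) A)))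
      (subst₂ (λ M N → LR Σ ⌊ A ⌋ Ξ (M ＠ σ b) N) (sym (sub-ren ob σ θ M))
        (cong₂ _＠_ (sym (sub-ren ob σ′ θ N)) (sym (RelSub.on-name m b)))
        (concrete-refl {ρ = ⌊ A ⌋} (fundamentalᵒ e (RelSub-restrict r m)) (σ b)))
  fundamentalᵒ {Ξ = Ξ} {σ = σ} {σ′} (β# {θ = θ} {b = b} {α = α} {A = A} {M} {N} r e) m =
    subst (λ ρ → LR Σ ρ Ξ _ _) (sym (trans (⌊sub⌋ (single b) (renᵗ (refl ∷ θ) A)) (⌊ren⌋ (refl ∷ θ) A)))
      (subst₂ (LR Σ ⌊ A ⌋ Ξ) (cong (_＠ σ b) (sym (sub-ren ob σ θ (⟨ α ⟩ M))))
        (sym (trans (sub-cons-single {k = nm} ob σ′ b (renᵒ (refl ∷ θ) N)) (sub-cons-ren {k = nm} ob σ′ θ (σ′ b) N)))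
        (expand-β# {a = σ b} M (σ ⊙ ι θ) (fundamentalᵒ e (RelSub-cons# (RelSub-restrict r m) (RelSub.on-name m b)))))
  fundamentalᵒ {σ = σ} {σ′} (ext# {A = A} {M} {N} _ e) m {Ξ′ = Ξ′} θ f a =
    subst₂ (λ M N → LR Σ ⌊ A ⌋ Ξ′ (M ＠ a) (N ＠ a))
      (trans (sub-cons-weaken {k = nm} ob (ι θ ⊙ σ) a M) (sym (ren-sub ob θ σ M)))
      (trans (sub-cons-weaken {k = nm} ob (ι θ ⊙ σ′) a N) (sym (ren-sub ob θ σ′ N)))
      (fundamentalᵒ e (RelSub-cons# (RelSub-ren {θ = θ} f m) refl))

  fundamentalᵗ : Σ ⨾ Γ ⊢ᵗ A ≈ B ∶ K → RelSub Σ ⌊ Γ ⌋ᶜ Ξ σ σ′ → LRᵗ Σ ⌊ K ⌋ᵏ Ξ (subᵗ σ A) (subᵗ σ′ B)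
  fundamentalᵗ {K = K} (≈-sym e) m = LRᵗ-sym ⌊ K ⌋ᵏ (fundamentalᵗ e (RelSub-sym m))
  fundamentalᵗ {K = K} (≈-trans e f) m = LRᵗ-trans ⌊ K ⌋ᵏ (fundamentalᵗ e m) (fundamentalᵗ f (RelSub-diag m))
  fundamentalᵗ {Ξ = Ξ} (conv e f) m = subst (λ κ → LRᵗ Σ κ Ξ _ _) (⌊⌋ᵏ-≈ f) (fundamentalᵗ e m)
  fundamentalᵗ (con {K = K} p) m =
    reflectᵗ _ (con p (sym (⌊ren⌋ᵏ (minimum _) K))) (con p (sym (⌊ren⌋ᵏ (minimum _) K)))
  fundamentalᵗ {Ξ = Ξ} {σ = σ} {σ′} (app {A = A} {B} {K = K} {M} {N} e f) m =
    subst (λ κ → LRᵗ Σ κ Ξ _ _) (sym (⌊sub⌋ᵏ (single M) K))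
      (subst₂ (λ A B → LRᵗ Σ ⌊ K ⌋ᵏ Ξ (A · subᵒ σ M) (B · subᵒ σ′ N)) (ren-refl ty (subᵗ σ A)) (ren-refl ty (subᵗ σ′ B))
        (fundamentalᵗ e m ⊆-refl (≤ˢ-refl {Ξ = Ξ}) (fundamentalᵒ f m)))
  fundamentalᵗ {σ = σ} {σ′} (Π {A₁ = A₁} {B₁ = B₁} _ e f) m
    with _ , a , b ← fundamentalᵗ e m | _ , c , d ← fundamentalᵗ f (RelSub-lift m) =
    -- Both codomains are evaluated over the erasure of `A₁`, which `B₁` shares because equal types
    -- have equal erasures.
    _ , Π a (⌊sub⌋ σ A₁) c , Π b (trans (⌊sub⌋ σ′ B₁) (sym (⌊⌋-≈ e))) d
  fundamentalᵗ {σ = σ} {σ′} (ext {A₁ = A₁} {A₂} {K = K} _ e) m {Ξ′ = Ξ′} θ f {P} {Q} pq =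
    subst₂ (λ M N → LRᵗ Σ ⌊ K ⌋ᵏ Ξ′ (M · P) (N · Q))
      (trans (sub-cons-weaken {k = var} ty (ι θ ⊙ σ) P A₁) (sym (ren-sub ty θ σ A₁)))
      (trans (sub-cons-weaken {k = var} ty (ι θ ⊙ σ′) Q A₂) (sym (ren-sub ty θ σ′ A₂)))
      (fundamentalᵗ e (RelSub-cons (RelSub-ren {θ = θ} f m) pq))
  fundamentalᵗ (name _) m = _ , name , name
  fundamentalᵗ (New _ e) m with _ , a , b ← fundamentalᵗ e (RelSub-lift# m) = _ , New a , New b

  RelSub-id : RelSub Σ Ξ Ξ idˢ idˢ
  RelSub-id {Ξ = Ξ} = relsub (λ x → reflect (Ξ x) (var refl) (var refl)) (λ a → refl)

  -- At the identity substitution, reification gives a common value; each normal form evaluates to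
  -- its own stripped version, and evaluation is deterministic.
  ≈-strip : Σ ⨾ Γ ⊢ᵒ M ≈ N ∶ A → Nf Σ ⌊ Γ ⌋ᶜ M ⌊ A ⌋ → Nf Σ ⌊ Γ ⌋ᶜ N ⌊ A ⌋ → stripᵒ M ≡ stripᵒ N
  ≈-strip {M = M} {N = N} {A = A} e m n
    with _ , d , f ← reify ⌊ A ⌋ (subst₂ (LR Σ ⌊ A ⌋ _) (subᵒ-id M) (subᵒ-id N) (fundamentalᵒ e RelSub-id)) =
    trans (⇓-unique (Nf-⇓ m) d) (⇓-unique f (Nf-⇓ n))

  ≈-stripᵗ : Σ ⨾ Γ ⊢ᵗ A ≈ B ∶ type → NfT Σ ⌊ Γ ⌋ᶜ A [] → NfT Σ ⌊ Γ ⌋ᶜ B [] → stripᵗ A ≡ stripᵗ B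
  ≈-stripᵗ {A = A} {B = B} e m n
    with _ , d , f ← subst₂ (LRᵗ Σ [] _) (subᵗ-id A) (subᵗ-id B) (fundamentalᵗ e RelSub-id) =
    trans (proj₁ (⇓ᵗ-unique (NfT-⇓ m) d)) (proj₁ (⇓ᵗ-unique f (NfT-⇓ n)))

-- Canonical forms and uniqueness

mutual
  HasRedexᵒ-ren : (θ : s ⊆ t) → HasRedexᵒ M → HasRedexᵒ (renᵒ θ M)
  HasRedexᵒ-ren θ β        = β
  HasRedexᵒ-ren θ β#       = β#
  HasRedexᵒ-ren θ (lam₁ h) = lam₁ (HasRedexᵗ-ren θ h)
  HasRedexᵒ-ren θ (lam₂ h) = lam₂ (HasRedexᵒ-ren (refl ∷ θ) h)
  HasRedexᵒ-ren θ (app₁ h) = app₁ (HasRedexᵒ-ren θ h)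
  HasRedexᵒ-ren θ (app₂ h) = app₂ (HasRedexᵒ-ren θ h)
  HasRedexᵒ-ren θ (abs h)  = abs (HasRedexᵒ-ren (refl ∷ θ) h)
  HasRedexᵒ-ren θ (conc h) = conc (HasRedexᵒ-ren θ h)

  HasRedexᵗ-ren : (θ : s ⊆ t) → HasRedexᵗ A → HasRedexᵗ (renᵗ θ A)
  HasRedexᵗ-ren θ (app₁ h) = app₁ (HasRedexᵗ-ren θ h)
  HasRedexᵗ-ren θ (app₂ h) = app₂ (HasRedexᵒ-ren θ h)
  HasRedexᵗ-ren θ (Π₁ h)   = Π₁ (HasRedexᵗ-ren θ h)
  HasRedexᵗ-ren θ (Π₂ h)   = Π₂ (HasRedexᵗ-ren (refl ∷ θ) h)
  HasRedexᵗ-ren θ (New h)  = New (HasRedexᵗ-ren (refl ∷ θ) h)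

mutual
  HasRedexᵒ-unren : (θ : s ⊆ t) → HasRedexᵒ (renᵒ θ M) → HasRedexᵒ M
  HasRedexᵒ-unren {M = ƛ A M} θ (lam₁ h)      = lam₁ (HasRedexᵗ-unren θ h)
  HasRedexᵒ-unren {M = ƛ A M} θ (lam₂ h)      = lam₂ (HasRedexᵒ-unren (refl ∷ θ) h)
  HasRedexᵒ-unren {M = ƛ A M · N} θ β         = β
  HasRedexᵒ-unren {M = M · N} θ (app₁ h)      = app₁ (HasRedexᵒ-unren θ h)
  HasRedexᵒ-unren {M = M · N} θ (app₂ h)      = app₂ (HasRedexᵒ-unren θ h)
  HasRedexᵒ-unren {M = ⟨ α ⟩ M} θ (abs h)     = abs (HasRedexᵒ-unren (refl ∷ θ) h)
  HasRedexᵒ-unren {M = (⟨ α ⟩ M) ＠ a} θ β#   = β#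
  HasRedexᵒ-unren {M = M ＠ a} θ (conc h)     = conc (HasRedexᵒ-unren θ h)

  HasRedexᵗ-unren : (θ : s ⊆ t) → HasRedexᵗ (renᵗ θ A) → HasRedexᵗ A
  HasRedexᵗ-unren {A = A · M} θ (app₁ h) = app₁ (HasRedexᵗ-unren θ h)
  HasRedexᵗ-unren {A = A · M} θ (app₂ h) = app₂ (HasRedexᵒ-unren θ h)
  HasRedexᵗ-unren {A = Π A B} θ (Π₁ h)   = Π₁ (HasRedexᵗ-unren θ h)
  HasRedexᵗ-unren {A = Π A B} θ (Π₂ h)   = Π₂ (HasRedexᵗ-unren (refl ∷ θ) h)
  HasRedexᵗ-unren {A = New α B} θ (New h) = New (HasRedexᵗ-unren (refl ∷ θ) h)

mutual
  Nf-¬HasRedex : Nf Σ Ξ M ρ → ¬ HasRedexᵒ M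
  Nf-¬HasRedex (ne n) h           = Ne-¬HasRedex n h
  Nf-¬HasRedex (lam A _ n) (lam₁ h) = NfT-¬HasRedex A h
  Nf-¬HasRedex (lam A _ n) (lam₂ h) = Nf-¬HasRedex n h
  Nf-¬HasRedex (abs n) (abs h)    = Nf-¬HasRedex n h

  Ne-¬HasRedex : Ne Σ Ξ M ρ → ¬ HasRedexᵒ M
  Ne-¬HasRedex (app m n) (app₁ h) = Ne-¬HasRedex m h
  Ne-¬HasRedex (app m n) (app₂ h) = Nf-¬HasRedex n h
  Ne-¬HasRedex (conc m) (conc h)  = Ne-¬HasRedex m h

  NfT-¬HasRedex : NfT Σ Ξ A κ → ¬ HasRedexᵗ A
  NfT-¬HasRedex (app A n) (app₁ h) = NfT-¬HasRedex A h
  NfT-¬HasRedex (app A n) (app₂ h) = Nf-¬HasRedex n h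
  NfT-¬HasRedex (Π A B) (Π₁ h)     = NfT-¬HasRedex A h
  NfT-¬HasRedex (Π A B) (Π₂ h)     = NfT-¬HasRedex B h
  NfT-¬HasRedex (New B) (New h)    = NfT-¬HasRedex B h

-- Only the outermost constructor of the simple type is significant, so `o ⇒ o` and `ν o` below are
-- arbitrary choices. Together with `intro-type` this refutes typings of an introduction form at a
-- type of the wrong shape.
data Intro {s} : Obj s → STy → Set where
  lam : Intro (ƛ A M) (ρ ⇒ ϕ)
  abs : Intro (⟨ α ⟩ M) (ν ρ)

intro-type : Intro M ρ → Σ ⨾ Γ ⊢ᵒ M ∶ A → Intro M ⌊ A ⌋
intro-type lam (lam _ _) = lam
intro-type abs (abs _ _) = abs
intro-type {M = M} i (conv D e) = subst (Intro M) (⌊⌋-≈ e) (intro-type i D)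

module Canonicity {Σ : Sig} (S : ⊢ Σ sig) where
  open Inversion S
  open Existence S

  Ne-type : Σ ⨾ Γ ⊢ᵒ M ∶ A → Ne Σ ⌊ Γ ⌋ᶜ M ρ → ρ ≡ ⌊ A ⌋
  Ne-type (con {A = A} p) (con q e) = trans (sym e) (trans (cong ⌊_⌋ (obj-unique S q p)) (sym (⌊ren⌋ (minimum _) A)))
  Ne-type (var p) (var e) = trans (sym e) (⌊⌋ᶜ-∋ p)
  Ne-type (nm p) nm = refl
  Ne-type (app {B = B} {N = N} D E) (app m n) = trans (proj₂ (⇒-inj (Ne-type D m))) (sym (⌊sub⌋ (single N) B))
  Ne-type (conc {θ = θ} {a = a} {B = B} r D) (conc m) =
    trans (ν-inj (Ne-type D (Ne-unren r m))) (sym (trans (⌊sub⌋ (single a) (renᵗ (refl ∷ θ) B)) (⌊ren⌋ (refl ∷ θ) B)))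
  Ne-type (conv D e) m = trans (Ne-type D m) (⌊⌋-≈ e)

  NfT-kind : Σ ⨾ Γ ⊢ᵗ A ∶ K → NfT Σ ⌊ Γ ⌋ᶜ A κ → κ ≡ ⌊ K ⌋ᵏ
  NfT-kind (con {K = K} p) (con q e) = trans (sym e) (trans (cong ⌊_⌋ᵏ (fam-unique S q p)) (sym (⌊ren⌋ᵏ (minimum _) K)))
  NfT-kind (app {K = K} {M = M} D E) (app k n) =
    trans (proj₂ (∷-injective (NfT-kind D k))) (sym (⌊sub⌋ᵏ (single M) K))
  NfT-kind (Π D E) (Π _ _) = refl
  NfT-kind (name p) name = refl
  NfT-kind (New p D) (New _) = refl
  NfT-kind (conv D e) k = trans (NfT-kind D k) (sym (⌊⌋ᵏ-≈ e))

  mutual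
    Nf-η : Nf Σ ⌊ Γ ⌋ᶜ M ρ → Σ ⨾ Γ ⊢ᵒ M ⟶η N → HasRedexᵒ N
    Nf-η (ne m) s with Ne-η m s
    ... | inj₂ h = h
    Nf-η (lam k e m) (η D) with lam ← intro-type {ρ = o ⇒ o} lam D = lam₂ β
    Nf-η (lam k e m) (η# D) with () ← intro-type {ρ = o ⇒ o} lam D
    Nf-η (abs m) (η D) with () ← intro-type {ρ = ν o} abs D
    Nf-η (abs m) (η# D) = abs β#
    Nf-η (lam k e m) (lam₁ s) = lam₁ (NfT-η k s)
    Nf-η (lam k refl m) (lam₂ s) = lam₂ (Nf-η m s)
    Nf-η (abs m) (abs s) = abs (Nf-η m s)

    -- Expanding a neutral object at its root yields an introduction form, which turns into a redex
    -- once an elimination surrounds it. If none does, the object is at `o`, where no introduction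
    -- form exists.
    Ne-η : Ne Σ ⌊ Γ ⌋ᶜ M ρ → Σ ⨾ Γ ⊢ᵒ M ⟶η N → Intro N ρ ⊎ HasRedexᵒ N
    Ne-η m (η D) with refl ← Ne-type D m = inj₁ lam
    Ne-η m (η# D) with refl ← Ne-type D m = inj₁ abs
    Ne-η (app m n) (app₁ s) with Ne-η m s
    ... | inj₁ lam = inj₂ β
    ... | inj₂ h   = inj₂ (app₁ h)
    Ne-η (app m n) (app₂ s) = inj₂ (app₂ (Nf-η n s))
    Ne-η (conc m) (conc {θ = θ} r s) with Ne-η (Ne-unren r m) s
    ... | inj₁ abs = inj₂ β#
    ... | inj₂ h   = inj₂ (conc (HasRedexᵒ-ren θ h))

    NfT-η : NfT Σ ⌊ Γ ⌋ᶜ A κ → Σ ⨾ Γ ⊢ᵗ A ⟶η B → HasRedexᵗ B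
    NfT-η (app k n) (app₁ s) = app₁ (NfT-η k s)
    NfT-η (app k n) (app₂ s) = app₂ (Nf-η n s)
    NfT-η (Π k k′) (Π₁ s)    = Π₁ (NfT-η k s)
    NfT-η (Π k k′) (Π₂ s)    = Π₂ (NfT-η k′ s)
    NfT-η (New k) (New s)    = New (NfT-η k s)

  Nf-canonical : Nf Σ ⌊ Γ ⌋ᶜ M ρ → Canonicalᵒ Σ Γ M
  Nf-canonical n = Nf-¬HasRedex n , Nf-η n

  NfT-canonical : NfT Σ ⌊ Γ ⌋ᶜ A κ → Canonicalᵗ Σ Γ A
  NfT-canonical n = NfT-¬HasRedex n , NfT-η n

  ¬Intro : Obj s → Set
  ¬Intro M = ∀ {ρ} → ¬ Intro M ρ

  redex-η : ¬Intro M → HasRedexᵒ (ƛ A (renᵒ weaken M · ` here refl)) → HasRedexᵗ A ⊎ HasRedexᵒ M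
  redex-η {M = M} i (lam₁ h) = inj₁ h
  redex-η {M = ƛ _ _} i (lam₂ β) = ⊥-elim (i {o ⇒ o} lam)
  redex-η {M = M} i (lam₂ (app₁ h)) = inj₂ (HasRedexᵒ-unren weaken h)

  redex-η# : ¬Intro M → HasRedexᵒ (⟨ α ⟩ (renᵒ weaken M ＠ here refl)) → HasRedexᵒ M
  redex-η# {M = ⟨ _ ⟩ _} i (abs β#) = ⊥-elim (i {ν o} abs)
  redex-η# {M = M} i (abs (conc h)) = HasRedexᵒ-unren weaken h

  -- The η-expansion must be taken at a normal form of the type: otherwise its annotation may
  -- contain a redex, and canonicity of M says nothing.
  neutral-base : Σ ⊢ Γ ctx → Σ ⨾ Γ ⊢ᵒ M ∶ A → Canonicalᵒ Σ Γ M → ¬Intro M → ⌊ A ⌋ ≡ o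
  neutral-base {Γ = Γ} {M = M} {A = A} G D (nr , η-redex) i with B , e , n ← exists-normalᵗ G (validity G D) =
    trans (⌊⌋-≈ e) (base n (conv D e))
    where
    base : NfT Σ ⌊ Γ ⌋ᶜ B [] → Σ ⨾ Γ ⊢ᵒ M ∶ B → ⌊ B ⌋ ≡ o
    base (con _ _) E = refl
    base (app k _) E = NfT-family k
    base (Π k _) E with redex-η i (η-redex (η E))
    ... | inj₁ h = ⊥-elim (NfT-¬HasRedex k h)
    ... | inj₂ h = ⊥-elim (nr h)
    base name E = refl
    base (New k) E = ⊥-elim (nr (redex-η# i (η-redex (η# E))))

  IsIntro : Obj s → Set
  IsIntro M = ∃[ ρ ] Intro M ρ

  mutual
    canonical-Nf : Σ ⊢ Γ ctx → Σ ⨾ Γ ⊢ᵒ M ∶ A → Canonicalᵒ Σ Γ M → Nf Σ ⌊ Γ ⌋ᶜ M ⌊ A ⌋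
    canonical-Nf G (lam {A = A} {M = M} D E) (nr , c) = lam
      (canonical-NfT G D ((λ h → nr (lam₁ h)) , λ s → case₁ (c (lam₁ s)))) refl
      (canonical-Nf (G ▸ D) E ((λ h → nr (lam₂ h)) , λ s → case₂ (c (lam₂ s))))
      where
      case₁ : HasRedexᵒ (ƛ A′ M) → HasRedexᵗ A′
      case₁ (lam₁ h) = h
      case₁ (lam₂ h) = ⊥-elim (nr (lam₂ h))
      case₂ : HasRedexᵒ (ƛ A M′) → HasRedexᵒ M′
      case₂ (lam₁ h) = ⊥-elim (nr (lam₁ h))
      case₂ (lam₂ h) = h
    canonical-Nf G (abs p D) (nr , c) =
      abs (canonical-Nf (G # p) D ((λ h → nr (abs h)) , λ s → case (c (abs s))))
      where
      case : HasRedexᵒ (⟨ α ⟩ M′) → HasRedexᵒ M′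
      case (abs h) = h
    canonical-Nf G (conv D e) c = subst (Nf Σ _ _) (⌊⌋-≈ e) (canonical-Nf G D c)
    canonical-Nf G D@(con _) c    = neutral-Nf G D c λ ()
    canonical-Nf G D@(var _) c    = neutral-Nf G D c λ ()
    canonical-Nf G D@(nm _) c     = neutral-Nf G D c λ ()
    canonical-Nf G D@(app _ _) c  = neutral-Nf G D c λ ()
    canonical-Nf G D@(conc _ _) c = neutral-Nf G D c λ ()

    neutral-Nf : Σ ⊢ Γ ctx → Σ ⨾ Γ ⊢ᵒ M ∶ A → Canonicalᵒ Σ Γ M → ¬Intro M → Nf Σ ⌊ Γ ⌋ᶜ M ⌊ A ⌋
    neutral-Nf {Γ = Γ} {M = M} G D c i = subst (Nf Σ ⌊ Γ ⌋ᶜ M) (sym A≡o)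
      (ne (subst (Ne Σ ⌊ Γ ⌋ᶜ M) A≡o (canonical-Ne G D (proj₁ c) i (λ s → inj₂ (proj₂ c s)))))
      where A≡o = neutral-base G D c i

    -- The head of an elimination need not be canonical by itself, since expanding it at the root
    -- creates a redex only with the elimination around it. The hypothesis therefore also admits an
    -- introduction form as the result of an expansion.
    canonical-Ne : Σ ⊢ Γ ctx → Σ ⨾ Γ ⊢ᵒ M ∶ A → ¬ HasRedexᵒ M → ¬Intro M →
      (∀ {N} → Σ ⨾ Γ ⊢ᵒ M ⟶η N → IsIntro N ⊎ HasRedexᵒ N) → Ne Σ ⌊ Γ ⌋ᶜ M ⌊ A ⌋
    canonical-Ne G (con {A = A} p) nr i c = con p (sym (⌊ren⌋ (minimum _) A))
    canonical-Ne G (var p) nr i c = var (⌊⌋ᶜ-∋ p)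
    canonical-Ne G (nm p) nr i c = nm
    canonical-Ne G (lam D E) nr i c = ⊥-elim (i {o ⇒ o} lam)
    canonical-Ne {Γ = Γ} G (app {B = B} {M = M} {N = N} D E) nr i c =
      subst (Ne Σ ⌊ Γ ⌋ᶜ (M · N)) (sym (⌊sub⌋ (single N) B))
        (app (canonical-Ne G D (λ h → nr (app₁ h)) head-¬Intro (λ s → head-η (c (app₁ s))))
             (canonical-Nf G E ((λ h → nr (app₂ h)) , λ s → arg-η (c (app₂ s)))))
      where
      head-¬Intro : ¬Intro M
      head-¬Intro lam = nr β
      head-¬Intro abs with () ← intro-type {ρ = ν o} abs D
      head-η : IsIntro (M′ · N) ⊎ HasRedexᵒ (M′ · N) → IsIntro M′ ⊎ HasRedexᵒ M′
      head-η (inj₂ β)        = inj₁ (o ⇒ o , lam)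
      head-η (inj₂ (app₁ h)) = inj₂ h
      head-η (inj₂ (app₂ h)) = ⊥-elim (nr (app₂ h))
      arg-η : IsIntro (M · N′) ⊎ HasRedexᵒ (M · N′) → HasRedexᵒ N′
      arg-η (inj₂ β)        = ⊥-elim (nr β)
      arg-η (inj₂ (app₁ h)) = ⊥-elim (nr (app₁ h))
      arg-η (inj₂ (app₂ h)) = h
    canonical-Ne G (abs p D) nr i c = ⊥-elim (i {ν o} abs)
    canonical-Ne {Γ = Γ} G (conc {θ = θ} {a = a} {B = B} {M = M} r D) nr i c =
      subst (Ne Σ ⌊ Γ ⌋ᶜ (renᵒ θ M ＠ a)) (sym (trans (⌊sub⌋ (single a) (renᵗ (refl ∷ θ) B)) (⌊ren⌋ (refl ∷ θ) B)))
        (conc (Ne-ren {θ = θ} (⌊⌋ᶜ-⊆ᶜ (restriction-⊆ᶜ r))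
          (canonical-Ne (ctx-restrict G r) D (λ h → nr (conc (HasRedexᵒ-ren θ h))) head-¬Intro
            (λ s → head-η (c (conc r s))))))
      where
      head-¬Intro : ¬Intro M
      head-¬Intro abs = nr β#
      head-¬Intro lam with () ← intro-type {ρ = o ⇒ o} lam D
      head-η : ∀ {M′} → IsIntro (renᵒ θ M′ ＠ a) ⊎ HasRedexᵒ (renᵒ θ M′ ＠ a) → IsIntro M′ ⊎ HasRedexᵒ M′
      head-η {⟨ _ ⟩ _} (inj₂ β#) = inj₁ (ν o , abs)
      head-η {M′} (inj₂ (conc h)) = inj₂ (HasRedexᵒ-unren θ h)
    canonical-Ne G (conv D e) nr i c = subst (Ne Σ _ _) (⌊⌋-≈ e) (canonical-Ne G D nr i c)

    canonical-NfT : Σ ⊢ Γ ctx → Σ ⨾ Γ ⊢ᵗ A ∶ K → Canonicalᵗ Σ Γ A → NfT Σ ⌊ Γ ⌋ᶜ A ⌊ K ⌋ᵏ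
    canonical-NfT G (con {K = K} p) c = con p (sym (⌊ren⌋ᵏ (minimum _) K))
    canonical-NfT {Γ = Γ} G (app {A = A} {K = K} {M = M} D E) (nr , c) =
      subst (NfT Σ ⌊ Γ ⌋ᶜ (A · M)) (sym (⌊sub⌋ᵏ (single M) K))
        (app (canonical-NfT G D ((λ h → nr (app₁ h)) , λ s → case₁ (c (app₁ s))))
             (canonical-Nf G E ((λ h → nr (app₂ h)) , λ s → case₂ (c (app₂ s)))))
      where
      case₁ : HasRedexᵗ (A′ · M) → HasRedexᵗ A′
      case₁ (app₁ h) = h
      case₁ (app₂ h) = ⊥-elim (nr (app₂ h))
      case₂ : HasRedexᵗ (A · M′) → HasRedexᵒ M′
      case₂ (app₁ h) = ⊥-elim (nr (app₁ h))
      case₂ (app₂ h) = h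
    canonical-NfT G (Π {A = A} {B = B} D E) (nr , c) = Π
      (canonical-NfT G D ((λ h → nr (Π₁ h)) , λ s → case₁ (c (Π₁ s))))
      (canonical-NfT (G ▸ D) E ((λ h → nr (Π₂ h)) , λ s → case₂ (c (Π₂ s))))
      where
      case₁ : HasRedexᵗ (Π A′ B) → HasRedexᵗ A′
      case₁ (Π₁ h) = h
      case₁ (Π₂ h) = ⊥-elim (nr (Π₂ h))
      case₂ : HasRedexᵗ (Π A B′) → HasRedexᵗ B′
      case₂ (Π₁ h) = ⊥-elim (nr (Π₁ h))
      case₂ (Π₂ h) = h
    canonical-NfT G (name p) c = name
    canonical-NfT G (New p D) (nr , c) = New (canonical-NfT (G # p) D ((λ h → nr (New h)) , λ s → case (c (New s))))
      where
      case : HasRedexᵗ (New α B′) → HasRedexᵗ B′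
      case (New h) = h
    canonical-NfT G (conv D e) c = subst (NfT Σ _ _) (sym (⌊⌋ᵏ-≈ e)) (canonical-NfT G D c)

-- Recovering annotations from types

module Uniqueness {Σ : Sig} (S : ⊢ Σ sig) where
  open Inversion S
  open Canonicity S
  open Completeness S

  mutual
    -- The pattern is bidirectional. Normal objects are compared at a common type, which dictates
    -- the annotations; neutral objects have none at the head and may be compared at unrelated
    -- types, since their heads synthesise them.
    unstripᵒ : Σ ⊢ Γ ctx → Σ ⨾ Γ ⊢ᵒ M ∶ A → Nf Σ ⌊ Γ ⌋ᶜ M ρ → Σ ⨾ Γ ⊢ᵒ N ∶ A → Nf Σ ⌊ Γ ⌋ᶜ N ρ →
      stripᵒ M ≡ stripᵒ N → M ≡ N
    unstripᵒ G D (ne m) E (ne n) e = unstrip-ne G D m E n e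
    unstripᵒ G (conv D f) m@(lam _ _ _) E n e = unstripᵒ G D m (conv E (≈-sym f)) n e
    unstripᵒ G (conv D f) m@(abs _) E n e = unstripᵒ G D m (conv E (≈-sym f)) n e
    unstripᵒ G (lam D D′) (lam k refl m) E (lam l f n) e
      with _ , E₁ , E₂ , g ← invert-ƛ G E with g₁ , g₂ ← Π-injective g
      -- Both annotations are equal to the domain of the common type, so completeness gives them the
      -- same stripped form, and the recursive call makes them identical.
      with refl ← unstripᵗ G D k E₁ l (≈-stripᵗ (≈-sym g₁) k l) =
      cong (ƛ _) (unstripᵒ (G ▸ D) D′ m (conv E₂ g₂) n (proj₂ (ƛ-inj e)))
    unstripᵒ G (abs p D) (abs m) E (abs n) e
      -- Stripping has erased the name type of the abstraction; it is read off the common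
      -- `New`-type.
      with _ , _ , E₁ , g ← invert-⟨⟩ G E with refl , g₁ ← New-injective g =
      cong (⟨ _ ⟩_) (unstripᵒ (G # p) D m (conv E₁ g₁) n (proj₂ (⟨⟩-inj e)))

    unstrip-ne : Σ ⊢ Γ ctx → Σ ⨾ Γ ⊢ᵒ M ∶ A → Ne Σ ⌊ Γ ⌋ᶜ M ρ → Σ ⨾ Γ ⊢ᵒ N ∶ B → Ne Σ ⌊ Γ ⌋ᶜ N ϕ →
      stripᵒ M ≡ stripᵒ N → M ≡ N
    unstrip-ne G (conv D f) m E n e = unstrip-ne G D m E n e
    unstrip-ne G (con p) m E (con _ _) refl = refl
    unstrip-ne G (var p) m E (var _) refl = refl
    unstrip-ne G (nm p) m E nm refl = refl
    unstrip-ne {Γ = Γ} G (app D D′) (app m m′) E (app n n′) e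
      with _ , _ , E₁ , E₂ , _ ← invert-· G E
      with refl ← unstrip-ne G D m E₁ n (proj₁ (·ᵒ-inj e))
      -- Now that the function parts coincide, uniqueness of types makes their domains equal, and
      -- the arguments can be compared at one type.
      with g , _ ← Π-injective (unique-type G D E₁) =
      cong (_ ·_) (unstripᵒ G D′ m′ (conv E₂ (≈-sym g))
        (subst (Nf Σ ⌊ Γ ⌋ᶜ _) (trans (proj₁ (⇒-inj (Ne-type E₁ n))) (trans (sym (⌊⌋-≈ g)) (sym (proj₁ (⇒-inj (Ne-type D m)))))) n′) (proj₂ (·ᵒ-inj e)))
    unstrip-ne G (conc {θ = θ} {M = M} r D) (conc m) E (conc n) e
      with refl ← proj₂ (＠-inj e)
      with concretion {head = N} r′ E′ refl _ ← invert-＠ E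
      with refl ← restriction-unique r r′ =
      cong (λ M → renᵒ θ M ＠ _) (unstrip-ne (ctx-restrict G r) D (Ne-unren r m) E′ (Ne-unren r n)
        (renᵒ-inj θ (trans (sym (stripᵒ-ren θ M)) (trans (proj₁ (＠-inj e)) (stripᵒ-ren θ N)))))

    unstripᵗ : ∀ {κ′} → Σ ⊢ Γ ctx → Σ ⨾ Γ ⊢ᵗ A ∶ K → NfT Σ ⌊ Γ ⌋ᶜ A κ → Σ ⨾ Γ ⊢ᵗ B ∶ L → NfT Σ ⌊ Γ ⌋ᶜ B κ′ →
      stripᵗ A ≡ stripᵗ B → A ≡ B
    unstripᵗ G (conv D f) m E n e = unstripᵗ G D m E n e
    unstripᵗ G (con p) m E (con _ _) refl = refl
    unstripᵗ {Γ = Γ} G (app D D′) (app m m′) E (app n n′) e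
      with _ , _ , E₁ , E₂ , _ ← invert-Ty-· G E
      with refl ← unstripᵗ G D m E₁ n (proj₁ (·ᵗ-inj e))
      with _ , _ , refl , g , _ ← Πᵏ-≈ (unique-kind G D E₁) refl =
      cong (_ ·_) (unstripᵒ G D′ m′ (conv E₂ (≈-sym g))
        (subst (Nf Σ ⌊ Γ ⌋ᶜ _) (trans (proj₁ (∷-injective (NfT-kind E₁ n))) (trans (sym (⌊⌋-≈ g)) (sym (proj₁ (∷-injective (NfT-kind D m)))))) n′) (proj₂ (·ᵗ-inj e)))
    unstripᵗ G (Π D D′) (Π m m′) E (Π n n′) e
      with E₁ , E₂ ← Π-formation E
      with refl ← unstripᵗ G D m E₁ n (proj₁ (Πᵗ-inj e)) =
      cong (Π _) (unstripᵗ (G ▸ D) D′ m′ E₂ n′ (proj₂ (Πᵗ-inj e)))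
    unstripᵗ G (name p) m E name refl = refl
    unstripᵗ G (New p D) (New m) E (New n) e
      with refl ← proj₁ (New-inj e) =
      cong (New _) (unstripᵗ (G # p) D m (proj₂ (New-formation E)) n (proj₂ (New-inj e)))

theorem4p18 : ∀ (Σ : Sig) {s : Scope} (Γ : Ctx s) (M : Obj s) (A : Ty s) →
    ⊢ Σ sig → Σ ⊢ Γ ctx →
    CanonicalSig Σ → CanonicalCtx Σ Γ →
    Σ ⨾ Γ ⊢ᵒ M ∶ A →
    ∃! _≡_ λ ((A′ , M′) : Ty s × Obj s) →
    Canonicalᵗ Σ Γ A′ × Canonicalᵒ Σ Γ M′ ×
    (Σ ⨾ Γ ⊢ᵗ A ≈ A′ ∶ type) × (Σ ⨾ Γ ⊢ᵒ M ≈ M′ ∶ A′)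
theorem4p18 Σ Γ M A S G _ _ D = (A₀ , M₀) ,
  (NfT-canonical A₀-nf , Nf-canonical M₀-nf , A≈A₀ , conv M≈M₀ A≈A₀) , unique
  where
  open Inversion S
  open Existence S
  open Canonicity S
  open Completeness S
  open Uniqueness S

  normal-type = exists-normalᵗ G (validity G D)
  normal-obj  = exists-normalᵒ G D

  A₀ = proj₁ normal-type
  A≈A₀ = proj₁ (proj₂ normal-type)
  A₀-nf = proj₂ (proj₂ normal-type)
  M₀ = proj₁ normal-obj
  M≈M₀ = proj₁ (proj₂ normal-obj)
  M₀-nf = proj₂ (proj₂ normal-obj)

  unique : ∀ {X : Ty _ × Obj _} → let A′ , M′ = X in
    Canonicalᵗ Σ Γ A′ × Canonicalᵒ Σ Γ M′ × (Σ ⨾ Γ ⊢ᵗ A ≈ A′ ∶ type) × (Σ ⨾ Γ ⊢ᵒ M ≈ M′ ∶ A′) →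
    (A₀ , M₀) ≡ X
  unique {A₁ , M₁} (A₁-can , M₁-can , A≈A₁ , M≈M₁) = cong₂ _,_
    (unstripᵗ G D₀ A₀-nf D₁ A₁-nf (≈-stripᵗ (≈-trans (≈-sym A≈A₀) A≈A₁) A₀-nf A₁-nf))
    (unstripᵒ G E₀ M₀-nf E₁ M₁-nf (≈-strip (≈-trans (≈-sym M≈M₀) M≈M₁′) M₀-nf M₁-nf))
    where
    D₀ = proj₁ (proj₂ (regularᵗ G A≈A₀))
    D₁ = proj₁ (proj₂ (regularᵗ G A≈A₁))
    A₁-nf = canonical-NfT G D₁ A₁-can
    -- Moved back to `A`, so that both canonical objects are normalised and compared at the same
    -- type, whichever canonical type was proposed.
    M≈M₁′ = conv M≈M₁ (≈-sym A≈A₁)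
    E₀ = proj₁ (proj₂ (regularᵒ G M≈M₀))
    E₁ = proj₁ (proj₂ (regularᵒ G M≈M₁′))
    M₁-nf = canonical-Nf G E₁ M₁-can
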